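{- Let $\mathbb F_q$ be a finite field with $q$ elements, let $n\ge 2$, let $a_1,\dots,a_n,b\in\mathbb F_q^*$ and let $k,k_1,\dots,k_n,m_1,\dots,m_n$ be positive integers. Let $N_q$ be the number of solutions $(x_1,\dots,x_n)\in\mathbb F_q^n$ of $$(a_1x_1^{m_1}+\dots+a_nx_n^{m_n})^k=bx_1^{k_1}\cdots x_n^{k_n}.$$ Let $d_j=\gcd(m_j,q-1)$, $M=\mathrm{lcm}[m_1,\dots,m_n]$ and $k_0=\gcd(k,k_1,\dots,k_n,q-1)$. Assume that for some $0\le t\le n$, $d_1,\dots,d_t$ are odd, $d_{t+1},\dots,d_n$ are even, and $d_1,\dots,d_t,d_{t+1}/2,\dots,d_n/2$ are pairwise coprime; that $b$ is a $k_0$th power in $\mathbb F_q$; and that $$\gcd\Bigl(\sum_{j=1}^n\frac{k_jM}{k_0m_j}-\frac{kM}{k_0},\ \frac{k_1(q-1)}{k_0d_1},\dots,\frac{k_n(q-1)}{k_0d_n},\ \frac{q-1}{k_0}\Bigr)=1.$$ Then: if $t=0$ and $n$ is even, $$N_q=q^{n-1}-1+\frac{(k_0-1)((q-1)^n-1)}{q}-k_0\eta((-1)^{n/2}a_1\cdots a_n)q^{(n-2)/2}-(k_0+q-1)\sum_{j=1}^{(n-2)/2}\eta((-1)^j)\sigma_{2j}(\eta(a_1),\dots,\eta(a_n))q^{j-1};$$ if $t=n$, $$N_q=q^{n-1}-(-1)^n+\frac{(k_0-1)((q-1)^n-(-1)^n)}{q};$$ otherwise $$N_q=q^{n-1}-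(-1)^n+\frac{(k_0-1)((q-1)^n-(-1)^n)}{q}-(-1)^n(k_0+q-1)\sum_{j=1}^{[(n-t)/2]}\eta((-1)^j)\sigma_{2j}(\eta(a_{t+1}),\dots,\eta(a_n))q^{j-1}.$$
   Context: For $q$ odd, $\eta$ is the quadratic character of $\mathbb F_q$: $\eta(x)=1,-1,0$ according as $x$ is a nonzero square, a nonsquare, or $0$ (in the cases where $\eta$ appears, some $d_j$ is even, so $q$ is odd). $\sigma_{2j}(z_1,\dots,z_r)$ denotes the elementary symmetric polynomial of degree $2j$ in $z_1,\dots,z_r$. $[x]$ denotes the integer part; empty sums are $0$. -}

module Defs where

open import Level using (Level; _⊔_) renaming (suc to lsuc)
open import Algebra.Bundles using (CommutativeRing)
import Algebra.Definitions.RawMonoid as RawMonoidDefs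
import Algebra.Properties.Semiring.Exp as Exp
open import Data.Bool.Base using (if_then_else_)
open import Data.Fin.Base using (Fin; finToFun; toℕ)
open import Data.Fin.Properties using (any?; nonZeroIndex; _≟_)
open import Data.Integer.Base as ℤ using (ℤ; +_; 0ℤ; 1ℤ; -1ℤ)
import Data.Integer.GCD as ℤ
open import Data.List.Base using (List; []; _∷_; [_]; _++_; map; foldr; filter; length; tabulate; allFin; upTo)
open import Data.Nat.Base using (ℕ; zero; suc; NonZero; ≢-nonZero; ≢-nonZero⁻¹; _*_; _∸_; _^_; _/_)
open import Data.Nat.GCD using (gcd; gcd[m,n]≢0)
open import Data.Nat.LCM using (lcm)
open import Data.Nat.ListAction using (sum)
open import Data.Nat.Properties using (m*n≢0; _<?_)
open import Data.Product.Base using (∃)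
open import Data.Rational.Base as ℚ using (ℚ)
open import Data.Sum.Base using (inj₁)
open import Function.Base using (_∘_)
open import Function.Bundles using (Inverse)
open import Function.Properties.Inverse using (Inverse⇒Injection) renaming (sym to inverse-sym)
open import Relation.Binary.Definitions using (Decidable)
open import Relation.Binary.PropositionalEquality.Properties using (setoid)
open import Relation.Nullary.Decidable using (Dec; does; via-injection)

record FiniteField (c ℓ : Level) : Set (lsuc (c ⊔ ℓ)) where
  field
    commutativeRing : CommutativeRing c ℓ

  open CommutativeRing commutativeRing public
    using (Carrier; _≈_; _≉_; 0#; 1#)
    renaming (_+_ to _+ᶠ_; _*_ to _*ᶠ_; -_ to -ᶠ_)
  private
    module R = CommutativeRing commutativeRing

  field
    1≉0         : 1# ≉ 0#
    inverse     : ∀ x → x ≉ 0# → ∃ λ y → x *ᶠ y ≈ 1#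
    q           : ℕ
    enumeration : Inverse (setoid (Fin q)) R.setoid

  open Inverse enumeration public using () renaming (to to element; from to index)

  instance
    q≢0 : NonZero q
    q≢0 = nonZeroIndex (index 0#)

  infix 4 _≈?_
  _≈?_ : Decidable _≈_
  _≈?_ = via-injection (Inverse⇒Injection (inverse-sym enumeration)) _≟_

  open Exp R.semiring public using () renaming (_^_ to _^ᶠ_)

  ∑ᶠ ∏ᶠ : ∀ {n} → (Fin n → Carrier) → Carrier
  ∑ᶠ = RawMonoidDefs.sum R.+-rawMonoid
  ∏ᶠ = RawMonoidDefs.sum R.*-rawMonoid

  square? : ∀ x → Dec (∃ λ i → element i *ᶠ element i ≈ x)
  square? x = any? (λ i → element i *ᶠ element i ≈? x)

  -- This is the quadratic character only for odd q.
  η : Carrier → ℤ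
  η x = if does (x ≈? 0#) then 0ℤ else
        if does (square? x) then 1ℤ else -1ℤ

  -- Fin (q ^ n) enumerates the points of Fⁿ up to pointwise _≈_.
  point : ∀ {n} → Fin (q ^ n) → Fin n → Carrier
  point i = element ∘ finToFun i

  solutionCount : ∀ {n} (a : Fin n → Carrier) (b : Carrier) (k : ℕ) (κ m : Fin n → ℕ) → ℕ
  solutionCount {n} a b k κ m = length (filter (solution? ∘ point) (allFin (q ^ n)))
    where
    Solution : (Fin n → Carrier) → Set ℓ
    Solution x = (∑ᶠ λ j → a j *ᶠ (x j ^ᶠ m j)) ^ᶠ k ≈ b *ᶠ (∏ᶠ λ j → x j ^ᶠ κ j)

    solution? : ∀ x → Dec (Solution x)
    solution? x = _ ≈? _

gcds lcms : List ℕ → ℕ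
gcds = foldr gcd 0
lcms = foldr lcm 1

module Exponents (q : ℕ) {n : ℕ} (k : ℕ) (κ m : Fin n → ℕ)
                 (k≢0 : NonZero k) (m≢0 : ∀ j → NonZero (m j)) where

  d : Fin n → ℕ
  d j = gcd (m j) (q ∸ 1)

  M : ℕ
  M = lcms (tabulate m)

  k₀ : ℕ
  k₀ = gcds (k ∷ tabulate κ ++ [ q ∸ 1 ])

  d≢0 : ∀ j → NonZero (d j)
  d≢0 j = ≢-nonZero (gcd[m,n]≢0 (m j) (q ∸ 1) (inj₁ (≢-nonZero⁻¹ (m j) {{m≢0 j}})))

  k₀≢0 : NonZero k₀
  k₀≢0 = ≢-nonZero (gcd[m,n]≢0 k (gcds (tabulate κ ++ [ q ∸ 1 ])) (inj₁ (≢-nonZero⁻¹ k {{k≢0}})))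

  k₀*m≢0 : ∀ j → NonZero (k₀ * m j)
  k₀*m≢0 j = m*n≢0 k₀ (m j) {{k₀≢0}} {{m≢0 j}}

  k₀*d≢0 : ∀ j → NonZero (k₀ * d j)
  k₀*d≢0 j = m*n≢0 k₀ (d j) {{k₀≢0}} {{d≢0 j}}

  -- All divisions here are exact: k₀ divides k, every κ j and q ∸ 1,
  -- while m j divides M and d j divides q ∸ 1.
  -- The first entry can be negative, hence the gcd in ℤ.
  exponentGcd : ℤ
  exponentGcd = ℤ.gcd
    (+ sum (tabulate λ j → ((κ j * M) / (k₀ * m j)) {{k₀*m≢0 j}})
      ℤ.- + ((k * M) / k₀) {{k₀≢0}})
    (+ gcds (tabulate (λ j → ((κ j * (q ∸ 1)) / (k₀ * d j)) {{k₀*d≢0 j}})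
             ++ [ ((q ∸ 1) / k₀) {{k₀≢0}} ]))

  -- With t counting the leading indices: d j for the first t, d j / 2 for the others.
  halved : ℕ → Fin n → ℕ
  halved t j = if does (toℕ j <? t) then d j else d j / 2

combinations : ∀ {a} {A : Set a} → ℕ → List A → List (List A)
combinations zero    _        = [ [] ]
combinations (suc r) []       = []
combinations (suc r) (x ∷ xs) = map (x ∷_) (combinations r xs) ++ combinations (suc r) xs

∑ℤ ∏ℤ : List ℤ → ℤ
∑ℤ = foldr ℤ._+_ 0ℤ
∏ℤ = foldr ℤ._*_ 1ℤ

σ : ℕ → List ℤ → ℤ
σ r zs = ∑ℤ (map ∏ℤ (combinations r zs))

-- ∑₁ J f = f 1 + ⋯ + f J
∑₁ : ℕ → (ℕ → ℤ) → ℤ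
∑₁ J f = ∑ℤ (map (f ∘ suc) (upTo J))

ι : ℤ → ℚ
ι z = z ℚ./ 1

{-# OPTIONS --safe #-}
module Submission where

-- Write A and A* for the numbers of zeros of ∑ a_j x_j^{m_j} in F^n and in the torus (F*)^n.
-- A solution with a vanishing coordinate is a zero of the form, so N = N* + A − A*, where N* counts
-- the solutions in the torus.
-- Bézout applied to the exponent gcd gives, for each s in F*, a scaling of the coordinates that
-- multiplies the form by some μ and the ratio b x^κ / (form)^k by s^{k₀}; as that ratio is always
-- a k₀-th power, (q − 1) N* = k₀ ((q − 1)^n − A*).
-- By the coprimality of the halved d_j, any x_1^{e_1}, …, x_n^{e_n} (e_j = 1 or 2 for d_j odd or
-- even) become m_j-th powers on multiplication by a common s; averaging over the torus replaces
-- each m_j by e_j.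
-- Finally, the numbers of points with ∑ a_j x_j^{e_j} = c form a function of c in the span of δ, 1
-- and η, which is closed under convolution (η ∗ η = η(−1) (q δ − 1)), so that adding one variable
-- multiplies α + γ g, with g² = η(−1) q, by η(a_j) g − 1 (torus) or η(a_j) g (all of F).

open import Defs
open import Algebra.Bundles using (AbelianGroup; CommutativeMonoid; CommutativeRing)
open import Algebra.Bundles.Raw using (RawRing)
import Algebra.Morphism.RingMonomorphism as RingMonomorphism
open import Algebra.Morphism.Structures using (IsRingMonomorphism)
import Algebra.Properties.CommutativeMonoid.Sum as CommutativeMonoidSum
import Algebra.Properties.CommutativeSemigroup as CommutativeSemigroupProperties
import Algebra.Properties.CommutativeSemiring.Exp as Exp
import Algebra.Properties.Group as GroupProperties
import Algebra.Properties.Ring as RingProperties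
import Algebra.Properties.Semiring.Sum as SemiringSum
import Algebra.Solver.Ring.NaturalCoefficients.Default as SemiringSolver
open import Algebra.Structures using (IsCommutativeRing)
open import Data.Bool.Base using (true; false; if_then_else_)
open import Data.Fin.Base using (Fin; zero; suc; toℕ; fromℕ<; combine; finToFun; _↑ˡ_; _↑ʳ_)
open import Data.Fin.Permutation as Permutation using (Permutation; _⟨$⟩ʳ_)
import Data.Fin.Properties as Fin
open import Data.Integer.Base as ℤ using (ℤ; +_; 0ℤ; 1ℤ; -1ℤ; _+_; _-_; _*_; -_; _^_)
import Data.Integer.Properties as ℤ
open import Data.Integer.Tactic.RingSolver using (solve-∀)
open import Data.List.Base as List using (List; []; _∷_; [_]; _++_; filter; length; map; upTo; drop; tabulate)
import Data.List.Properties as List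
open import Data.List.Relation.Unary.All as All using (All; []; _∷_)
import Data.List.Relation.Unary.All.Properties as All
open import Data.Nat.Base as ℕ using (ℕ; zero; suc; NonZero; _≤_; _<_; z≤n; s≤s; _∸_; _/_)
open import Data.Nat.Coprimality as Coprimality using (Coprime; coprime⇒gcd≡1; coprime-divisor)
open import Data.Nat.Divisibility using (_∣_; _∤_; divides; quotient; ∣-refl; ∣-trans; ∣-reflexive; ∣n⇒∣m*n; ∣m⇒∣m*n; *-pres-∣; ∣⇒≤; 0∣⇒≡0)
open import Data.Nat.DivMod using (_%_; m*n/n≡m; m/n*n≡m; m*[n/m]≡n; /-congˡ; m≡m%n+[m/n]*n; m%n<n)
open import Data.Nat.GCD using (gcd; gcd-GCD; module Bézout; gcd[m,n]∣m; gcd[m,n]∣n; c*gcd[m,n]≡gcd[cm,cn])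
open import Data.Nat.LCM using (m∣lcm[m,n]; n∣lcm[m,n])
import Data.Nat.ListAction as ℕ
import Data.Nat.Properties as ℕ
open import Data.Product.Base using (∃; _×_; _,_; proj₁; proj₂)
open import Data.Rational.Base as ℚ using (toℚᵘ)
import Data.Rational.Properties as ℚ
open import Data.Rational.Unnormalised.Base as ℚᵘ using (mkℚᵘ; *≡*)
import Data.Rational.Unnormalised.Properties as ℚᵘ
open import Data.Sum.Base using (_⊎_; inj₁; inj₂)
open import Data.Vec.Base as Vec using (Vec; []; _∷_; lookup; replicate)
import Data.Vec.Properties as Vec
open import Function.Base using (_∘_; id)
open import Function.Bundles using (Inverse; mk⇔)
open import Level using (Level; 0ℓ)
open import Relation.Binary.PropositionalEquality using (_≡_; _≢_; refl; sym; trans; cong; cong₂; subst; subst₂; module ≡-Reasoning)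
open import Relation.Nullary.Decidable using (Dec; does; yes; no; toSum; dec-true; dec-false; does-⇔)
open import Relation.Nullary.Negation using (¬_; contradiction)
open import Relation.Unary using (Pred; Decidable)

open GroupProperties (AbelianGroup.group ℤ.+-0-abelianGroup) using (∙-cancelˡ)

private
  variable
    ℓ₁ ℓ₂ : Level

  module ℤ∑ = SemiringSum ℤ.+-*-semiring

⟦_⟧ : {P : Set ℓ₁} → Dec P → ℤ
⟦ P? ⟧ = if does P? then 1ℤ else 0ℤ

module _ {P : Set ℓ₁} (P? : Dec P) where
  ⟦⟧-yes : P → ⟦ P? ⟧ ≡ 1ℤ
  ⟦⟧-yes h = cong (if_then 1ℤ else 0ℤ) (dec-true P? h)

  ⟦⟧-no : ¬ P → ⟦ P? ⟧ ≡ 0ℤ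
  ⟦⟧-no h = cong (if_then 1ℤ else 0ℤ) (dec-false P? h)

  ⟦⟧-cong : {R : Set ℓ₂} (R? : Dec R) → (P → R) → (R → P) → ⟦ P? ⟧ ≡ ⟦ R? ⟧
  ⟦⟧-cong R? to from = cong (if_then 1ℤ else 0ℤ) (does-⇔ (mk⇔ to from) P? R?)

  0≤⟦⟧ : 0ℤ ℤ.≤ ⟦ P? ⟧
  0≤⟦⟧ with does P?
  ... | true  = ℤ.+≤+ ℕ.z≤n
  ... | false = ℤ.+≤+ ℕ.z≤n

module _ {c ℓ} (M : CommutativeMonoid c ℓ) where
  open CommutativeMonoid M
    renaming (refl to ≈-refl; sym to ≈-sym; trans to ≈-trans)
  open CommutativeMonoidSum M

  sum-ε : ∀ {n} (f : Fin n → Carrier) → (∀ i → f i ≈ ε) → sum f ≈ ε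
  sum-ε {n} f h = ≈-trans (sum-cong-≋ h) (sum-replicate-zero n)

  sum-single : ∀ {n} (f : Fin n → Carrier) j → (∀ i → i ≢ j → f i ≈ ε) → sum f ≈ f j
  sum-single {suc n} f zero h =
    ≈-trans (∙-congˡ (sum-ε (f ∘ suc) λ i → h (suc i) λ ())) (identityʳ _)
  sum-single {suc n} f (suc j) h =
    ≈-trans (∙-cong (h zero λ ())
                    (sum-single (f ∘ suc) j λ i i≢j → h (suc i) (i≢j ∘ Fin.suc-injective)))
            (identityˡ _)

opaque
  ∑ : ∀ {n} → (Fin n → ℤ) → ℤ
  ∑ = ℤ∑.sum

opaque
  unfolding ∑

  ∑-empty : (f : Fin 0 → ℤ) → ∑ f ≡ 0ℤ
  ∑-empty f = refl

  ∑-suc : ∀ {n} (f : Fin (suc n) → ℤ) → ∑ f ≡ f zero + ∑ (f ∘ suc)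
  ∑-suc f = refl

  ∑-cong : ∀ {n} {f g : Fin n → ℤ} → (∀ i → f i ≡ g i) → ∑ f ≡ ∑ g
  ∑-cong = ℤ∑.sum-cong-≗

  ∑-permute : ∀ {n} (f : Fin n → ℤ) (π : Permutation n n) → ∑ f ≡ ∑ (λ i → f (π ⟨$⟩ʳ i))
  ∑-permute f π = ℤ∑.sum-permute f π

  ∑-comm : ∀ {m n} (f : Fin m → Fin n → ℤ) → ∑ (λ i → ∑ (f i)) ≡ ∑ (λ j → ∑ λ i → f i j)
  ∑-comm f = ℤ∑.∑-comm f

  ∑-+ : ∀ {n} (f g : Fin n → ℤ) → ∑ (λ i → f i + g i) ≡ ∑ f + ∑ g
  ∑-+ f g = ℤ∑.∑-distrib-+ f g

  ∑-scale : ∀ {n} c (f : Fin n → ℤ) → ∑ (λ i → c * f i) ≡ c * ∑ f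
  ∑-scale c f = sym (ℤ∑.*-distribˡ-sum c f)

  ∑-single : ∀ {n} (f : Fin n → ℤ) j → (∀ i → i ≢ j → f i ≡ 0ℤ) → ∑ f ≡ f j
  ∑-single = sum-single ℤ.+-0-commutativeMonoid

  ∑-zero : ∀ {n} (f : Fin n → ℤ) → (∀ i → f i ≡ 0ℤ) → ∑ f ≡ 0ℤ
  ∑-zero = sum-ε ℤ.+-0-commutativeMonoid

∑-const : ∀ n c → ∑ {n} (λ _ → c) ≡ + n * c
∑-const zero    c = trans (∑-empty _) (sym (ℤ.*-zeroˡ c))
∑-const (suc n) c = trans (∑-suc _) (trans (cong (_+_ c) (∑-const n c)) (sym (ℤ.suc-* (+ n) c)))

∑-mono : ∀ {n} {f g : Fin n → ℤ} → (∀ i → f i ℤ.≤ g i) → ∑ f ℤ.≤ ∑ g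
∑-mono {zero}  {f} {g} h = ℤ.≤-reflexive (trans (∑-empty f) (sym (∑-empty g)))
∑-mono {suc n} {f} {g} h = subst₂ ℤ._≤_ (sym (∑-suc f)) (sym (∑-suc g))
                             (ℤ.+-mono-≤ (h zero) (∑-mono (h ∘ suc)))

∑-++ : ∀ m n (f : Fin (m ℕ.+ n) → ℤ) → ∑ f ≡ ∑ (λ i → f (i ↑ˡ n)) + ∑ (λ i → f (m ↑ʳ i))
∑-++ zero    n f = trans (sym (ℤ.+-identityˡ (∑ f))) (cong (_+ ∑ f) (sym (∑-empty (λ i → f (i ↑ˡ n)))))
∑-++ (suc m) n f = begin
  ∑ f                                                       ≡⟨ ∑-suc f ⟩
  f zero + ∑ (f ∘ suc)                                      ≡⟨ cong (_+_ (f zero)) (∑-++ m n (f ∘ suc)) ⟩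
  f zero + (∑ (λ i → f (suc i ↑ˡ n)) + rest)                   ≡⟨ ℤ.+-assoc (f zero) _ rest ⟨
  (f zero + ∑ (λ i → f (suc i ↑ˡ n))) + rest                   ≡⟨ cong (_+ rest) (∑-suc (λ i → f (i ↑ˡ n))) ⟨
  ∑ (λ i → f (i ↑ˡ n)) + rest                                  ∎
  where
  open ≡-Reasoning
  rest = ∑ (λ i → f (suc m ↑ʳ i))

∑-combine : ∀ m n (f : Fin (m ℕ.* n) → ℤ) → ∑ f ≡ ∑ λ (i : Fin m) → ∑ λ (j : Fin n) → f (combine i j)
∑-combine zero    n f = trans (∑-empty f) (sym (∑-empty _))
∑-combine (suc m) n f = trans (∑-++ n (m ℕ.* n) f)
  (trans (cong (_+_ (∑ λ j → f (j ↑ˡ (m ℕ.* n)))) (∑-combine m n (f ∘ (n ↑ʳ_))))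
         (sym (∑-suc (λ (i : Fin (suc m)) → ∑ λ (j : Fin n) → f (combine i j)))))

length-filter-tabulate : ∀ {a} {A : Set a} {P : Pred A ℓ₁} (P? : Decidable P) {n} (f : Fin n → A) →
  + length (filter P? (List.tabulate f)) ≡ ∑ (λ i → ⟦ P? (f i) ⟧)
length-filter-tabulate P? {zero}  f = sym (∑-empty (λ i → ⟦ P? (f i) ⟧))
length-filter-tabulate P? {suc n} f = trans (step (length-filter-tabulate P? (f ∘ suc)))
                                            (sym (∑-suc (λ i → ⟦ P? (f i) ⟧)))
  where
  step : ∀ {s} → + length (filter P? (List.tabulate (f ∘ suc))) ≡ s →
         + length (filter P? (List.tabulate f)) ≡ ⟦ P? (f zero) ⟧ + s
  step eq with does (P? (f zero))
  ... | true  = cong ℤ.suc eq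
  ... | false = trans eq (sym (ℤ.+-identityˡ _))

-- The sets of exponents e for which x ^ e lies in a fixed subgroup are of this kind.
record CancellativeSubmonoid (J : ℕ → Set ℓ₁) : Set ℓ₁ where
  field
    J-zero   : J 0
    J-add    : ∀ {m n} → J m → J n → J (m ℕ.+ n)
    J-cancel : ∀ {m n} → J (m ℕ.+ n) → J n → J m

  J-mult : ∀ m {n} → J n → J (m ℕ.* n)
  J-mult zero    h = J-zero
  J-mult (suc m) h = J-add h (J-mult m h)

  J-gcd : ∀ {m n} → J m → J n → J (gcd m n)
  J-gcd {m} {n} hm hn with Bézout.identity (gcd-GCD m n)
  ... | Bézout.+- x y eq = J-cancel (subst J (sym eq) (J-mult x hm)) (J-mult y hn)
  ... | Bézout.-+ x y eq = J-cancel (subst J (sym eq) (J-mult y hn)) (J-mult x hm)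

  J-gcds : ∀ {l} → All J l → J (gcds l)
  J-gcds []       = J-zero
  J-gcds (h ∷ hs) = J-gcd h (J-gcds hs)

  J-∣ : ∀ {m n} → m ∣ n → J m → J n
  J-∣ (divides c eq) h = subst J (sym eq) (J-mult c h)

-- With Fin q as the carrier, equality is _≡_ and functions on the field need no congruence proofs.
record FinField (q : ℕ) : Set where
  infixl 6 _+ᶠ_
  infixl 7 _*ᶠ_
  infix  8 -ᶠ_
  field
    _+ᶠ_ _*ᶠ_         : Fin q → Fin q → Fin q
    -ᶠ_               : Fin q → Fin q
    0# 1#             : Fin q
    isCommutativeRing : IsCommutativeRing _≡_ _+ᶠ_ _*ᶠ_ -ᶠ_ 0# 1#
    1≢0               : 1# ≢ 0#
    inverse           : ∀ x → x ≢ 0# → ∃ λ y → x *ᶠ y ≡ 1#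

  commutativeRing : CommutativeRing 0ℓ 0ℓ
  commutativeRing = record { isCommutativeRing = isCommutativeRing }

module FinFieldProperties {q : ℕ} (𝔽 : FinField q) where
  open FinField 𝔽 public
  open CommutativeRing commutativeRing public
    using ( +-assoc; +-comm; +-identityˡ; +-identityʳ; -‿inverseˡ; -‿inverseʳ
          ; *-assoc; *-comm; *-identityˡ; *-identityʳ; distribˡ; zeroˡ; zeroʳ
          ; *-commutativeMonoid; commutativeSemiring; ring)
  open RingProperties ring public
    using ( -‿distribʳ-*; -1*x≈-x; -‿+-comm; -‿involutive
          ; +-cancelˡ; +-cancelʳ)
  open CommutativeSemigroupProperties (CommutativeRing.*-commutativeSemigroup commutativeRing) public
    using () renaming (interchange to *-interchange; x∙yz≈y∙xz to x*yz≡y*xz; xy∙z≈xz∙y to xy*z≡xz*y)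
  open Exp commutativeSemiring public
    using (^-homo-*; ^-assocʳ; ^-distrib-*) renaming (_^_ to _^ᶠ_)
  open CommutativeMonoidSum *-commutativeMonoid public
    using () renaming (sum to ∏ᶠ; ∑-distrib-+ to ∏-distrib; sum-cong-≗ to ∏-cong;
                       sum-permute to ∏-permute; sum-replicate to ∏-replicate)
  open CommutativeMonoidSum (CommutativeRing.+-commutativeMonoid commutativeRing) public
    using () renaming (sum to ∑ᶠ; sum-cong-≗ to ∑ᶠ-cong)

  infix 4 _≟_
  _≟_ : (x y : Fin q) → Dec (x ≡ y)
  _≟_ = Fin._≟_

  ≡0-cases : ∀ x → x ≡ 0# ⊎ x ≢ 0#
  ≡0-cases x = toSum (x ≟ 0#)

  instance
    q≢0 : NonZero q
    q≢0 = Fin.nonZeroIndex 0#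

  infix 9 _⁻¹
  _⁻¹ : Fin q → Fin q
  x ⁻¹ with x ≟ 0#
  ... | yes _  = 0#
  ... | no x≢0 = proj₁ (inverse x x≢0)

  *-inverseʳ : ∀ {x} → x ≢ 0# → x *ᶠ x ⁻¹ ≡ 1#
  *-inverseʳ {x} x≢0 with x ≟ 0#
  ... | yes x≡0 = contradiction x≡0 x≢0
  ... | no x≢0′ = proj₂ (inverse x x≢0′)

  *-inverseˡ : ∀ {x} → x ≢ 0# → x ⁻¹ *ᶠ x ≡ 1#
  *-inverseˡ x≢0 = trans (*-comm _ _) (*-inverseʳ x≢0)

  x⁻¹[xy]≡y : ∀ {x} → x ≢ 0# → ∀ y → x ⁻¹ *ᶠ (x *ᶠ y) ≡ y
  x⁻¹[xy]≡y x≢0 y =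
    trans (sym (*-assoc _ _ y)) (trans (cong (_*ᶠ y) (*-inverseˡ x≢0)) (*-identityˡ y))

  x[x⁻¹y]≡y : ∀ {x} → x ≢ 0# → ∀ y → x *ᶠ (x ⁻¹ *ᶠ y) ≡ y
  x[x⁻¹y]≡y x≢0 y =
    trans (sym (*-assoc _ _ y)) (trans (cong (_*ᶠ y) (*-inverseʳ x≢0)) (*-identityˡ y))

  *-cancelˡ : ∀ {x} → x ≢ 0# → ∀ {y z} → x *ᶠ y ≡ x *ᶠ z → y ≡ z
  *-cancelˡ {x} x≢0 {y} {z} eq =
    trans (sym (x⁻¹[xy]≡y x≢0 y)) (trans (cong (x ⁻¹ *ᶠ_) eq) (x⁻¹[xy]≡y x≢0 z))

  *-cancelʳ : ∀ {x} → x ≢ 0# → ∀ {y z} → y *ᶠ x ≡ z *ᶠ x → y ≡ z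
  *-cancelʳ x≢0 eq = *-cancelˡ x≢0 (trans (*-comm _ _) (trans eq (*-comm _ _)))

  x*y≡0 : ∀ {x y} → x ≢ 0# → x *ᶠ y ≡ 0# → y ≡ 0#
  x*y≡0 {x} x≢0 eq = *-cancelˡ x≢0 (trans eq (sym (zeroʳ x)))

  *-≢0 : ∀ {x y} → x ≢ 0# → y ≢ 0# → x *ᶠ y ≢ 0#
  *-≢0 x≢0 y≢0 eq = y≢0 (x*y≡0 x≢0 eq)

  ^-≢0 : ∀ {x} → x ≢ 0# → ∀ n → x ^ᶠ n ≢ 0#
  ^-≢0 x≢0 zero    = 1≢0
  ^-≢0 x≢0 (suc n) = *-≢0 x≢0 (^-≢0 x≢0 n)

  0^n≡0 : ∀ n → .{{_ : NonZero n}} → 0# ^ᶠ n ≡ 0#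
  0^n≡0 (suc n) = zeroˡ _

  x^n≡0 : ∀ {x} n → x ^ᶠ n ≡ 0# → x ≡ 0#
  x^n≡0 {x} n eq with x ≟ 0#
  ... | yes x≡0 = x≡0
  ... | no x≢0  = contradiction eq (^-≢0 x≢0 n)

  ⁻¹-≢0 : ∀ {x} → x ≢ 0# → x ⁻¹ ≢ 0#
  ⁻¹-≢0 x≢0 eq = 1≢0 (trans (sym (*-inverseʳ x≢0)) (trans (cong (_ *ᶠ_) eq) (zeroʳ _)))

  1^n≡1 : ∀ n → 1# ^ᶠ n ≡ 1#
  1^n≡1 zero    = refl
  1^n≡1 (suc n) = trans (*-identityˡ _) (1^n≡1 n)

  ∏-≢0 : ∀ {n} (f : Fin n → Fin q) → (∀ i → f i ≢ 0#) → ∏ᶠ f ≢ 0#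
  ∏-≢0 {zero}  f h = 1≢0
  ∏-≢0 {suc n} f h = *-≢0 (h zero) (∏-≢0 (f ∘ suc) (h ∘ suc))

  ∏-≡0 : ∀ {n} (f : Fin n → Fin q) j → f j ≡ 0# → ∏ᶠ f ≡ 0#
  ∏-≡0 {suc n} f zero    h = trans (cong (_*ᶠ ∏ᶠ (f ∘ suc)) h) (zeroˡ _)
  ∏-≡0 {suc n} f (suc j) h = trans (cong (f zero *ᶠ_) (∏-≡0 (f ∘ suc) j h)) (zeroʳ _)

  x-y≡0 : ∀ {x y} → x +ᶠ -ᶠ y ≡ 0# → x ≡ y
  x-y≡0 {x} {y} eq = +-cancelʳ (-ᶠ y) x y (trans eq (sym (-‿inverseʳ y)))

  scalingPermutation : ∀ {u} → u ≢ 0# → Permutation.Permutation q q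
  scalingPermutation {u} u≢0 = Permutation.permutation (u *ᶠ_) (u ⁻¹ *ᶠ_) (x[x⁻¹y]≡y u≢0) (x⁻¹[xy]≡y u≢0)

  ∑-scaling : ∀ {u} → u ≢ 0# → (f : Fin q → ℤ) → ∑ (λ x → f (u *ᶠ x)) ≡ ∑ f
  ∑-scaling u≢0 f = sym (∑-permute f (scalingPermutation u≢0))

  ∑-reflection : ∀ c (f : Fin q → ℤ) → ∑ (λ x → f (c +ᶠ -ᶠ x)) ≡ ∑ f
  ∑-reflection c f = sym (∑-permute f (Permutation.permutation reflect reflect involutive involutive))
    where
    reflect : Fin q → Fin q
    reflect x = c +ᶠ -ᶠ x
    involutive : ∀ x → reflect (reflect x) ≡ x
    involutive x = begin
      c +ᶠ -ᶠ (c +ᶠ -ᶠ x)         ≡⟨ cong (c +ᶠ_) (-‿+-comm c (-ᶠ x)) ⟨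
      c +ᶠ (-ᶠ c +ᶠ -ᶠ (-ᶠ x))    ≡⟨ +-assoc c _ _ ⟨
      c +ᶠ -ᶠ c +ᶠ -ᶠ (-ᶠ x)      ≡⟨ cong₂ _+ᶠ_ (-‿inverseʳ c) (-‿involutive x) ⟩
      0# +ᶠ x                     ≡⟨ +-identityˡ x ⟩
      x                           ∎ where open ≡-Reasoning

  δ : Fin q → ℤ
  δ x = ⟦ x ≟ 0# ⟧

  δ-0 : δ 0# ≡ 1ℤ
  δ-0 = ⟦⟧-yes (0# ≟ 0#) refl

  δ-≢0 : ∀ {x} → x ≢ 0# → δ x ≡ 0ℤ
  δ-≢0 {x} = ⟦⟧-no (x ≟ 0#)

  δ-scaling : ∀ {u} → u ≢ 0# → ∀ x → δ (u *ᶠ x) ≡ δ x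
  δ-scaling {u} u≢0 x = ⟦⟧-cong (u *ᶠ x ≟ 0#) (x ≟ 0#) (x*y≡0 u≢0)
                          (λ eq → trans (cong (u *ᶠ_) eq) (zeroʳ u))

  ∑-δ* : ∀ (f : Fin q → ℤ) → ∑ (λ x → δ x * f x) ≡ f 0#
  ∑-δ* f = trans (∑-single (λ x → δ x * f x) 0# λ i i≢0 →
                   trans (cong (_* f i) (δ-≢0 i≢0)) (ℤ.*-zeroˡ (f i)))
                 (trans (cong (_* f 0#) δ-0) (ℤ.*-identityˡ (f 0#)))

  ∑-δ : ∑ δ ≡ 1ℤ
  ∑-δ = trans (∑-single δ 0# λ i i≢0 → δ-≢0 i≢0) δ-0

  -- w 0ℤ is the constant 1, and w 1ℤ the indicator of the nonzero elements.
  w : ℤ → Fin q → ℤ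
  w ν x = 1ℤ - ν * δ x

  w-scaling : ∀ ν {u} → u ≢ 0# → ∀ x → w ν (u *ᶠ x) ≡ w ν x
  w-scaling ν u≢0 x = cong (λ z → 1ℤ - ν * z) (δ-scaling u≢0 x)

  w₁-0 : ∀ {x} → x ≡ 0# → w 1ℤ x ≡ 0ℤ
  w₁-0 refl = cong (λ z → 1ℤ - 1ℤ * z) δ-0

  w₁-≢0 : ∀ {x} → x ≢ 0# → w 1ℤ x ≡ 1ℤ
  w₁-≢0 x≢0 = cong (λ z → 1ℤ - 1ℤ * z) (δ-≢0 x≢0)

  ∑-w* : ∀ ν (f : Fin q → ℤ) → ∑ (λ x → w ν x * f x) ≡ ∑ f - ν * f 0#
  ∑-w* ν f = begin
    ∑ (λ x → w ν x * f x)                          ≡⟨ ∑-cong (λ x → expand ν (δ x) (f x)) ⟩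
    ∑ (λ x → f x + (- ν) * (δ x * f x))            ≡⟨ ∑-+ f _ ⟩
    ∑ f + ∑ (λ x → (- ν) * (δ x * f x))            ≡⟨ cong (_+_ (∑ f)) (∑-scale (- ν) (λ x → δ x * f x)) ⟩
    ∑ f + (- ν) * ∑ (λ x → δ x * f x)              ≡⟨ cong (λ z → ∑ f + (- ν) * z) (∑-δ* f) ⟩
    ∑ f + (- ν) * f 0#                             ≡⟨ collect (∑ f) ν (f 0#) ⟩
    ∑ f - ν * f 0#                                 ∎
    where
    open ≡-Reasoning
    expand : ∀ ν d z → (1ℤ - ν * d) * z ≡ z + (- ν) * (d * z)
    expand = solve-∀
    collect : ∀ s ν z → s + (- ν) * z ≡ s - ν * z
    collect = solve-∀

  ∑-w : ∀ ν → ∑ (w ν) ≡ + q - ν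
  ∑-w ν = begin
    ∑ (w ν)                        ≡⟨ ∑-cong (λ x → sym (ℤ.*-identityʳ (w ν x))) ⟩
    ∑ (λ x → w ν x * 1ℤ)           ≡⟨ ∑-w* ν (λ _ → 1ℤ) ⟩
    ∑ {q} (λ _ → 1ℤ) - ν * 1ℤ
      ≡⟨ cong₂ _-_ (trans (∑-const q 1ℤ) (ℤ.*-identityʳ (+ q))) (ℤ.*-identityʳ ν) ⟩
    + q - ν                        ∎
    where open ≡-Reasoning

  suc[q∸1]≡q : suc (q ∸ 1) ≡ q
  suc[q∸1]≡q = ℕ.m+[n∸m]≡n (ℕ.>-nonZero⁻¹ q)

  fermat : ∀ {x} → x ≢ 0# → x ^ᶠ (q ∸ 1) ≡ 1#
  fermat {u} u≢0 = *-cancelˡ u≢0 (begin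
    u *ᶠ u ^ᶠ (q ∸ 1)     ≡⟨ cong (u ^ᶠ_) suc[q∸1]≡q ⟩
    u ^ᶠ q                ≡⟨ ∏-replicate q ⟨
    ∏ᶠ {q} (λ _ → u)      ≡⟨ ∏-cong split ⟩
    ∏ᶠ (λ x → h x *ᶠ k x) ≡⟨ ∏-distrib h k ⟩
    ∏ᶠ h *ᶠ ∏ᶠ k          ≡⟨ cong₂ _*ᶠ_ ∏h≡1 ∏k≡u ⟩
    1# *ᶠ u               ≡⟨ *-comm 1# u ⟩
    u *ᶠ 1#               ∎)
    where
    open ≡-Reasoning
    g h k : Fin q → Fin q
    g x with x ≟ 0#
    ... | yes _ = 1#
    ... | no _  = x
    h x with x ≟ 0#
    ... | yes _ = 1#
    ... | no _  = u
    k x with x ≟ 0#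
    ... | yes _ = u
    ... | no _  = 1#
    split : ∀ x → u ≡ h x *ᶠ k x
    split x with x ≟ 0#
    ... | yes _ = sym (*-identityˡ u)
    ... | no _  = sym (*-identityʳ u)
    g≢0 : ∀ x → g x ≢ 0#
    g≢0 x with x ≟ 0#
    ... | yes _  = 1≢0
    ... | no x≢0 = x≢0
    g-scaling : ∀ x → g (u *ᶠ x) ≡ h x *ᶠ g x
    g-scaling x with x ≟ 0# | u *ᶠ x ≟ 0#
    ... | yes _   | yes _    = sym (*-identityˡ 1#)
    ... | yes x≡0 | no ux≢0  = contradiction (trans (cong (u *ᶠ_) x≡0) (zeroʳ u)) ux≢0
    ... | no x≢0  | yes ux≡0 = contradiction (x*y≡0 u≢0 ux≡0) x≢0
    ... | no _    | no _     = refl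
    ∏h≡1 : ∏ᶠ h ≡ 1#
    ∏h≡1 = *-cancelʳ (∏-≢0 g g≢0) (begin
      ∏ᶠ h *ᶠ ∏ᶠ g             ≡⟨ ∏-distrib h g ⟨
      ∏ᶠ (λ x → h x *ᶠ g x)    ≡⟨ ∏-cong g-scaling ⟨
      ∏ᶠ (λ x → g (u *ᶠ x))    ≡⟨ ∏-permute g (scalingPermutation u≢0) ⟨
      ∏ᶠ g                     ≡⟨ *-identityˡ _ ⟨
      1# *ᶠ ∏ᶠ g               ∎)
    k-0 : k 0# ≡ u
    k-0 with 0# ≟ 0#
    ... | yes _  = refl
    ... | no 0≢0 = contradiction refl 0≢0
    k-≢0 : ∀ x → x ≢ 0# → k x ≡ 1#
    k-≢0 x x≢0 with x ≟ 0#
    ... | yes x≡0 = contradiction x≡0 x≢0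
    ... | no _    = refl
    ∏k≡u : ∏ᶠ k ≡ u
    ∏k≡u = trans (sum-single *-commutativeMonoid k 0# k-≢0) k-0

  -- The coefficients, from the constant one up, of a monic polynomial of degree n.
  eval : ∀ {n} → Vec (Fin q) n → Fin q → Fin q
  eval []       x = 1#
  eval (c ∷ cs) x = c +ᶠ x *ᶠ eval cs x

  cofactor : ∀ {n} → Vec (Fin q) (suc n) → Fin q → Vec (Fin q) n
  cofactor (c ∷ [])         r = []
  cofactor (c ∷ cs@(_ ∷ _)) r = eval cs r ∷ cofactor cs r

  -- p(x) − p(r) = (x − r) Q(x), with both sides moved so that no subtraction occurs.
  eval-cofactor : ∀ {n} (p : Vec (Fin q) (suc n)) r x →
    eval p x +ᶠ r *ᶠ eval (cofactor p r) x ≡ eval p r +ᶠ x *ᶠ eval (cofactor p r) x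
  eval-cofactor (c ∷ []) r x =
    solve 4 (λ c x r i → (c :+ x :* i) :+ r :* i := (c :+ r :* i) :+ x :* i) refl c x r 1#
    where open SemiringSolver commutativeSemiring
  eval-cofactor (c ∷ cs@(_ ∷ _)) r x = begin
    (c +ᶠ x *ᶠ P x) +ᶠ r *ᶠ (P r +ᶠ x *ᶠ Q)   ≡⟨ regroup c x (P x) r (P r) Q ⟩
    (c +ᶠ r *ᶠ P r) +ᶠ x *ᶠ (P x +ᶠ r *ᶠ Q)
      ≡⟨ cong (λ z → (c +ᶠ r *ᶠ P r) +ᶠ x *ᶠ z) (eval-cofactor cs r x) ⟩
    (c +ᶠ r *ᶠ P r) +ᶠ x *ᶠ (P r +ᶠ x *ᶠ Q)   ∎
    where
    open ≡-Reasoning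
    P = eval cs
    Q = eval (cofactor cs r) x
    regroup : ∀ c x a r b d →
      (c +ᶠ x *ᶠ a) +ᶠ r *ᶠ (b +ᶠ x *ᶠ d) ≡ (c +ᶠ r *ᶠ b) +ᶠ x *ᶠ (a +ᶠ r *ᶠ d)
    regroup = solve 6 (λ c x a r b d →
      (c :+ x :* a) :+ r :* (b :+ x :* d) := (c :+ r :* b) :+ x :* (a :+ r :* d)) refl
      where open SemiringSolver commutativeSemiring

  rootBound : ∀ {n} (p : Vec (Fin q) (suc n)) v → ∑ (λ x → ⟦ eval p x ≟ v ⟧) ℤ.≤ + suc n
  rootBound {n} p v with Fin.any? (λ r → eval p r ≟ v)
  ... | no noRoot = ℤ.≤-trans
    (ℤ.≤-reflexive (∑-zero _ λ x → ⟦⟧-no (eval p x ≟ v) λ eq → noRoot (x , eq)))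
    (ℤ.+≤+ ℕ.z≤n)
  ... | yes (r , pr≡v) = begin
    ∑ (λ x → ⟦ eval p x ≟ v ⟧)                              ≤⟨ ∑-mono atMost ⟩
    ∑ (λ x → ⟦ x ≟ r ⟧ + ⟦ eval (cofactor p r) x ≟ 0# ⟧)    ≡⟨ ∑-+ (λ x → ⟦ x ≟ r ⟧) _ ⟩
    ∑ (λ x → ⟦ x ≟ r ⟧) + others
      ≡⟨ cong (_+ others) (trans (∑-single _ r λ x x≢r → ⟦⟧-no (x ≟ r) x≢r) (⟦⟧-yes (r ≟ r) refl)) ⟩
    1ℤ + others                                             ≤⟨ ℤ.+-monoʳ-≤ 1ℤ (cofactorBound p) ⟩
    1ℤ + + n                                                ∎
    where
    open ℤ.≤-Reasoning
    others = ∑ (λ x → ⟦ eval (cofactor p r) x ≟ 0# ⟧)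
    cofactorBound : ∀ {n} (p : Vec (Fin q) (suc n)) → ∑ (λ x → ⟦ eval (cofactor p r) x ≟ 0# ⟧) ℤ.≤ + n
    cofactorBound (c ∷ [])           = ℤ.≤-reflexive (∑-zero {q} _ λ _ → ⟦⟧-no (1# ≟ 0#) 1≢0)
    cofactorBound p@(_ ∷ cs@(_ ∷ _)) = rootBound (cofactor p r) 0#
    atMost : ∀ x → ⟦ eval p x ≟ v ⟧ ℤ.≤ ⟦ x ≟ r ⟧ + ⟦ eval (cofactor p r) x ≟ 0# ⟧
    atMost x with eval p x ≟ v | x ≟ r | eval (cofactor p r) x ≟ 0#
    ... | no _      | yes _   | yes _   = ℤ.+≤+ ℕ.z≤n
    ... | no _      | yes _   | no _    = ℤ.+≤+ ℕ.z≤n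
    ... | no _      | no _    | yes _   = ℤ.+≤+ ℕ.z≤n
    ... | no _      | no _    | no _    = ℤ.+≤+ ℕ.z≤n
    ... | yes _     | yes _   | yes _   = ℤ.+≤+ (ℕ.s≤s ℕ.z≤n)
    ... | yes _     | yes _   | no _    = ℤ.+≤+ (ℕ.s≤s ℕ.z≤n)
    ... | yes _     | no _    | yes _   = ℤ.+≤+ (ℕ.s≤s ℕ.z≤n)
    ... | yes px≡v  | no x≢r  | no Qx≢0 = contradiction
      (*-cancelʳ Qx≢0 (sym (+-cancelˡ v _ _ (trans (cong (_+ᶠ _) (sym px≡v))
        (trans (eval-cofactor p r x) (cong (_+ᶠ _) pr≡v)))))) x≢r

  rootsOfUnity : ℕ → ℤ
  rootsOfUnity d = ∑ (λ x → ⟦ x ^ᶠ d ≟ 1# ⟧)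

  rootsOfUnity-≤ : ∀ d → .{{_ : NonZero d}} → rootsOfUnity d ℤ.≤ + d
  rootsOfUnity-≤ (suc n) = subst (ℤ._≤ + suc n)
    (∑-cong λ x → cong (λ z → ⟦ z ≟ 1# ⟧) (eval-zeros (suc n) x)) (rootBound (replicate (suc n) 0#) 1#)
    where
    eval-zeros : ∀ m x → eval (replicate m 0#) x ≡ x ^ᶠ m
    eval-zeros zero    x = refl
    eval-zeros (suc m) x = trans (+-identityˡ _) (cong (x *ᶠ_) (eval-zeros m x))

  -- A fibre of x ↦ x ^ d is a coset of the d-th roots of unity.
  powerFibre : ∀ d z → z ≢ 0# → ∑ (λ x → ⟦ x ^ᶠ d ≟ z ^ᶠ d ⟧) ≡ rootsOfUnity d
  powerFibre d z z≢0 = trans (sym (∑-scaling z≢0 _)) (∑-cong λ x →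
    ⟦⟧-cong ((z *ᶠ x) ^ᶠ d ≟ z ^ᶠ d) (x ^ᶠ d ≟ 1#)
      (λ eq → *-cancelˡ (^-≢0 z≢0 d) (trans (sym (^-distrib-* z x d)) (trans eq (sym (*-identityʳ _)))))
      (λ eq → trans (^-distrib-* z x d) (trans (cong (z ^ᶠ d *ᶠ_) eq) (*-identityʳ _))))

distinct⇒nonZero[n∸1] : ∀ {n} {i j : Fin n} → i ≢ j → NonZero (n ∸ 1)
distinct⇒nonZero[n∸1] {1}           {zero} {zero} i≢j = contradiction refl i≢j
distinct⇒nonZero[n∸1] {suc (suc n)} _                 = _

module Points {q : ℕ} (𝔽 : FinField q) where
  open FinFieldProperties 𝔽

  instance
    q∸1≢0 : NonZero (q ∸ 1)
    q∸1≢0 = distinct⇒nonZero[n∸1] 1≢0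

  +[q∸1]≡ : + (q ∸ 1) ≡ + q - 1ℤ
  +[q∸1]≡ = trans (sym (ℤ.⊖-≥ (ℕ.>-nonZero⁻¹ q))) (sym (ℤ.m-n≡m⊖n q 1))

  instance
    q-1≢0 : ℤ.NonZero (+ q - 1ℤ)
    q-1≢0 = subst ℤ.NonZero +[q∸1]≡ (ℤ.≢-nonZero λ eq → ℕ.≢-nonZero⁻¹ (q ∸ 1) (ℤ.+-injective eq))

  rootsOfUnity-≡ : ∀ d d′ → d ℕ.* d′ ≡ q ∸ 1 → rootsOfUnity d ≡ + d
  rootsOfUnity-≡ d d′ dd′≡q∸1 = ℤ.≤-antisym (rootsOfUnity-≤ d) (ℤ.*-cancelʳ-≤-pos (+ d) (rootsOfUnity d) (+ d′) (begin
      + d * + d′                                       ≡⟨ ℤ.pos-* d d′ ⟨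
      + (d ℕ.* d′)                                     ≡⟨ cong +_ dd′≡q∸1 ⟩
      + (q ∸ 1)                                        ≡⟨ +[q∸1]≡ ⟩
      + q - 1ℤ                                         ≡⟨ ∑-w 1ℤ ⟨
      ∑ (w 1ℤ)                                         ≡⟨ ∑-cong spread ⟩
      ∑ (λ x → ∑ λ y → w 1ℤ x * ⟦ y ≟ x ^ᶠ d ⟧)        ≡⟨ ∑-comm (λ x y → w 1ℤ x * ⟦ y ≟ x ^ᶠ d ⟧) ⟩
      ∑ (λ y → ∑ λ x → w 1ℤ x * ⟦ y ≟ x ^ᶠ d ⟧)        ≤⟨ ∑-mono fibreBound ⟩
      ∑ (λ y → rootsOfUnity d * ⟦ y ^ᶠ d′ ≟ 1# ⟧)      ≡⟨ ∑-scale (rootsOfUnity d) (λ y → ⟦ y ^ᶠ d′ ≟ 1# ⟧) ⟩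
      rootsOfUnity d * rootsOfUnity d′
        ≤⟨ ℤ.*-monoˡ-≤-nonNeg (rootsOfUnity d) {{ℤ.nonNegative 0≤K}} (rootsOfUnity-≤ d′) ⟩
      rootsOfUnity d * + d′                            ∎))
    where
    open ℤ.≤-Reasoning
    instance
      dd′≢0 : NonZero (d ℕ.* d′)
      dd′≢0 = subst NonZero (sym dd′≡q∸1) q∸1≢0
      d≢0 : NonZero d
      d≢0 = ℕ.m*n≢0⇒m≢0 d
      d′≢0 : NonZero d′
      d′≢0 = ℕ.m*n≢0⇒n≢0 d
      +d′-positive : ℤ.Positive (+ d′)
      +d′-positive = ℤ.positive (ℤ.+<+ (ℕ.>-nonZero⁻¹ d′))
    0≤K : 0ℤ ℤ.≤ rootsOfUnity d
    0≤K = subst (ℤ._≤ rootsOfUnity d) (∑-zero {q} (λ _ → 0ℤ) λ _ → refl)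
                (∑-mono λ x → 0≤⟦⟧ (x ^ᶠ d ≟ 1#))
    spread : ∀ x → w 1ℤ x ≡ ∑ λ y → w 1ℤ x * ⟦ y ≟ x ^ᶠ d ⟧
    spread x = sym (trans (∑-scale (w 1ℤ x) (λ y → ⟦ y ≟ x ^ᶠ d ⟧))
      (trans (cong (w 1ℤ x *_) (trans (∑-single (λ y → ⟦ y ≟ x ^ᶠ d ⟧) (x ^ᶠ d) λ y → ⟦⟧-no (y ≟ x ^ᶠ d))
                                      (⟦⟧-yes (x ^ᶠ d ≟ x ^ᶠ d) refl)))
             (ℤ.*-identityʳ (w 1ℤ x))))
    vanish : ∀ y → (∀ x → x ≢ 0# → y ≢ x ^ᶠ d) → ∑ (λ x → w 1ℤ x * ⟦ y ≟ x ^ᶠ d ⟧) ≡ 0ℤ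
    vanish y h = ∑-zero _ term
      where
      term : ∀ x → w 1ℤ x * ⟦ y ≟ x ^ᶠ d ⟧ ≡ 0ℤ
      term x with ≡0-cases x
      ... | inj₁ x≡0 = trans (cong (_* ⟦ y ≟ x ^ᶠ d ⟧) (w₁-0 x≡0)) (ℤ.*-zeroˡ ⟦ y ≟ x ^ᶠ d ⟧)
      ... | inj₂ x≢0  = trans (cong (w 1ℤ x *_) (⟦⟧-no (y ≟ x ^ᶠ d) (h x x≢0))) (ℤ.*-zeroʳ (w 1ℤ x))
    w₁*-≤ : ∀ x {z} → 0ℤ ℤ.≤ z → w 1ℤ x * z ℤ.≤ z
    w₁*-≤ x {z} 0≤z with ≡0-cases x
    ... | inj₁ x≡0 = subst (ℤ._≤ z) (sym (trans (cong (_* z) (w₁-0 x≡0)) (ℤ.*-zeroˡ z))) 0≤z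
    ... | inj₂ x≢0  = ℤ.≤-reflexive (trans (cong (_* z) (w₁-≢0 x≢0)) (ℤ.*-identityˡ z))
    fibreBound : ∀ y → ∑ (λ x → w 1ℤ x * ⟦ y ≟ x ^ᶠ d ⟧) ℤ.≤ rootsOfUnity d * ⟦ y ^ᶠ d′ ≟ 1# ⟧
    fibreBound y with y ^ᶠ d′ ≟ 1#
    ... | no y^d′≢1 = ℤ.≤-reflexive (trans
        (vanish y λ x x≢0 y≡x^d → y^d′≢1
          (trans (cong (_^ᶠ d′) y≡x^d)
            (trans (^-assocʳ x d d′) (trans (cong (x ^ᶠ_) dd′≡q∸1) (fermat x≢0)))))
        (sym (ℤ.*-zeroʳ (rootsOfUnity d))))
    ... | yes y^d′≡1 with Fin.any? (λ z → y ≟ z ^ᶠ d)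
    ...   | no noRoot = subst₂ ℤ._≤_ (sym (vanish y λ x _ eq → noRoot (x , eq)))
                          (sym (ℤ.*-identityʳ (rootsOfUnity d))) 0≤K
    ...   | yes (z , refl) = begin
      ∑ (λ x → w 1ℤ x * ⟦ z ^ᶠ d ≟ x ^ᶠ d ⟧)   ≤⟨ ∑-mono (λ x → w₁*-≤ x (0≤⟦⟧ (z ^ᶠ d ≟ x ^ᶠ d))) ⟩
      ∑ (λ x → ⟦ z ^ᶠ d ≟ x ^ᶠ d ⟧)
        ≡⟨ ∑-cong (λ x → ⟦⟧-cong (z ^ᶠ d ≟ x ^ᶠ d) (x ^ᶠ d ≟ z ^ᶠ d) sym sym) ⟩
      ∑ (λ x → ⟦ x ^ᶠ d ≟ z ^ᶠ d ⟧)            ≡⟨ powerFibre d z z≢0 ⟩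
      rootsOfUnity d                           ≡⟨ ℤ.*-identityʳ (rootsOfUnity d) ⟨
      rootsOfUnity d * 1ℤ                      ∎
      where
      z≢0 : z ≢ 0#
      z≢0 refl = 1≢0 (trans (sym y^d′≡1)
                   (trans (cong (_^ᶠ d′) (0^n≡0 d)) (0^n≡0 d′)))

  decode : ∀ {n} → Fin (q ℕ.^ n) → Vec (Fin q) n
  decode i = Vec.tabulate (finToFun i)

  opaque
    ∑ⱽ : ∀ {n} → (Vec (Fin q) n → ℤ) → ℤ
    ∑ⱽ f = ∑ (f ∘ decode)

  opaque
    unfolding ∑ⱽ

    ∑ⱽ≡∑ : ∀ {n} (f : Vec (Fin q) n → ℤ) → ∑ⱽ f ≡ ∑ (f ∘ decode)
    ∑ⱽ≡∑ f = refl

    ∑ⱽ-cong : ∀ {n} {f g : Vec (Fin q) n → ℤ} → (∀ x → f x ≡ g x) → ∑ⱽ f ≡ ∑ⱽ g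
    ∑ⱽ-cong h = ∑-cong (h ∘ decode)

    ∑ⱽ-scale : ∀ {n} c (f : Vec (Fin q) n → ℤ) → ∑ⱽ (λ x → c * f x) ≡ c * ∑ⱽ f
    ∑ⱽ-scale c f = ∑-scale c (f ∘ decode)

    ∑ⱽ-+ : ∀ {n} (f g : Vec (Fin q) n → ℤ) → ∑ⱽ (λ x → f x + g x) ≡ ∑ⱽ f + ∑ⱽ g
    ∑ⱽ-+ f g = ∑-+ (f ∘ decode) (g ∘ decode)

    ∑-∑ⱽ-comm : ∀ {m n} (f : Fin m → Vec (Fin q) n → ℤ) →
      ∑ (λ x → ∑ⱽ (f x)) ≡ ∑ⱽ (λ y → ∑ λ x → f x y)
    ∑-∑ⱽ-comm f = ∑-comm (λ i j → f i (decode j))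

    ∑ⱽ-comm : ∀ {m n} (f : Vec (Fin q) m → Vec (Fin q) n → ℤ) →
      ∑ⱽ (λ x → ∑ⱽ (f x)) ≡ ∑ⱽ (λ y → ∑ⱽ λ x → f x y)
    ∑ⱽ-comm f = ∑-comm (λ i j → f (decode i) (decode j))

    ∑ⱽ-[] : (f : Vec (Fin q) 0 → ℤ) → ∑ⱽ f ≡ f []
    ∑ⱽ-[] f = ∑-single (f ∘ decode) zero λ { zero i≢0 → contradiction refl i≢0 }

    ∑ⱽ-∷ : ∀ {n} (f : Vec (Fin q) (suc n) → ℤ) → ∑ⱽ f ≡ ∑ λ x → ∑ⱽ λ v → f (x ∷ v)
    ∑ⱽ-∷ {n} f = trans (∑-combine q (q ℕ.^ n) (f ∘ decode))
      (∑-cong λ x → ∑-cong λ j → cong f (cong₂ _∷_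
        (cong proj₁ (Fin.remQuot-combine x j))
        (Vec.tabulate-cong λ l → cong (λ i → finToFun i l) (cong proj₂ (Fin.remQuot-combine x j)))))

  infixr 7 _⊙_
  _⊙_ : ∀ {n} → (Fin n → Fin q) → Vec (Fin q) n → Vec (Fin q) n
  u ⊙ []      = []
  u ⊙ (x ∷ v) = u zero *ᶠ x ∷ (u ∘ suc) ⊙ v

  lookup-⊙ : ∀ {n} (u : Fin n → Fin q) v j → lookup (u ⊙ v) j ≡ u j *ᶠ lookup v j
  lookup-⊙ u (x ∷ v) zero    = refl
  lookup-⊙ u (x ∷ v) (suc j) = lookup-⊙ (u ∘ suc) v j

  ∑ⱽ-scaling : ∀ {n} {u : Fin n → Fin q} → (∀ j → u j ≢ 0#) →
    (f : Vec (Fin q) n → ℤ) → ∑ⱽ (λ v → f (u ⊙ v)) ≡ ∑ⱽ f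
  ∑ⱽ-scaling {zero}      u≢0 f = ∑ⱽ-cong {0} λ { [] → refl }
  ∑ⱽ-scaling {suc n} {u} u≢0 f = begin
    ∑ⱽ (λ v → f (u ⊙ v))                                     ≡⟨ ∑ⱽ-∷ _ ⟩
    ∑ (λ x → ∑ⱽ λ v → f (u zero *ᶠ x ∷ (u ∘ suc) ⊙ v))
      ≡⟨ ∑-cong (λ x → ∑ⱽ-scaling (u≢0 ∘ suc) λ v → f (u zero *ᶠ x ∷ v)) ⟩
    ∑ (λ x → ∑ⱽ λ v → f (u zero *ᶠ x ∷ v))
      ≡⟨ ∑-scaling (u≢0 zero) (λ x → ∑ⱽ λ v → f (x ∷ v)) ⟩
    ∑ (λ x → ∑ⱽ λ v → f (x ∷ v))                             ≡⟨ ∑ⱽ-∷ f ⟨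
    ∑ⱽ f                                                     ∎
    where open ≡-Reasoning

  ω : ∀ {n} → ℤ → Vec (Fin q) n → ℤ
  ω ν []      = 1ℤ
  ω ν (x ∷ v) = w ν x * ω ν v

  ω-scaling : ∀ ν {n} {u : Fin n → Fin q} → (∀ j → u j ≢ 0#) → ∀ v → ω ν (u ⊙ v) ≡ ω ν v
  ω-scaling ν u≢0 []      = refl
  ω-scaling ν u≢0 (x ∷ v) = cong₂ _*_ (w-scaling ν (u≢0 zero) x) (ω-scaling ν (u≢0 ∘ suc) v)

  ω₀≡1 : ∀ {n} (v : Vec (Fin q) n) → ω 0ℤ v ≡ 1ℤ
  ω₀≡1 []      = refl
  ω₀≡1 (x ∷ v) = cong (1ℤ *_) (ω₀≡1 v)

  ω₁-cases : ∀ {n} (v : Vec (Fin q) n) →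
    (ω 1ℤ v ≡ 1ℤ × ∀ j → lookup v j ≢ 0#) ⊎ (ω 1ℤ v ≡ 0ℤ × ∃ λ j → lookup v j ≡ 0#)
  ω₁-cases [] = inj₁ (refl , λ ())
  ω₁-cases (x ∷ v) with ≡0-cases x | ω₁-cases v
  ... | inj₁ x≡0 | _                     = inj₂ (trans (cong (_* ω 1ℤ v) (w₁-0 x≡0)) (ℤ.*-zeroˡ (ω 1ℤ v)) , zero , x≡0)
  ... | inj₂ _   | inj₂ (ω≡0 , j , vj≡0) = inj₂ (trans (cong (w 1ℤ x *_) ω≡0) (ℤ.*-zeroʳ (w 1ℤ x)) , suc j , vj≡0)
  ... | inj₂ x≢0  | inj₁ (ω≡1 , v≢0)      = inj₁ (cong₂ _*_ (w₁-≢0 x≢0) ω≡1 , λ { zero → x≢0 ; (suc j) → v≢0 j })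

  ω₁*-cong : ∀ {n} (v : Vec (Fin q) n) {y z : ℤ} → ((∀ j → lookup v j ≢ 0#) → y ≡ z) →
    ω 1ℤ v * y ≡ ω 1ℤ v * z
  ω₁*-cong v {y} {z} h with ω₁-cases v
  ... | inj₁ (_ , v≢0) = cong (ω 1ℤ v *_) (h v≢0)
  ... | inj₂ (ω≡0 , _) = trans (cong (_* y) ω≡0) (trans (ℤ.*-zeroˡ y)
                           (sym (trans (cong (_* z) ω≡0) (ℤ.*-zeroˡ z))))

  ∑ⱽ-ω : ∀ ν n → ∑ⱽ {n} (ω ν) ≡ (+ q - ν) ^ n
  ∑ⱽ-ω ν zero    = ∑ⱽ-[] (ω ν)
  ∑ⱽ-ω ν (suc n) = begin
    ∑ⱽ {suc n} (ω ν)                        ≡⟨ ∑ⱽ-∷ {n} (ω ν) ⟩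
    ∑ (λ x → ∑ⱽ {n} λ v → w ν x * ω ν v)
      ≡⟨ ∑-cong (λ x → trans (∑ⱽ-scale {n} (w ν x) (ω ν)) (ℤ.*-comm (w ν x) (∑ⱽ {n} (ω ν)))) ⟩
    ∑ (λ x → ∑ⱽ {n} (ω ν) * w ν x)          ≡⟨ ∑-scale (∑ⱽ {n} (ω ν)) (w ν) ⟩
    ∑ⱽ {n} (ω ν) * ∑ (w ν)                  ≡⟨ cong₂ _*_ (∑ⱽ-ω ν n) (∑-w ν) ⟩
    (+ q - ν) ^ n * (+ q - ν)               ≡⟨ ℤ.*-comm ((+ q - ν) ^ n) (+ q - ν) ⟩
    (+ q - ν) ^ suc n                       ∎
    where open ≡-Reasoning

  form : ∀ {n} → (Fin n → Fin q) → (Fin n → ℕ) → Vec (Fin q) n → Fin q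
  form a m x = ∑ᶠ λ j → a j *ᶠ lookup x j ^ᶠ m j

  zeros : ∀ {n} → ℤ → (Fin n → Fin q) → (Fin n → ℕ) → ℤ
  zeros ν a m = ∑ⱽ λ x → ω ν x * δ (form a m x)

  *-distrib-∑ᶠ : ∀ {n} s (f : Fin n → Fin q) → s *ᶠ ∑ᶠ f ≡ ∑ᶠ (λ j → s *ᶠ f j)
  *-distrib-∑ᶠ {zero}  s f = zeroʳ s
  *-distrib-∑ᶠ {suc n} s f = trans (distribˡ s _ _) (cong (s *ᶠ f zero +ᶠ_) (*-distrib-∑ᶠ s (f ∘ suc)))

  -- Averaging over all x in the torus replaces the m j-th powers by the e j-th powers.
  zeros-exponents : ∀ ν {n} (a : Fin n → Fin q) (m e : Fin n → ℕ) → (∀ j → NonZero (m j)) →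
    (∀ j → e j ∣ m j) →
    (∀ (x : Fin n → Fin q) → (∀ j → x j ≢ 0#) →
      ∃ λ s → s ≢ 0# × (∀ j → ∃ λ v → v ≢ 0# × s *ᶠ x j ^ᶠ e j ≡ v ^ᶠ m j)) →
    zeros ν a m ≡ zeros ν a e
  zeros-exponents ν {n} a m e m≢0 e∣m simultaneous =
    ℤ.*-cancelˡ-≡ ((+ q - 1ℤ) ^ n) (zeros ν a m) (zeros ν a e) (begin
      (+ q - 1ℤ) ^ n * zeros ν a m                                ≡⟨ average (zeros ν a m) ⟩
      ∑ⱽ (λ x → ω 1ℤ x * zeros ν a m)                             ≡⟨ ∑ⱽ-cong (λ x → ω₁*-cong x (absorb x)) ⟨
      ∑ⱽ (λ x → ω 1ℤ x * ∑ⱽ λ y → ω ν y * δ (mixed x y m))        ≡⟨ swap m ⟩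
      ∑ⱽ (λ y → ω ν y * ∑ⱽ λ x → ω 1ℤ x * δ (mixed x y m))
        ≡⟨ ∑ⱽ-cong (λ y → cong (ω ν y *_) (exchange y)) ⟩
      ∑ⱽ (λ y → ω ν y * ∑ⱽ λ x → ω 1ℤ x * δ (mixed x y e))        ≡⟨ swap e ⟨
      ∑ⱽ (λ x → ω 1ℤ x * ∑ⱽ λ y → ω ν y * δ (mixed x y e))        ≡⟨ ∑ⱽ-cong (λ x → ω₁*-cong x (absorbₑ x)) ⟩
      ∑ⱽ (λ x → ω 1ℤ x * zeros ν a e)                             ≡⟨ average (zeros ν a e) ⟨
      (+ q - 1ℤ) ^ n * zeros ν a e                                ∎)
    where
    open ≡-Reasoning
    instance
      [q-1]^n≢0 : ℤ.NonZero ((+ q - 1ℤ) ^ n)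
      [q-1]^n≢0 = ℤ.≢-nonZero (power≢0 n)
        where
        power≢0 : ∀ n → (+ q - 1ℤ) ^ n ≢ 0ℤ
        power≢0 zero    ()
        power≢0 (suc n) eq with ℤ.i*j≡0⇒i≡0∨j≡0 (+ q - 1ℤ) eq
        ... | inj₁ eq′ = ℕ.≢-nonZero⁻¹ ℤ.∣ + q - 1ℤ ∣ (cong ℤ.∣_∣ eq′)
        ... | inj₂ eq′ = power≢0 n eq′

    mixed : Vec (Fin q) n → Vec (Fin q) n → (Fin n → ℕ) → Fin q
    mixed x y m′ = ∑ᶠ λ j → a j *ᶠ (lookup x j ^ᶠ e j *ᶠ lookup y j ^ᶠ m′ j)

    average : ∀ z → (+ q - 1ℤ) ^ n * z ≡ ∑ⱽ {n} (λ x → ω 1ℤ x * z)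
    average z = begin
      (+ q - 1ℤ) ^ n * z             ≡⟨ ℤ.*-comm _ z ⟩
      z * (+ q - 1ℤ) ^ n             ≡⟨ cong (z *_) (∑ⱽ-ω 1ℤ n) ⟨
      z * ∑ⱽ {n} (ω 1ℤ)              ≡⟨ ∑ⱽ-scale {n} z (ω 1ℤ) ⟨
      ∑ⱽ {n} (λ x → z * ω 1ℤ x)      ≡⟨ ∑ⱽ-cong {n} (λ x → ℤ.*-comm z (ω 1ℤ x)) ⟩
      ∑ⱽ {n} (λ x → ω 1ℤ x * z)      ∎

    swap : ∀ m′ → ∑ⱽ (λ x → ω 1ℤ x * ∑ⱽ λ y → ω ν y * δ (mixed x y m′)) ≡
                  ∑ⱽ (λ y → ω ν y * ∑ⱽ λ x → ω 1ℤ x * δ (mixed x y m′))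
    swap m′ = begin
      ∑ⱽ (λ x → ω 1ℤ x * ∑ⱽ λ y → ω ν y * δ (mixed x y m′))
        ≡⟨ ∑ⱽ-cong (λ x → ∑ⱽ-scale (ω 1ℤ x) λ y → ω ν y * δ (mixed x y m′)) ⟨
      ∑ⱽ (λ x → ∑ⱽ λ y → ω 1ℤ x * (ω ν y * δ (mixed x y m′)))
        ≡⟨ ∑ⱽ-comm {n} {n} (λ x y → ω 1ℤ x * (ω ν y * δ (mixed x y m′))) ⟩
      ∑ⱽ (λ y → ∑ⱽ λ x → ω 1ℤ x * (ω ν y * δ (mixed x y m′)))
        ≡⟨ ∑ⱽ-cong {n} (λ y → ∑ⱽ-cong {n} λ x → rearrange (ω 1ℤ x) (ω ν y) (δ (mixed x y m′))) ⟩
      ∑ⱽ (λ y → ∑ⱽ λ x → ω ν y * (ω 1ℤ x * δ (mixed x y m′)))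
        ≡⟨ ∑ⱽ-cong (λ y → ∑ⱽ-scale (ω ν y) λ x → ω 1ℤ x * δ (mixed x y m′)) ⟩
      ∑ⱽ (λ y → ω ν y * ∑ⱽ λ x → ω 1ℤ x * δ (mixed x y m′)) ∎
      where
      rearrange : ∀ a b c → a * (b * c) ≡ b * (a * c)
      rearrange = solve-∀

    absorb : ∀ x → (∀ j → lookup x j ≢ 0#) → ∑ⱽ (λ y → ω ν y * δ (mixed x y m)) ≡ zeros ν a m
    absorb x x≢0 with simultaneous (lookup x) x≢0
    ... | s , s≢0 , h = begin
      ∑ⱽ (λ y → ω ν y * δ (mixed x y m))
        ≡⟨ ∑ⱽ-cong (λ y → cong₂ _*_ (ω-scaling ν v≢0 y) (step y)) ⟨
      ∑ⱽ (λ y → ω ν (v ⊙ y) * δ (form a m (v ⊙ y)))    ≡⟨ ∑ⱽ-scaling v≢0 (λ y → ω ν y * δ (form a m y)) ⟩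
      zeros ν a m                                      ∎
      where
      v : Fin n → Fin q
      v j = proj₁ (h j)
      v≢0 : ∀ j → v j ≢ 0#
      v≢0 j = proj₁ (proj₂ (h j))
      step : ∀ y → δ (form a m (v ⊙ y)) ≡ δ (mixed x y m)
      step y = trans (cong δ (trans (∑ᶠ-cong λ j → begin
          a j *ᶠ lookup (v ⊙ y) j ^ᶠ m j
            ≡⟨ cong (λ z → a j *ᶠ z ^ᶠ m j) (lookup-⊙ v y j) ⟩
          a j *ᶠ (v j *ᶠ lookup y j) ^ᶠ m j
            ≡⟨ cong (a j *ᶠ_) (^-distrib-* (v j) (lookup y j) (m j)) ⟩
          a j *ᶠ (v j ^ᶠ m j *ᶠ lookup y j ^ᶠ m j)
            ≡⟨ cong (λ z → a j *ᶠ (z *ᶠ lookup y j ^ᶠ m j)) (proj₂ (proj₂ (h j))) ⟨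
          a j *ᶠ (s *ᶠ lookup x j ^ᶠ e j *ᶠ lookup y j ^ᶠ m j)
            ≡⟨ cong (a j *ᶠ_) (*-assoc s _ _) ⟩
          a j *ᶠ (s *ᶠ (lookup x j ^ᶠ e j *ᶠ lookup y j ^ᶠ m j))
            ≡⟨ x*yz≡y*xz (a j) s _ ⟩
          s *ᶠ (a j *ᶠ (lookup x j ^ᶠ e j *ᶠ lookup y j ^ᶠ m j)) ∎)
        (sym (*-distrib-∑ᶠ s λ j → a j *ᶠ (lookup x j ^ᶠ e j *ᶠ lookup y j ^ᶠ m j))))) (δ-scaling s≢0 (mixed x y m))

    form-⊙ : ∀ x y → form a e ((lookup x) ⊙ y) ≡ mixed x y e
    form-⊙ x y = ∑ᶠ-cong λ j → cong (a j *ᶠ_)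
      (trans (cong (_^ᶠ e j) (lookup-⊙ (lookup x) y j)) (^-distrib-* (lookup x j) (lookup y j) (e j)))

    absorbₑ : ∀ x → (∀ j → lookup x j ≢ 0#) → ∑ⱽ (λ y → ω ν y * δ (mixed x y e)) ≡ zeros ν a e
    absorbₑ x x≢0 = trans
      (∑ⱽ-cong λ y → sym (cong₂ _*_ (ω-scaling ν x≢0 y) (cong δ (form-⊙ x y))))
      (∑ⱽ-scaling x≢0 (λ y → ω ν y * δ (form a e y)))

    powerShift : ∀ m e → NonZero m → e ∣ m → ∀ y → ∃ λ u → u ≢ 0# × y ^ᶠ m ≡ (u *ᶠ y) ^ᶠ e
    powerShift m e m≢0 (divides c m≡ce) y with y ≟ 0#
    ... | yes refl = 1# , 1≢0 ,
      trans (0^n≡0 m {{m≢0}})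
            (sym (trans (cong (_^ᶠ e) (*-identityˡ 0#)) (0^n≡0 e {{ℕ.m*n≢0⇒n≢0 c {{subst NonZero m≡ce m≢0}}}})))
    powerShift m e m≢0 (divides zero m≡0) y | no y≢0 = contradiction m≡0 (ℕ.≢-nonZero⁻¹ m {{m≢0}})
    powerShift m e m≢0 (divides (suc c) m≡ce) y | no y≢0 = y ^ᶠ c , ^-≢0 y≢0 c ,
      trans (cong (y ^ᶠ_) m≡ce) (trans (sym (^-assocʳ y (suc c) e)) (cong (_^ᶠ e) (*-comm y (y ^ᶠ c))))

    exchange : ∀ y → ∑ⱽ (λ x → ω 1ℤ x * δ (mixed x y m)) ≡ ∑ⱽ (λ x → ω 1ℤ x * δ (mixed x y e))
    exchange y = trans (∑ⱽ-cong λ x → cong₂ _*_ (sym (ω-scaling 1ℤ u≢0 x)) (cong δ (∑ᶠ-cong λ j → cong (a j *ᶠ_) (begin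
        lookup x j ^ᶠ e j *ᶠ lookup y j ^ᶠ m j
          ≡⟨ cong (lookup x j ^ᶠ e j *ᶠ_) (proj₂ (proj₂ (shift j))) ⟩
        lookup x j ^ᶠ e j *ᶠ (u j *ᶠ lookup y j) ^ᶠ e j
          ≡⟨ ^-distrib-* (lookup x j) (u j *ᶠ lookup y j) (e j) ⟨
        (lookup x j *ᶠ (u j *ᶠ lookup y j)) ^ᶠ e j
          ≡⟨ cong (_^ᶠ e j) (x*yz≡y*xz (lookup x j) (u j) (lookup y j)) ⟩
        (u j *ᶠ (lookup x j *ᶠ lookup y j)) ^ᶠ e j
          ≡⟨ cong (_^ᶠ e j) (*-assoc (u j) (lookup x j) (lookup y j)) ⟨
        (u j *ᶠ lookup x j *ᶠ lookup y j) ^ᶠ e j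
          ≡⟨ cong (λ z → (z *ᶠ lookup y j) ^ᶠ e j) (lookup-⊙ u x j) ⟨
        (lookup (u ⊙ x) j *ᶠ lookup y j) ^ᶠ e j
          ≡⟨ ^-distrib-* (lookup (u ⊙ x) j) (lookup y j) (e j) ⟩
        lookup (u ⊙ x) j ^ᶠ e j *ᶠ lookup y j ^ᶠ e j      ∎))))
      (∑ⱽ-scaling u≢0 (λ x → ω 1ℤ x * δ (mixed x y e)))
      where
      shift : ∀ j → ∃ λ u → u ≢ 0# × lookup y j ^ᶠ m j ≡ (u *ᶠ lookup y j) ^ᶠ e j
      shift j = powerShift (m j) (e j) (m≢0 j) (e∣m j) (lookup y j)
      u : Fin n → Fin q
      u j = proj₁ (shift j)
      u≢0 : ∀ j → u j ≢ 0#
      u≢0 j = proj₁ (proj₂ (shift j))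

gcds-∣ : ∀ l → All (gcds l ∣_) l
gcds-∣ []      = []
gcds-∣ (x ∷ l) = gcd[m,n]∣m x (gcds l) ∷ All.map (∣-trans (gcd[m,n]∣n x (gcds l))) (gcds-∣ l)

∣-lcms : ∀ l → All (_∣ lcms l) l
∣-lcms []      = []
∣-lcms (x ∷ l) = m∣lcm[m,n] x (lcms l) ∷ All.map (λ h → ∣-trans h (n∣lcm[m,n] x (lcms l))) (∣-lcms l)

exact-/ : ∀ {a x y b z} .{{_ : NonZero (a ℕ.* b)}} → a ∣ x → y ≡ z ℕ.* b →
  a ℕ.* (x ℕ.* y / (a ℕ.* b)) ≡ x ℕ.* z
exact-/ {a} {x} {y} {b} {z} (divides c x≡ca) y≡zb = begin
  a ℕ.* (x ℕ.* y / (a ℕ.* b))                       ≡⟨ cong (a ℕ.*_) (/-congˡ xy≡) ⟩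
  a ℕ.* ((c ℕ.* z) ℕ.* (a ℕ.* b) / (a ℕ.* b))       ≡⟨ cong (a ℕ.*_) (m*n/n≡m (c ℕ.* z) (a ℕ.* b)) ⟩
  a ℕ.* (c ℕ.* z)                                   ≡⟨ ℕ.*-assoc a c z ⟨
  a ℕ.* c ℕ.* z                                     ≡⟨ cong (ℕ._* z) (trans (ℕ.*-comm a c) (sym x≡ca)) ⟩
  x ℕ.* z                                           ∎
  where
  open ≡-Reasoning
  xy≡ : x ℕ.* y ≡ (c ℕ.* z) ℕ.* (a ℕ.* b)
  xy≡ = trans (cong₂ ℕ._*_ x≡ca y≡zb) (ℕ.[m*n]*[o*p]≡[m*o]*[n*p] c a z b)

∣+m-+n∣≡o : ∀ {m n o} → m ≡ n ℕ.+ o → ℤ.∣ + m - + n ∣ ≡ o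
∣+m-+n∣≡o {m} {n} {o} refl = begin
  ℤ.∣ + m - + n ∣    ≡⟨ cong ℤ.∣_∣ (ℤ.[+m]-[+n]≡m⊖n m n) ⟩
  ℤ.∣ m ℤ.⊖ n ∣      ≡⟨ ℤ.∣m⊖n∣≡∣n⊖m∣ m n ⟩
  ℤ.∣ n ℤ.⊖ m ∣      ≡⟨ ℤ.∣⊖∣-≤ (ℕ.m≤m+n n o) ⟩
  n ℕ.+ o ∸ n        ≡⟨ ℕ.m+n∸m≡n n o ⟩
  o                  ∎
  where open ≡-Reasoning

∣-∣-cases : ∀ m n → (m ≡ n ℕ.+ ℤ.∣ + m - + n ∣) ⊎ (n ≡ m ℕ.+ ℤ.∣ + m - + n ∣)
∣-∣-cases m n with ℕ.≤-total n m
... | inj₁ n≤m = inj₁ (trans m≡ (cong (n ℕ.+_) (sym (∣+m-+n∣≡o m≡))))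
  where m≡ = sym (ℕ.m+[n∸m]≡n n≤m)
... | inj₂ m≤n = inj₂ (trans n≡ (cong (m ℕ.+_) (trans (sym (∣+m-+n∣≡o n≡)) (ℤ.∣i-j∣≡∣j-i∣ (+ n) (+ m)))))
  where n≡ = sym (ℕ.m+[n∸m]≡n m≤n)

coprime-* : ∀ {k m n} → Coprime k m → Coprime k n → Coprime k (m ℕ.* n)
coprime-* k⊥m k⊥n (d∣k , d∣mn) = k⊥n (d∣k , coprime-divisor (λ (e∣d , e∣m) → k⊥m (∣-trans e∣d d∣k , e∣m)) d∣mn)

coprime-1 : ∀ k → Coprime k 1
coprime-1 k = Coprimality.sym (Coprimality.1-coprimeTo k)

coprimeMultiple : ∀ {n} k (f : Fin n → ℕ) → (∀ j → Coprime k (f j)) →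
  ∃ λ P → Coprime k P × (∀ j → f j ∣ P)
coprimeMultiple {zero}  k f k⊥f = 1 , coprime-1 k , λ ()
coprimeMultiple {suc n} k f k⊥f with coprimeMultiple k (f ∘ suc) (k⊥f ∘ suc)
... | P , k⊥P , f∣P = f zero ℕ.* P , coprime-* (k⊥f zero) k⊥P ,
  λ { zero → ∣m⇒∣m*n P ∣-refl ; (suc j) → ∣n⇒∣m*n (f zero) (f∣P j) }

coprimeMultipleOfOthers : ∀ {n} (h : Fin n → ℕ) → (∀ i j → i ≢ j → Coprime (h i) (h j)) →
  ∀ i → ∃ λ P → Coprime (h i) P × (∀ j → j ≢ i → h j ∣ P)
coprimeMultipleOfOthers {n} h h⊥h i =
  let P , hi⊥P , others∣P = coprimeMultiple (h i) others hi⊥others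
  in  P , hi⊥P , λ j j≢i → subst (_∣ P) (others-≢ j j≢i) (others∣P j)
  where
  others : Fin n → ℕ
  others j with j Fin.≟ i
  ... | yes _ = 1
  ... | no _  = h j
  hi⊥others : ∀ j → Coprime (h i) (others j)
  hi⊥others j with j Fin.≟ i
  ... | yes _  = coprime-1 (h i)
  ... | no j≢i = h⊥h i j (j≢i ∘ sym)
  others-≢ : ∀ j → j ≢ i → others j ≡ h j
  others-≢ j j≢i with j Fin.≟ i
  ... | yes j≡i = contradiction j≡i j≢i
  ... | no _    = refl

gcd∣1or2 : ∀ {e h P} → Coprime h P → (e ≡ 1 × Coprime h 2) ⊎ e ≡ 2 → gcd (e ℕ.* h) (2 ℕ.* P) ∣ e
gcd∣1or2 {h = h} {P} h⊥P (inj₁ (refl , h⊥2)) = ∣-reflexive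
  (coprime⇒gcd≡1 (subst (λ z → Coprime z (2 ℕ.* P)) (sym (ℕ.*-identityˡ h)) (coprime-* h⊥2 h⊥P)))
gcd∣1or2 {h = h} {P} h⊥P (inj₂ refl) = ∣-reflexive
  (trans (sym (c*gcd[m,n]≡gcd[cm,cn] 2 h P)) (cong (2 ℕ.*_) (coprime⇒gcd≡1 h⊥P)))

module Exponentiation {q : ℕ} (𝔽 : FinField q) where
  open FinFieldProperties 𝔽
  open Points 𝔽

  record IsPower (m : ℕ) (y : Fin q) : Set where
    constructor isPower
    field
      root    : Fin q
      root≢0  : root ≢ 0#
      isRoot  : y ≡ root ^ᶠ m

  isPower-1 : ∀ m → IsPower m 1#
  isPower-1 m = isPower 1# 1≢0 (sym (1^n≡1 m))

  isPower-* : ∀ {m y z} → IsPower m y → IsPower m z → IsPower m (y *ᶠ z)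
  isPower-* {m} (isPower v v≢0 refl) (isPower u u≢0 refl) = isPower (v *ᶠ u) (*-≢0 v≢0 u≢0) (sym (^-distrib-* v u m))

  isPower-⁻¹ : ∀ {m y} → IsPower m y → IsPower m (y ⁻¹)
  isPower-⁻¹ {m} (isPower v v≢0 refl) = isPower (v ⁻¹) (⁻¹-≢0 v≢0) (*-cancelˡ (^-≢0 v≢0 m) (begin
    v ^ᶠ m *ᶠ (v ^ᶠ m) ⁻¹    ≡⟨ *-inverseʳ (^-≢0 v≢0 m) ⟩
    1#                       ≡⟨ 1^n≡1 m ⟨
    1# ^ᶠ m                  ≡⟨ cong (_^ᶠ m) (*-inverseʳ v≢0) ⟨
    (v *ᶠ v ⁻¹) ^ᶠ m         ≡⟨ ^-distrib-* v (v ⁻¹) m ⟩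
    v ^ᶠ m *ᶠ (v ⁻¹) ^ᶠ m    ∎))
    where open ≡-Reasoning

  cancelInverse : ∀ {z} → z ≢ 0# → ∀ y → (y *ᶠ z) *ᶠ z ⁻¹ ≡ y
  cancelInverse {z} z≢0 y = trans (*-assoc y z (z ⁻¹)) (trans (cong (y *ᶠ_) (*-inverseʳ z≢0)) (*-identityʳ y))

  isPower-cancel : ∀ {m y z} → IsPower m (y *ᶠ z) → IsPower m z → IsPower m y
  isPower-cancel {m} {y} h hz@(isPower v v≢0 refl) =
    subst (IsPower m) (cancelInverse (^-≢0 v≢0 m) y) (isPower-* h (isPower-⁻¹ hz))

  isPower-∣ : ∀ {m x e} → x ≢ 0# → gcd m (q ∸ 1) ∣ e → IsPower m (x ^ᶠ e)
  isPower-∣ {m} {x} x≢0 d∣e = CancellativeSubmonoid.J-∣ powers d∣e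
    (CancellativeSubmonoid.J-gcd powers {m} {q ∸ 1} (isPower x x≢0 refl)
      (subst (IsPower m) (sym (fermat x≢0)) (isPower-1 m)))
    where
    powers : CancellativeSubmonoid (λ e → IsPower m (x ^ᶠ e))
    powers = record
      { J-zero   = isPower-1 m
      ; J-add    = λ {a} {b} ha hb → subst (IsPower m) (sym (^-homo-* x a b)) (isPower-* ha hb)
      ; J-cancel = λ {a} {b} hab hb → isPower-cancel (subst (IsPower m) (^-homo-* x a b) hab) hb
      }

  isPower-∏ : ∀ {m n} (f : Fin n → Fin q) → (∀ i → IsPower m (f i)) → IsPower m (∏ᶠ f)
  isPower-∏ {m} {zero}  f h = isPower-1 m
  isPower-∏ {m} {suc n} f h = isPower-* (h zero) (isPower-∏ (f ∘ suc) (h ∘ suc))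

  isPower-∏* : ∀ {m n} (f : Fin n → Fin q) y j → IsPower m (f j *ᶠ y) →
    (∀ i → i ≢ j → IsPower m (f i)) → IsPower m (∏ᶠ f *ᶠ y)
  isPower-∏* {m} f y zero    hj h = subst (IsPower m) (sym (xy*z≡xz*y (f zero) _ y))
    (isPower-* hj (isPower-∏ (f ∘ suc) λ i → h (suc i) λ ()))
  isPower-∏* {m} f y (suc j) hj h = subst (IsPower m) (sym (*-assoc (f zero) _ y))
    (isPower-* (h zero λ ()) (isPower-∏* (f ∘ suc) y j hj λ i i≢j → h (suc i) (i≢j ∘ Fin.suc-injective)))

  module _ {n} (m e h : Fin n → ℕ)
           (d≡e*h : ∀ j → gcd (m j) (q ∸ 1) ≡ e j ℕ.* h j)
           (e≡1or2 : ∀ j → (e j ≡ 1 × Coprime (h j) 2) ⊎ e j ≡ 2)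
           (h⊥h : ∀ i j → i ≢ j → Coprime (h i) (h j)) where

    private
      d∣2P : ∀ j {P} → h j ∣ P → gcd (m j) (q ∸ 1) ∣ 2 ℕ.* P
      d∣2P j {P} h∣P = subst (_∣ 2 ℕ.* P) (sym (d≡e*h j)) (lemma (e≡1or2 j))
        where
        lemma : ∀ {e} → (e ≡ 1 × Coprime (h j) 2) ⊎ e ≡ 2 → e ℕ.* h j ∣ 2 ℕ.* P
        lemma (inj₁ (refl , _)) = *-pres-∣ {1} {2} (divides 2 refl) h∣P
        lemma (inj₂ refl)       = *-pres-∣ {2} {2} ∣-refl h∣P

    adjustOne : ∀ {x} → x ≢ 0# → ∀ i → ∃ λ s → s ≢ 0# ×
      (∀ j → j ≢ i → IsPower (m j) s) × IsPower (m i) (s *ᶠ x ^ᶠ e i)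
    adjustOne {x} x≢0 i with coprimeMultipleOfOthers h h⊥h i
    ... | P , hi⊥P , h∣P = CancellativeSubmonoid.J-∣ adjustable
          (subst (λ z → gcd z (2 ℕ.* P) ∣ e i) (sym (d≡e*h i)) (gcd∣1or2 hi⊥P (e≡1or2 i)))
          (CancellativeSubmonoid.J-gcd adjustable {gcd (m i) (q ∸ 1)} {2 ℕ.* P} J-d J-2P)
      where
      Adjustable : ℕ → Set
      Adjustable k = ∃ λ s → s ≢ 0# × (∀ j → j ≢ i → IsPower (m j) s) × IsPower (m i) (s *ᶠ x ^ᶠ k)

      J-d : Adjustable (gcd (m i) (q ∸ 1))
      J-d = 1# , 1≢0 , (λ j _ → isPower-1 (m j)) ,
        subst (IsPower (m i)) (sym (*-identityˡ _)) (isPower-∣ x≢0 ∣-refl)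

      J-2P : Adjustable (2 ℕ.* P)
      J-2P = (x ^ᶠ (2 ℕ.* P)) ⁻¹ , ⁻¹-≢0 (^-≢0 x≢0 (2 ℕ.* P)) ,
        (λ j j≢i → isPower-⁻¹ (isPower-∣ x≢0 (d∣2P j (h∣P j j≢i)))) ,
        subst (IsPower (m i)) (sym (*-inverseˡ (^-≢0 x≢0 (2 ℕ.* P)))) (isPower-1 (m i))

      adjustable : CancellativeSubmonoid Adjustable
      adjustable = record
        { J-zero   = 1# , 1≢0 , (λ j _ → isPower-1 (m j)) ,
            subst (IsPower (m i)) (sym (*-identityˡ 1#)) (isPower-1 (m i))
        ; J-add    = λ {a} {b} (s , s≢0 , hs , hsx) (t , t≢0 , ht , htx) →
            s *ᶠ t , *-≢0 s≢0 t≢0 , (λ j j≢i → isPower-* (hs j j≢i) (ht j j≢i)) ,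
            subst (IsPower (m i))
              (trans (*-interchange s (x ^ᶠ a) t (x ^ᶠ b)) (cong (s *ᶠ t *ᶠ_) (sym (^-homo-* x a b))))
              (isPower-* hsx htx)
        ; J-cancel = λ {a} {b} (s , s≢0 , hs , hsx) (t , t≢0 , ht , htx) →
            s *ᶠ t ⁻¹ , *-≢0 s≢0 (⁻¹-≢0 t≢0) ,
            (λ j j≢i → isPower-* (hs j j≢i) (isPower-⁻¹ (ht j j≢i))) ,
            isPower-cancel (subst (IsPower (m i)) (sym (regroup s t a b t≢0)) hsx) htx
        }
        where
        regroup : ∀ s t a b → t ≢ 0# →
          (s *ᶠ t ⁻¹ *ᶠ x ^ᶠ a) *ᶠ (t *ᶠ x ^ᶠ b) ≡ s *ᶠ x ^ᶠ (a ℕ.+ b)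
        regroup s t a b t≢0 = begin
          (s *ᶠ t ⁻¹ *ᶠ x ^ᶠ a) *ᶠ (t *ᶠ x ^ᶠ b)    ≡⟨ *-interchange (s *ᶠ t ⁻¹) (x ^ᶠ a) t (x ^ᶠ b) ⟩
          (s *ᶠ t ⁻¹ *ᶠ t) *ᶠ (x ^ᶠ a *ᶠ x ^ᶠ b)
            ≡⟨ cong₂ _*ᶠ_ (trans (*-assoc s _ t) (trans (cong (s *ᶠ_) (*-inverseˡ t≢0)) (*-identityʳ s))) (sym (^-homo-* x a b)) ⟩
          s *ᶠ x ^ᶠ (a ℕ.+ b)                       ∎
          where open ≡-Reasoning

    simultaneousPowers : (x : Fin n → Fin q) → (∀ j → x j ≢ 0#) →
      ∃ λ s → s ≢ 0# × (∀ j → IsPower (m j) (s *ᶠ x j ^ᶠ e j))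
    simultaneousPowers x x≢0 = ∏ᶠ s , ∏-≢0 s (λ i → proj₁ (proj₂ (adjust i))) , λ j →
      isPower-∏* s (x j ^ᶠ e j) j (proj₂ (proj₂ (proj₂ (adjust j))))
        λ i i≢j → proj₁ (proj₂ (proj₂ (adjust i))) j (i≢j ∘ sym)
      where
      adjust = λ i → adjustOne (x≢0 i) i
      s = λ i → proj₁ (adjust i)

module TorusSolutions {q : ℕ} (𝔽 : FinField q) {n} (k : ℕ) (κ m : Fin n → ℕ)
                      (k≢0 : NonZero k) (m≢0 : ∀ j → NonZero (m j)) where
  open FinFieldProperties 𝔽
  open Points 𝔽
  open Exponentiation 𝔽
  open Exponents q k κ m k≢0 m≢0

  k₀∣κ : ∀ j → k₀ ∣ κ j
  k₀∣κ = All.tabulate⁻ (All.++⁻ˡ (List.tabulate κ) (All.tail (gcds-∣ (k ∷ List.tabulate κ ++ [ q ∸ 1 ]))))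

  k₀∣k : k₀ ∣ k
  k₀∣k = gcd[m,n]∣m k _

  k₀∣q∸1 : k₀ ∣ q ∸ 1
  k₀∣q∸1 = All.head (All.++⁻ʳ (List.tabulate κ) (All.tail (gcds-∣ (k ∷ List.tabulate κ ++ [ q ∸ 1 ]))))

  m∣M : ∀ j → m j ∣ M
  m∣M = All.tabulate⁻ (∣-lcms (List.tabulate m))

  -- x ↦ λ x multiplies the form by μ, and so (form)^k / ∏ x^κ by ratio⁻¹.
  record Scaling (ratio : Fin q) : Set where
    constructor scaling
    field
      μ    : Fin q
      μ≢0  : μ ≢ 0#
      λᵥ   : Fin n → Fin q
      λ≢0  : ∀ j → λᵥ j ≢ 0#
      λ^m  : ∀ j → λᵥ j ^ᶠ m j ≡ μ
      ∏λ^κ : ∏ᶠ (λ j → λᵥ j ^ᶠ κ j) ≡ μ ^ᶠ k *ᶠ ratio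

  scaling-1 : Scaling 1#
  scaling-1 = scaling 1# 1≢0 (λ _ → 1#) (λ _ → 1≢0) (λ j → 1^n≡1 (m j))
    (trans (sum-ε *-commutativeMonoid _ λ j → 1^n≡1 (κ j))
           (sym (trans (cong (_*ᶠ 1#) (1^n≡1 k)) (*-identityˡ 1#))))

  ∏-^-distrib : ∀ (f g : Fin n → Fin q) →
    ∏ᶠ (λ j → (f j *ᶠ g j) ^ᶠ κ j) ≡ ∏ᶠ (λ j → f j ^ᶠ κ j) *ᶠ ∏ᶠ (λ j → g j ^ᶠ κ j)
  ∏-^-distrib f g = trans (∏-cong λ j → ^-distrib-* (f j) (g j) (κ j))
                          (∏-distrib (λ j → f j ^ᶠ κ j) (λ j → g j ^ᶠ κ j))

  scaling-* : ∀ {r s} → Scaling r → Scaling s → Scaling (r *ᶠ s)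
  scaling-* {r} {s} (scaling μ μ≢0 f f≢0 f^m ∏f) (scaling ν ν≢0 g g≢0 g^m ∏g) =
    scaling (μ *ᶠ ν) (*-≢0 μ≢0 ν≢0) (λ j → f j *ᶠ g j) (λ j → *-≢0 (f≢0 j) (g≢0 j))
      (λ j → trans (^-distrib-* (f j) (g j) (m j)) (cong₂ _*ᶠ_ (f^m j) (g^m j)))
      (begin
        ∏ᶠ (λ j → (f j *ᶠ g j) ^ᶠ κ j)                       ≡⟨ ∏-^-distrib f g ⟩
        ∏ᶠ (λ j → f j ^ᶠ κ j) *ᶠ ∏ᶠ (λ j → g j ^ᶠ κ j)       ≡⟨ cong₂ _*ᶠ_ ∏f ∏g ⟩
        (μ ^ᶠ k *ᶠ r) *ᶠ (ν ^ᶠ k *ᶠ s)                       ≡⟨ *-interchange (μ ^ᶠ k) r (ν ^ᶠ k) s ⟩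
        (μ ^ᶠ k *ᶠ ν ^ᶠ k) *ᶠ (r *ᶠ s)                       ≡⟨ cong (_*ᶠ (r *ᶠ s)) (^-distrib-* μ ν k) ⟨
        (μ *ᶠ ν) ^ᶠ k *ᶠ (r *ᶠ s)                            ∎)
    where open ≡-Reasoning

  scaling-^ : ∀ {r} → Scaling r → ∀ e → Scaling (r ^ᶠ e)
  scaling-^ h zero    = scaling-1
  scaling-^ h (suc e) = scaling-* h (scaling-^ h e)

  *^[q∸2] : ∀ {r} → r ≢ 0# → r *ᶠ r ^ᶠ (q ∸ 1 ∸ 1) ≡ 1#
  *^[q∸2] {r} r≢0 = trans (cong (r ^ᶠ_) (ℕ.m+[n∸m]≡n (ℕ.>-nonZero⁻¹ (q ∸ 1)))) (fermat r≢0)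

  scaling-cancel : ∀ {r s} → s ≢ 0# → Scaling (r *ᶠ s) → Scaling s → Scaling r
  scaling-cancel {r} {s} s≢0 hrs hs = subst Scaling
    (trans (*-assoc r s _) (trans (cong (r *ᶠ_) (*^[q∸2] s≢0)) (*-identityʳ r)))
    (scaling-* hrs (scaling-^ hs (q ∸ 1 ∸ 1)))

  module _ {s} (s≢0 : s ≢ 0#) where

    Scalable : ℕ → Set
    Scalable e = Scaling (s ^ᶠ (k₀ ℕ.* e))

    s^[k₀[a+b]] : ∀ a b → s ^ᶠ (k₀ ℕ.* (a ℕ.+ b)) ≡ s ^ᶠ (k₀ ℕ.* a) *ᶠ s ^ᶠ (k₀ ℕ.* b)
    s^[k₀[a+b]] a b = trans (cong (s ^ᶠ_) (ℕ.*-distribˡ-+ k₀ a b)) (^-homo-* s (k₀ ℕ.* a) (k₀ ℕ.* b))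

    scalable : CancellativeSubmonoid Scalable
    scalable = record
      { J-zero   = subst Scaling (sym (cong (s ^ᶠ_) (ℕ.*-zeroʳ k₀))) scaling-1
      ; J-add    = λ {a} {b} ha hb → subst Scaling (sym (s^[k₀[a+b]] a b)) (scaling-* ha hb)
      ; J-cancel = λ {a} {b} hab hb → scaling-cancel (^-≢0 s≢0 (k₀ ℕ.* b))
                                        (subst Scaling (s^[k₀[a+b]] a b) hab) hb
      }

    scalable-multiple : ∀ {e} → q ∸ 1 ≡ k₀ ℕ.* e → Scalable e
    scalable-multiple eq = subst Scaling (sym (trans (cong (s ^ᶠ_) (sym eq)) (fermat s≢0))) scaling-1

    -- Only the j-th coordinate is multiplied, by a root of unity of order dividing m j.
    scalable-coordinate : ∀ j → Scalable (((κ j ℕ.* (q ∸ 1)) / (k₀ ℕ.* d j)) {{k₀*d≢0 j}})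
    scalable-coordinate j = scaling 1# 1≢0 f f≢0 f^m (begin
      ∏ᶠ (λ i → f i ^ᶠ κ i)               ≡⟨ sum-single *-commutativeMonoid _ j f^κ-≢ ⟩
      f j ^ᶠ κ j                          ≡⟨ cong (_^ᶠ κ j) f-j ⟩
      (s ^ᶠ c) ^ᶠ κ j                     ≡⟨ ^-assocʳ s c (κ j) ⟩
      s ^ᶠ (c ℕ.* κ j)                    ≡⟨ cong (s ^ᶠ_) (ℕ.*-comm c (κ j)) ⟩
      s ^ᶠ (κ j ℕ.* c)                    ≡⟨ cong (s ^ᶠ_) (exact-/ {{k₀*d≢0 j}} (k₀∣κ j) q∸1≡cd) ⟨
      s ^ᶠ (k₀ ℕ.* e)                     ≡⟨ *-identityˡ _ ⟨
      1# *ᶠ s ^ᶠ (k₀ ℕ.* e)               ≡⟨ cong (_*ᶠ s ^ᶠ (k₀ ℕ.* e)) (1^n≡1 k) ⟨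
      1# ^ᶠ k *ᶠ s ^ᶠ (k₀ ℕ.* e)          ∎)
      where
      open ≡-Reasoning
      e = ((κ j ℕ.* (q ∸ 1)) / (k₀ ℕ.* d j)) {{k₀*d≢0 j}}
      c = quotient (gcd[m,n]∣n (m j) (q ∸ 1))
      q∸1≡cd : q ∸ 1 ≡ c ℕ.* d j
      q∸1≡cd = _∣_.equality (gcd[m,n]∣n (m j) (q ∸ 1))
      f : Fin n → Fin q
      f i with i Fin.≟ j
      ... | yes _ = s ^ᶠ c
      ... | no _  = 1#
      f≢0 : ∀ i → f i ≢ 0#
      f≢0 i with i Fin.≟ j
      ... | yes _ = ^-≢0 s≢0 c
      ... | no _  = 1≢0
      f-j : f j ≡ s ^ᶠ c
      f-j with j Fin.≟ j
      ... | yes _  = refl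
      ... | no j≢j = contradiction refl j≢j
      f^κ-≢ : ∀ i → i ≢ j → f i ^ᶠ κ i ≡ 1#
      f^κ-≢ i i≢j with i Fin.≟ j
      ... | yes i≡j = contradiction i≡j i≢j
      ... | no _    = 1^n≡1 (κ i)
      f^m : ∀ i → f i ^ᶠ m i ≡ 1#
      f^m i with i Fin.≟ j
      ... | no _     = 1^n≡1 (m i)
      ... | yes refl = begin
        (s ^ᶠ c) ^ᶠ m j
          ≡⟨ cong ((s ^ᶠ c) ^ᶠ_) (trans (_∣_.equality (gcd[m,n]∣m (m j) (q ∸ 1))) (ℕ.*-comm c′ (d j))) ⟩
        (s ^ᶠ c) ^ᶠ (d j ℕ.* c′)         ≡⟨ ^-assocʳ (s ^ᶠ c) (d j) c′ ⟨
        ((s ^ᶠ c) ^ᶠ d j) ^ᶠ c′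
          ≡⟨ cong (_^ᶠ c′) (trans (^-assocʳ s c (d j)) (trans (cong (s ^ᶠ_) (sym q∸1≡cd)) (fermat s≢0))) ⟩
        1# ^ᶠ c′                         ≡⟨ 1^n≡1 c′ ⟩
        1#                               ∎
        where c′ = quotient (gcd[m,n]∣m (m j) (q ∸ 1))

    weightSum weightDegree : ℕ
    weightSum    = ℕ.sum (List.tabulate λ j → ((κ j ℕ.* M) / (k₀ ℕ.* m j)) {{k₀*m≢0 j}})
    weightDegree = ((k ℕ.* M) / k₀) {{k₀≢0}}

    -- The weighted homogeneity of the form, in which x j has degree M / m j.
    weighted : ∀ r → s ^ᶠ (k₀ ℕ.* weightDegree) *ᶠ r ≡ s ^ᶠ (k₀ ℕ.* weightSum) → Scaling r
    weighted r eq = scaling (s ^ᶠ M) (^-≢0 s≢0 M) (λ j → s ^ᶠ c j) (λ j → ^-≢0 s≢0 (c j))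
      (λ j → trans (^-assocʳ s (c j) (m j)) (cong (s ^ᶠ_) (sym (M≡cm j))))
      (begin
        ∏ᶠ (λ j → (s ^ᶠ c j) ^ᶠ κ j)
          ≡⟨ ∏-cong (λ j → trans (^-assocʳ s (c j) (κ j)) (cong (s ^ᶠ_) (trans (ℕ.*-comm (c j) (κ j)) (sym (exact-/ {{k₀*m≢0 j}} (k₀∣κ j) (M≡cm j)))))) ⟩
        ∏ᶠ (λ j → s ^ᶠ (k₀ ℕ.* e j))                ≡⟨ ∏-powers e ⟩
        s ^ᶠ (k₀ ℕ.* weightSum)                     ≡⟨ eq ⟨
        s ^ᶠ (k₀ ℕ.* weightDegree) *ᶠ r             ≡⟨ cong (λ z → s ^ᶠ z *ᶠ r) k₀*degree ⟩
        s ^ᶠ (M ℕ.* k) *ᶠ r                         ≡⟨ cong (_*ᶠ r) (^-assocʳ s M k) ⟨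
        (s ^ᶠ M) ^ᶠ k *ᶠ r                          ∎)
      where
      open ≡-Reasoning
      c e : Fin n → ℕ
      c j = quotient (m∣M j)
      e j = ((κ j ℕ.* M) / (k₀ ℕ.* m j)) {{k₀*m≢0 j}}
      M≡cm : ∀ j → M ≡ c j ℕ.* m j
      M≡cm j = _∣_.equality (m∣M j)
      k₀*degree : k₀ ℕ.* weightDegree ≡ M ℕ.* k
      k₀*degree = trans (m*[n/m]≡n {{k₀≢0}} (∣-trans k₀∣k (divides M (ℕ.*-comm k M)))) (ℕ.*-comm k M)
      ∏-powers : ∀ {l} (e : Fin l → ℕ) → ∏ᶠ (λ j → s ^ᶠ (k₀ ℕ.* e j)) ≡ s ^ᶠ (k₀ ℕ.* ℕ.sum (List.tabulate e))
      ∏-powers {zero}  e = cong (s ^ᶠ_) (sym (ℕ.*-zeroʳ k₀))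
      ∏-powers {suc l} e = trans (cong (s ^ᶠ (k₀ ℕ.* e zero) *ᶠ_) (∏-powers (e ∘ suc)))
                                 (sym (s^[k₀[a+b]] (e zero) _))

    scalable-weighted : Scalable ℤ.∣ + weightSum - + weightDegree ∣
    scalable-weighted with ∣-∣-cases weightSum weightDegree
    ... | inj₁ sum≡ = weighted _ (trans (sym (s^[k₀[a+b]] weightDegree _)) (cong (λ z → s ^ᶠ (k₀ ℕ.* z)) (sym sum≡)))
    ... | inj₂ degree≡ = scaling-cancel (⁻¹-≢0 r≢0) (subst Scaling (sym (*-inverseʳ r≢0)) scaling-1)
      (weighted (r ⁻¹) (begin
        s ^ᶠ (k₀ ℕ.* weightDegree) *ᶠ r ⁻¹        ≡⟨ cong (λ z → s ^ᶠ (k₀ ℕ.* z) *ᶠ r ⁻¹) degree≡ ⟩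
        s ^ᶠ (k₀ ℕ.* (weightSum ℕ.+ e)) *ᶠ r ⁻¹   ≡⟨ cong (_*ᶠ r ⁻¹) (s^[k₀[a+b]] weightSum e) ⟩
        s ^ᶠ (k₀ ℕ.* weightSum) *ᶠ r *ᶠ r ⁻¹      ≡⟨ cancelInverse r≢0 _ ⟩
        s ^ᶠ (k₀ ℕ.* weightSum)                   ∎))
      where
      open ≡-Reasoning
      e   = ℤ.∣ + weightSum - + weightDegree ∣
      r   = s ^ᶠ (k₀ ℕ.* e)
      r≢0 = ^-≢0 s≢0 (k₀ ℕ.* e)

    scaling-k₀ : exponentGcd ≡ 1ℤ → Scaling (s ^ᶠ k₀)
    scaling-k₀ gcd≡1 = subst (λ e → Scaling (s ^ᶠ e)) (ℕ.*-identityʳ k₀)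
      (subst Scalable (ℤ.+-injective gcd≡1)
        (CancellativeSubmonoid.J-gcd scalable {ℤ.∣ + weightSum - + weightDegree ∣} scalable-weighted
          (CancellativeSubmonoid.J-gcds scalable
            (All.++⁺ (All.tabulate⁺ scalable-coordinate)
                     (scalable-multiple (sym (m*[n/m]≡n {{k₀≢0}} k₀∣q∸1)) ∷ [])))))

  module _ (a : Fin n → Fin q) {b} (b≢0 : b ≢ 0#)
           (b-power : ∃ λ y → b ≡ y ^ᶠ k₀) (gcd≡1 : exponentGcd ≡ 1ℤ) where

    monomial : Vec (Fin q) n → Fin q
    monomial x = ∏ᶠ λ j → lookup x j ^ᶠ κ j

    torusSolutions : ℤ
    torusSolutions = ∑ⱽ λ x → ω 1ℤ x * ⟦ form a m x ^ᶠ k ≟ b *ᶠ monomial x ⟧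

    private
      twisted : Vec (Fin q) n → Fin q → ℤ
      twisted x s = ⟦ form a m x ^ᶠ k ≟ b *ᶠ monomial x *ᶠ s ^ᶠ k₀ ⟧

    torusSolutions-twist : ∀ {s} → s ≢ 0# → torusSolutions ≡ ∑ⱽ λ x → ω 1ℤ x * twisted x s
    torusSolutions-twist {s} s≢0 = trans
      (sym (∑ⱽ-scaling λ≢0 λ x → ω 1ℤ x * ⟦ form a m x ^ᶠ k ≟ b *ᶠ monomial x ⟧))
      (∑ⱽ-cong λ x → cong₂ _*_ (ω-scaling 1ℤ λ≢0 x)
        (⟦⟧-cong (form a m (λᵥ ⊙ x) ^ᶠ k ≟ b *ᶠ monomial (λᵥ ⊙ x))
                 (form a m x ^ᶠ k ≟ b *ᶠ monomial x *ᶠ s ^ᶠ k₀)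
          (λ eq → *-cancelˡ (^-≢0 μ≢0 k) (trans (sym (lhs x)) (trans eq (rhs x))))
          (λ eq → trans (lhs x) (trans (cong (μ ^ᶠ k *ᶠ_) eq) (sym (rhs x))))))
      where
      open ≡-Reasoning
      open Scaling (scaling-k₀ s≢0 gcd≡1)
      lhs : ∀ x → form a m (λᵥ ⊙ x) ^ᶠ k ≡ μ ^ᶠ k *ᶠ form a m x ^ᶠ k
      lhs x = trans (cong (_^ᶠ k) (trans (∑ᶠ-cong λ j → begin
          a j *ᶠ lookup (λᵥ ⊙ x) j ^ᶠ m j             ≡⟨ cong (λ z → a j *ᶠ z ^ᶠ m j) (lookup-⊙ λᵥ x j) ⟩
          a j *ᶠ (λᵥ j *ᶠ lookup x j) ^ᶠ m j
            ≡⟨ cong (a j *ᶠ_) (^-distrib-* (λᵥ j) (lookup x j) (m j)) ⟩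
          a j *ᶠ (λᵥ j ^ᶠ m j *ᶠ lookup x j ^ᶠ m j)
            ≡⟨ cong (λ z → a j *ᶠ (z *ᶠ lookup x j ^ᶠ m j)) (λ^m j) ⟩
          a j *ᶠ (μ *ᶠ lookup x j ^ᶠ m j)             ≡⟨ x*yz≡y*xz (a j) μ _ ⟩
          μ *ᶠ (a j *ᶠ lookup x j ^ᶠ m j)             ∎)
        (sym (*-distrib-∑ᶠ μ λ j → a j *ᶠ lookup x j ^ᶠ m j)))) (^-distrib-* μ (form a m x) k)
      rhs : ∀ x → b *ᶠ monomial (λᵥ ⊙ x) ≡ μ ^ᶠ k *ᶠ (b *ᶠ monomial x *ᶠ s ^ᶠ k₀)
      rhs x = begin
        b *ᶠ monomial (λᵥ ⊙ x)
          ≡⟨ cong (b *ᶠ_) (trans (∏-cong λ j → cong (_^ᶠ κ j) (lookup-⊙ λᵥ x j)) (∏-^-distrib λᵥ (lookup x))) ⟩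
        b *ᶠ (∏ᶠ (λ j → λᵥ j ^ᶠ κ j) *ᶠ monomial x)      ≡⟨ cong (λ z → b *ᶠ (z *ᶠ monomial x)) ∏λ^κ ⟩
        b *ᶠ (μ ^ᶠ k *ᶠ s ^ᶠ k₀ *ᶠ monomial x)
          ≡⟨ cong (b *ᶠ_) (xy*z≡xz*y (μ ^ᶠ k) (s ^ᶠ k₀) (monomial x)) ⟩
        b *ᶠ (μ ^ᶠ k *ᶠ monomial x *ᶠ s ^ᶠ k₀)
          ≡⟨ cong (b *ᶠ_) (*-assoc (μ ^ᶠ k) (monomial x) (s ^ᶠ k₀)) ⟩
        b *ᶠ (μ ^ᶠ k *ᶠ (monomial x *ᶠ s ^ᶠ k₀))         ≡⟨ x*yz≡y*xz b (μ ^ᶠ k) _ ⟩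
        μ ^ᶠ k *ᶠ (b *ᶠ (monomial x *ᶠ s ^ᶠ k₀))
          ≡⟨ cong (μ ^ᶠ k *ᶠ_) (*-assoc b (monomial x) (s ^ᶠ k₀)) ⟨
        μ ^ᶠ k *ᶠ (b *ᶠ monomial x *ᶠ s ^ᶠ k₀)           ∎

    private
      w₁*-cong : ∀ x {y z : ℤ} → (x ≢ 0# → y ≡ z) → w 1ℤ x * y ≡ w 1ℤ x * z
      w₁*-cong x {y} {z} h with ≡0-cases x
      ... | inj₁ x≡0 = trans (cong (_* y) (w₁-0 x≡0)) (trans (ℤ.*-zeroˡ y)
                         (sym (trans (cong (_* z) (w₁-0 x≡0)) (ℤ.*-zeroˡ z))))
      ... | inj₂ x≢0 = cong (w 1ℤ x *_) (h x≢0)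

      quotientIsPower : ∀ x → (∀ j → lookup x j ≢ 0#) → form a m x ≢ 0# →
        ∃ λ z → z ≢ 0# × form a m x ^ᶠ k ≡ b *ᶠ monomial x *ᶠ z ^ᶠ k₀
      quotientIsPower x x≢0 S≢0 = S ^ᶠ k′ *ᶠ Y ⁻¹ , *-≢0 (^-≢0 S≢0 k′) (⁻¹-≢0 Y≢0) , (begin
        S ^ᶠ k                                       ≡⟨ cong (S ^ᶠ_) (_∣_.equality k₀∣k) ⟩
        S ^ᶠ (k′ ℕ.* k₀)                             ≡⟨ ^-assocʳ S k′ k₀ ⟨
        (S ^ᶠ k′) ^ᶠ k₀
          ≡⟨ cong (_^ᶠ k₀) (sym (trans (x*yz≡y*xz Y (S ^ᶠ k′) (Y ⁻¹)) (trans (cong (S ^ᶠ k′ *ᶠ_) (*-inverseʳ Y≢0)) (*-identityʳ _)))) ⟩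
        (Y *ᶠ (S ^ᶠ k′ *ᶠ Y ⁻¹)) ^ᶠ k₀               ≡⟨ ^-distrib-* Y _ k₀ ⟩
        Y ^ᶠ k₀ *ᶠ (S ^ᶠ k′ *ᶠ Y ⁻¹) ^ᶠ k₀           ≡⟨ cong (_*ᶠ (S ^ᶠ k′ *ᶠ Y ⁻¹) ^ᶠ k₀) Y^k₀ ⟩
        b *ᶠ monomial x *ᶠ (S ^ᶠ k′ *ᶠ Y ⁻¹) ^ᶠ k₀   ∎)
        where
        open ≡-Reasoning
        S  = form a m x
        k′ = quotient k₀∣k
        y  = proj₁ b-power
        X  = ∏ᶠ (λ j → lookup x j ^ᶠ quotient (k₀∣κ j))
        Y  = y *ᶠ X
        y≢0 : y ≢ 0#
        y≢0 y≡0 = b≢0 (trans (proj₂ b-power) (trans (cong (_^ᶠ k₀) y≡0) (0^n≡0 k₀ {{k₀≢0}})))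
        Y≢0 : Y ≢ 0#
        Y≢0 = *-≢0 y≢0 (∏-≢0 _ λ j → ^-≢0 (x≢0 j) (quotient (k₀∣κ j)))
        ∏-^ : ∀ {l} (f : Fin l → Fin q) e → ∏ᶠ f ^ᶠ e ≡ ∏ᶠ (λ j → f j ^ᶠ e)
        ∏-^ {zero}  f e = 1^n≡1 e
        ∏-^ {suc l} f e = trans (^-distrib-* (f zero) _ e) (cong (f zero ^ᶠ e *ᶠ_) (∏-^ (f ∘ suc) e))
        Y^k₀ : Y ^ᶠ k₀ ≡ b *ᶠ monomial x
        Y^k₀ = trans (^-distrib-* y X k₀) (cong₂ _*ᶠ_ (sym (proj₂ b-power))
          (trans (∏-^ (λ j → lookup x j ^ᶠ quotient (k₀∣κ j)) k₀) (∏-cong λ j →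
            trans (^-assocʳ (lookup x j) (quotient (k₀∣κ j)) k₀)
                  (cong (lookup x j ^ᶠ_) (sym (_∣_.equality (k₀∣κ j)))))))

    twistSum : ∀ x → (∀ j → lookup x j ≢ 0#) →
      ∑ (λ s → w 1ℤ s * twisted x s) ≡ + k₀ * (1ℤ - δ (form a m x))
    twistSum x x≢0 with ≡0-cases (form a m x)
    ... | inj₁ S≡0 = trans
      (∑-zero _ λ s → trans (w₁*-cong s λ s≢0 →
        ⟦⟧-no (form a m x ^ᶠ k ≟ b *ᶠ monomial x *ᶠ s ^ᶠ k₀) λ eq →
          *-≢0 (*-≢0 b≢0 (∏-≢0 (λ j → lookup x j ^ᶠ κ j) λ j → ^-≢0 (x≢0 j) (κ j))) (^-≢0 s≢0 k₀)
            (trans (sym eq) (trans (cong (_^ᶠ k) S≡0) (0^n≡0 k {{k≢0}}))))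
        (ℤ.*-zeroʳ (w 1ℤ s)))
      (sym (trans (cong (λ z → + k₀ * (1ℤ - z)) (trans (cong δ S≡0) δ-0)) (ℤ.*-zeroʳ (+ k₀))))
    ... | inj₂ S≢0 = begin
      ∑ (λ s → w 1ℤ s * twisted x s)       ≡⟨ ∑-cong step ⟩
      ∑ (λ s → ⟦ s ^ᶠ k₀ ≟ z ^ᶠ k₀ ⟧)      ≡⟨ powerFibre k₀ z z≢0 ⟩
      rootsOfUnity k₀                      ≡⟨ rootsOfUnity-≡ k₀ _ (m*[n/m]≡n {{k₀≢0}} k₀∣q∸1) ⟩
      + k₀                                 ≡⟨ ℤ.*-identityʳ (+ k₀) ⟨
      + k₀ * 1ℤ                            ≡⟨ cong (λ z → + k₀ * (1ℤ - z)) (δ-≢0 S≢0) ⟨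
      + k₀ * (1ℤ - δ (form a m x))         ∎
      where
      open ≡-Reasoning
      root = quotientIsPower x x≢0 S≢0
      z    = proj₁ root
      z≢0  = proj₁ (proj₂ root)
      B≢0 : b *ᶠ monomial x ≢ 0#
      B≢0 = *-≢0 b≢0 (∏-≢0 (λ j → lookup x j ^ᶠ κ j) λ j → ^-≢0 (x≢0 j) (κ j))
      step : ∀ s → w 1ℤ s * twisted x s ≡ ⟦ s ^ᶠ k₀ ≟ z ^ᶠ k₀ ⟧
      step s with ≡0-cases s
      ... | inj₁ s≡0 = trans (cong (_* twisted x s) (w₁-0 s≡0)) (trans (ℤ.*-zeroˡ (twisted x s))
        (sym (⟦⟧-no (s ^ᶠ k₀ ≟ z ^ᶠ k₀) λ eq → ^-≢0 z≢0 k₀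
          (trans (sym eq) (trans (cong (_^ᶠ k₀) s≡0) (0^n≡0 k₀ {{k₀≢0}}))))))
      ... | inj₂ s≢0 = trans (cong (_* twisted x s) (w₁-≢0 s≢0)) (trans (ℤ.*-identityˡ (twisted x s))
        (⟦⟧-cong (form a m x ^ᶠ k ≟ b *ᶠ monomial x *ᶠ s ^ᶠ k₀) (s ^ᶠ k₀ ≟ z ^ᶠ k₀)
          (λ eq → *-cancelˡ B≢0 (trans (sym eq) (proj₂ (proj₂ root))))
          (λ eq → trans (proj₂ (proj₂ root)) (cong (b *ᶠ monomial x *ᶠ_) (sym eq)))))

    torusSolutions-≡ : (+ q - 1ℤ) * torusSolutions ≡ + k₀ * ((+ q - 1ℤ) ^ n - zeros 1ℤ a m)
    torusSolutions-≡ = begin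
      (+ q - 1ℤ) * torusSolutions                               ≡⟨ ℤ.*-comm (+ q - 1ℤ) torusSolutions ⟩
      torusSolutions * (+ q - 1ℤ)                               ≡⟨ cong (torusSolutions *_) (∑-w 1ℤ) ⟨
      torusSolutions * ∑ (w 1ℤ)                                 ≡⟨ ∑-scale torusSolutions (w 1ℤ) ⟨
      ∑ (λ s → torusSolutions * w 1ℤ s)
        ≡⟨ ∑-cong (λ s → trans (ℤ.*-comm torusSolutions (w 1ℤ s)) (w₁*-cong s torusSolutions-twist)) ⟩
      ∑ (λ s → w 1ℤ s * ∑ⱽ λ x → ω 1ℤ x * twisted x s)
        ≡⟨ ∑-cong (λ s → ∑ⱽ-scale (w 1ℤ s) λ x → ω 1ℤ x * twisted x s) ⟨
      ∑ (λ s → ∑ⱽ λ x → w 1ℤ s * (ω 1ℤ x * twisted x s))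
        ≡⟨ ∑-∑ⱽ-comm (λ s x → w 1ℤ s * (ω 1ℤ x * twisted x s)) ⟩
      ∑ⱽ (λ x → ∑ λ s → w 1ℤ s * (ω 1ℤ x * twisted x s))
        ≡⟨ ∑ⱽ-cong (λ x → trans (∑-cong λ s → rearrange (w 1ℤ s) (ω 1ℤ x) (twisted x s)) (∑-scale (ω 1ℤ x) λ s → w 1ℤ s * twisted x s)) ⟩
      ∑ⱽ (λ x → ω 1ℤ x * ∑ λ s → w 1ℤ s * twisted x s)          ≡⟨ ∑ⱽ-cong (λ x → ω₁*-cong x (twistSum x)) ⟩
      ∑ⱽ (λ x → ω 1ℤ x * (+ k₀ * (1ℤ - δ (form a m x))))
        ≡⟨ ∑ⱽ-cong (λ x → expand (ω 1ℤ x) (+ k₀) (δ (form a m x))) ⟩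
      ∑ⱽ (λ x → + k₀ * (ω 1ℤ x + -1ℤ * (ω 1ℤ x * δ (form a m x))))
        ≡⟨ ∑ⱽ-scale (+ k₀) (λ x → ω 1ℤ x + -1ℤ * (ω 1ℤ x * δ (form a m x))) ⟩
      + k₀ * ∑ⱽ (λ x → ω 1ℤ x + -1ℤ * (ω 1ℤ x * δ (form a m x)))
        ≡⟨ cong (+ k₀ *_) (∑ⱽ-+ (ω 1ℤ) λ x → -1ℤ * (ω 1ℤ x * δ (form a m x))) ⟩
      + k₀ * (∑ⱽ {n} (ω 1ℤ) + ∑ⱽ (λ x → -1ℤ * (ω 1ℤ x * δ (form a m x))))
        ≡⟨ cong (+ k₀ *_) (cong₂ _+_ (∑ⱽ-ω 1ℤ n) (trans (∑ⱽ-scale -1ℤ λ x → ω 1ℤ x * δ (form a m x)) (ℤ.-1*i≡-i _))) ⟩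
      + k₀ * ((+ q - 1ℤ) ^ n - zeros 1ℤ a m)                    ∎
      where
      open ≡-Reasoning
      rearrange : ∀ a b c → a * (b * c) ≡ b * (a * c)
      rearrange = solve-∀
      expand : ∀ o k d → o * (k * (1ℤ - d)) ≡ k * (o + -1ℤ * (o * d))
      expand = solve-∀

∑-≤0 : ∀ {n} (f : Fin n → ℤ) → (∀ i → f i ℤ.≤ 0ℤ) → ∑ f ≡ 0ℤ → ∀ j → f j ≡ 0ℤ
∑-≤0 {n} f f≤0 ∑f≡0 j = ℤ.≤-antisym (f≤0 j) (begin
  0ℤ          ≡⟨ ∑f≡0 ⟨
  ∑ f         ≤⟨ ∑-mono f≤g ⟩
  ∑ g         ≡⟨ ∑-single g j g-≢ ⟩
  g j         ≡⟨ g-j ⟩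
  f j         ∎)
  where
  open ℤ.≤-Reasoning
  g : Fin n → ℤ
  g i with i Fin.≟ j
  ... | yes _ = f i
  ... | no _  = 0ℤ
  f≤g : ∀ i → f i ℤ.≤ g i
  f≤g i with i Fin.≟ j
  ... | yes _ = ℤ.≤-refl
  ... | no _  = f≤0 i
  g-≢ : ∀ i → i ≢ j → g i ≡ 0ℤ
  g-≢ i i≢j with i Fin.≟ j
  ... | yes i≡j = contradiction i≡j i≢j
  ... | no _    = refl
  g-j : g j ≡ f j
  g-j with j Fin.≟ j
  ... | yes _  = refl
  ... | no j≢j = contradiction refl j≢j

-- α + γ g = ∏ (z g − ν) in ℤ[g] with g² = G.
α γ : ℤ → ℤ → List ℤ → ℤ
α G ν []       = 1ℤ
α G ν (z ∷ zs) = z * G * γ G ν zs - ν * α G ν zs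
γ G ν []       = 0ℤ
γ G ν (z ∷ zs) = z * α G ν zs - ν * γ G ν zs

module QuadraticCharacter {q : ℕ} (𝔽 : FinField q) where
  open FinFieldProperties 𝔽
  open Points 𝔽

  square? : ∀ x → Dec (∃ λ z → z *ᶠ z ≡ x)
  square? x = Fin.any? λ z → z *ᶠ z ≟ x

  χ : Fin q → ℤ
  χ x = if does (x ≟ 0#) then 0ℤ else if does (square? x) then 1ℤ else -1ℤ

  data Squareness (x : Fin q) : Set where
    null      : x ≡ 0# → χ x ≡ 0ℤ → Squareness x
    square    : ∀ z → z ≢ 0# → x ≡ z *ᶠ z → χ x ≡ 1ℤ → Squareness x
    nonsquare : x ≢ 0# → (∀ z → z *ᶠ z ≢ x) → χ x ≡ -1ℤ → Squareness x

  squareness : ∀ x → Squareness x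
  squareness x = helper (x ≟ 0#) (square? x)
    where
    helper : Dec (x ≡ 0#) → Dec (∃ λ z → z *ᶠ z ≡ x) → Squareness x
    helper (yes x≡0) _ = null x≡0 (cong (if_then 0ℤ else if does (square? x) then 1ℤ else -1ℤ) (dec-true (x ≟ 0#) x≡0))
    helper (no x≢0) (yes (z , zz≡x)) = square z (λ z≡0 → x≢0 (trans (sym zz≡x) (trans (cong (_*ᶠ z) z≡0) (zeroˡ z)))) (sym zz≡x)
      (trans (cong (if_then 0ℤ else if does (square? x) then 1ℤ else -1ℤ) (dec-false (x ≟ 0#) x≢0)) (cong (if_then 1ℤ else -1ℤ) (dec-true (square? x) (z , zz≡x))))
    helper (no x≢0) (no ¬sq) = nonsquare x≢0 (λ z zz≡x → ¬sq (z , zz≡x))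
      (trans (cong (if_then 0ℤ else if does (square? x) then 1ℤ else -1ℤ) (dec-false (x ≟ 0#) x≢0)) (cong (if_then 1ℤ else -1ℤ) (dec-false (square? x) ¬sq)))

  χ-0 : χ 0# ≡ 0ℤ
  χ-0 = cong (if_then 0ℤ else if does (square? 0#) then 1ℤ else -1ℤ) (dec-true (0# ≟ 0#) refl)

  χ-square : ∀ {z} → z ≢ 0# → χ (z *ᶠ z) ≡ 1ℤ
  χ-square {z} z≢0 with squareness (z *ᶠ z)
  ... | null zz≡0 _         = contradiction zz≡0 (*-≢0 z≢0 z≢0)
  ... | square _ _ _ χ≡1    = χ≡1
  ... | nonsquare _ ¬sq _   = contradiction refl (¬sq z)

  χ≤1 : ∀ x → χ x ℤ.≤ 1ℤ
  χ≤1 x with squareness x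
  ... | null _ eq        = subst (ℤ._≤ 1ℤ) (sym eq) (ℤ.+≤+ z≤n)
  ... | square _ _ _ eq  = ℤ.≤-reflexive eq
  ... | nonsquare _ _ eq = subst (ℤ._≤ 1ℤ) (sym eq) ℤ.-≤+

  χ*χ≡w₁ : ∀ x → χ x * χ x ≡ w 1ℤ x
  χ*χ≡w₁ x with squareness x
  ... | null x≡0 eq          = trans (cong₂ _*_ eq eq) (sym (w₁-0 x≡0))
  ... | square z z≢0 refl eq = trans (cong₂ _*_ eq eq) (sym (w₁-≢0 (*-≢0 z≢0 z≢0)))
  ... | nonsquare x≢0 _ eq   = trans (cong₂ _*_ eq eq) (sym (w₁-≢0 x≢0))

  χ*χ≡1 : ∀ {x} → x ≢ 0# → χ x * χ x ≡ 1ℤ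
  χ*χ≡1 {x} x≢0 = trans (χ*χ≡w₁ x) (w₁-≢0 x≢0)

  θ : ℤ
  θ = χ (-ᶠ 1#)

  module _ (2∣q∸1 : 2 ∣ q ∸ 1) where

    squareRoots : ∀ y → ∑ (λ x → ⟦ x ^ᶠ 2 ≟ y ⟧) ≡ 1ℤ + χ y
    squareRoots y with squareness y
    ... | null refl eq = trans
      (∑-cong λ x → ⟦⟧-cong (x ^ᶠ 2 ≟ 0#) (x ≟ 0#) (x^n≡0 2) λ { refl → 0^n≡0 2 })
      (trans ∑-δ (cong (_+_ 1ℤ) (sym eq)))
    ... | square z z≢0 refl eq = trans
      (∑-cong λ x → cong (λ v → ⟦ x ^ᶠ 2 ≟ z *ᶠ v ⟧) (sym (*-identityʳ z)))
      (trans (powerFibre 2 z z≢0)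
        (trans (rootsOfUnity-≡ 2 (_∣_.quotient 2∣q∸1) (trans (ℕ.*-comm 2 (_∣_.quotient 2∣q∸1)) (sym (_∣_.equality 2∣q∸1)))) (cong (_+_ 1ℤ) (sym eq))))
    ... | nonsquare _ ¬sq eq = trans
      (∑-zero _ λ x → ⟦⟧-no (x ^ᶠ 2 ≟ y) λ x²≡y → ¬sq x (trans (cong (x *ᶠ_) (sym (*-identityʳ x))) x²≡y))
      (cong (_+_ 1ℤ) (sym eq))

    ∑-square : ∀ (g : Fin q → ℤ) → ∑ (λ x → g (x ^ᶠ 2)) ≡ ∑ g + ∑ (λ y → χ y * g y)
    ∑-square g = begin
      ∑ (λ x → g (x ^ᶠ 2))                            ≡⟨ ∑-cong spread ⟩
      ∑ (λ x → ∑ λ y → g y * ⟦ x ^ᶠ 2 ≟ y ⟧)          ≡⟨ ∑-comm (λ x y → g y * ⟦ x ^ᶠ 2 ≟ y ⟧) ⟩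
      ∑ (λ y → ∑ λ x → g y * ⟦ x ^ᶠ 2 ≟ y ⟧)
        ≡⟨ ∑-cong (λ y → trans (∑-scale (g y) λ x → ⟦ x ^ᶠ 2 ≟ y ⟧) (cong (g y *_) (squareRoots y))) ⟩
      ∑ (λ y → g y * (1ℤ + χ y))                      ≡⟨ ∑-cong (λ y → expand (g y) (χ y)) ⟩
      ∑ (λ y → g y + χ y * g y)                       ≡⟨ ∑-+ g (λ y → χ y * g y) ⟩
      ∑ g + ∑ (λ y → χ y * g y)                       ∎
      where
      open ≡-Reasoning
      expand : ∀ u v → u * (1ℤ + v) ≡ u + v * u
      expand = solve-∀
      spread : ∀ x → g (x ^ᶠ 2) ≡ ∑ λ y → g y * ⟦ x ^ᶠ 2 ≟ y ⟧
      spread x = sym (trans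
        (∑-single (λ y → g y * ⟦ x ^ᶠ 2 ≟ y ⟧) (x ^ᶠ 2) λ y y≢ →
          trans (cong (g y *_) (⟦⟧-no (x ^ᶠ 2 ≟ y) (y≢ ∘ sym))) (ℤ.*-zeroʳ (g y)))
        (trans (cong (g (x ^ᶠ 2) *_) (⟦⟧-yes (x ^ᶠ 2 ≟ x ^ᶠ 2) refl)) (ℤ.*-identityʳ (g (x ^ᶠ 2)))))

    ∑-χ : ∑ χ ≡ 0ℤ
    ∑-χ = trans (∑-cong λ y → sym (ℤ.*-identityʳ (χ y)))
      (∙-cancelˡ (∑ {q} λ _ → 1ℤ) (∑ λ y → χ y * 1ℤ) 0ℤ
        (trans (sym (∑-square (λ _ → 1ℤ))) (sym (ℤ.+-identityʳ (∑ {q} λ _ → 1ℤ)))))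

    χ-square* : ∀ {z} → z ≢ 0# → ∀ y → χ (z *ᶠ z *ᶠ y) ≡ χ y
    χ-square* {z} z≢0 y with squareness y
    ... | null refl eq = cong χ (zeroʳ (z *ᶠ z))
    ... | square v v≢0 refl eq = trans (cong χ (*-interchange z z v v)) (trans (χ-square (*-≢0 z≢0 v≢0)) (sym eq))
    ... | nonsquare y≢0 ¬sq eq with squareness (z *ᶠ z *ᶠ y)
    ...   | null zzy≡0 _          = contradiction zzy≡0 (*-≢0 (*-≢0 z≢0 z≢0) y≢0)
    ...   | square v v≢0 zzy≡vv _ = contradiction
      (*-cancelˡ (*-≢0 z≢0 z≢0) (trans (sym (*-interchange z (z ⁻¹ *ᶠ v) z (z ⁻¹ *ᶠ v)))
        (trans (cong₂ _*ᶠ_ (x[x⁻¹y]≡y z≢0 v) (x[x⁻¹y]≡y z≢0 v)) (sym zzy≡vv)))) (¬sq (z ⁻¹ *ᶠ v))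
    ...   | nonsquare _ _ eq′     = trans eq′ (sym eq)

    -- ∑ (χ y + χ (x y)) vanishes although no term is positive.
    χ-nonsquare* : ∀ {x} → x ≢ 0# → (∀ z → z *ᶠ z ≢ x) → χ x ≡ -1ℤ → ∀ y → χ y + χ (x *ᶠ y) ≡ 0ℤ
    χ-nonsquare* {x} x≢0 ¬sq χx≡-1 = ∑-≤0 (λ y → χ y + χ (x *ᶠ y)) nonpositive
      (trans (∑-+ χ λ y → χ (x *ᶠ y)) (trans (cong₂ _+_ ∑-χ (∑-scaling x≢0 χ)) (trans (ℤ.+-identityˡ _) ∑-χ)))
      where
      nonpositive : ∀ y → χ y + χ (x *ᶠ y) ℤ.≤ 0ℤ
      nonpositive y with squareness y
      ... | null refl eq = ℤ.≤-reflexive (cong₂ _+_ eq (trans (cong χ (zeroʳ x)) eq))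
      ... | square v v≢0 refl eq = ℤ.≤-reflexive (cong₂ _+_ eq
        (trans (cong χ (*-comm x (v *ᶠ v))) (trans (χ-square* v≢0 x) χx≡-1)))
      ... | nonsquare _ _ eq = subst (λ z → z + χ (x *ᶠ y) ℤ.≤ 0ℤ) (sym eq) (ℤ.+-monoʳ-≤ -1ℤ (χ≤1 (x *ᶠ y)))

    χ-* : ∀ x y → χ (x *ᶠ y) ≡ χ x * χ y
    χ-* x y with squareness x
    ... | null refl eq = trans (cong χ (zeroˡ y)) (trans eq (sym (trans (cong (_* χ y) eq) (ℤ.*-zeroˡ (χ y)))))
    ... | square z z≢0 refl eq = trans (χ-square* z≢0 y) (sym (trans (cong (_* χ y) eq) (ℤ.*-identityˡ (χ y))))
    ... | nonsquare x≢0 ¬sq eq = begin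
      χ (x *ᶠ y)                      ≡⟨ isolate (χ y) (χ (x *ᶠ y)) ⟩
      (χ y + χ (x *ᶠ y)) + -1ℤ * χ y  ≡⟨ cong₂ _+_ (χ-nonsquare* x≢0 ¬sq eq y) (cong (_* χ y) (sym eq)) ⟩
      0ℤ + χ x * χ y                  ≡⟨ ℤ.+-identityˡ _ ⟩
      χ x * χ y                       ∎
      where
      open ≡-Reasoning
      isolate : ∀ u v → v ≡ (u + v) + -1ℤ * u
      isolate = solve-∀

    χ-^ : ∀ x e → χ (x ^ᶠ e) ≡ χ x ^ e
    χ-^ x zero    = trans (cong χ (sym (*-identityˡ 1#))) (χ-square 1≢0)
    χ-^ x (suc e) = trans (χ-* x (x ^ᶠ e)) (cong (χ x *_) (χ-^ x e))

    χ-neg : ∀ x → χ (-ᶠ x) ≡ θ * χ x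
    χ-neg x = trans (cong χ (sym (-1*x≈-x x))) (χ-* (-ᶠ 1#) x)

    jacobi : Fin q → ℤ
    jacobi c = ∑ λ y → χ y * χ (c +ᶠ -ᶠ y)

    jacobi-0 : jacobi 0# ≡ θ * (+ q - 1ℤ)
    jacobi-0 = begin
      ∑ (λ y → χ y * χ (0# +ᶠ -ᶠ y))
        ≡⟨ ∑-cong (λ y → trans (cong (χ y *_) (trans (cong χ (+-identityˡ (-ᶠ y))) (χ-neg y))) (rearrange (χ y) θ)) ⟩
      ∑ (λ y → θ * (χ y * χ y))        ≡⟨ ∑-scale θ (λ y → χ y * χ y) ⟩
      θ * ∑ (λ y → χ y * χ y)          ≡⟨ cong (θ *_) (trans (∑-cong χ*χ≡w₁) (∑-w 1ℤ)) ⟩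
      θ * (+ q - 1ℤ)                   ∎
      where
      open ≡-Reasoning
      rearrange : ∀ u v → u * (v * u) ≡ v * (u * u)
      rearrange = solve-∀

    jacobi-scaling : ∀ {c} → c ≢ 0# → jacobi c ≡ jacobi 1#
    jacobi-scaling {c} c≢0 = begin
      jacobi c                                       ≡⟨ ∑-scaling c≢0 (λ y → χ y * χ (c +ᶠ -ᶠ y)) ⟨
      ∑ (λ y → χ (c *ᶠ y) * χ (c +ᶠ -ᶠ (c *ᶠ y)))    ≡⟨ ∑-cong step ⟩
      ∑ (λ y → χ y * χ (1# +ᶠ -ᶠ y))                 ∎
      where
      open ≡-Reasoning
      rearrange : ∀ u v w → (u * v) * (u * w) ≡ (u * u) * (v * w)
      rearrange = solve-∀
      step : ∀ y → χ (c *ᶠ y) * χ (c +ᶠ -ᶠ (c *ᶠ y)) ≡ χ y * χ (1# +ᶠ -ᶠ y)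
      step y = begin
        χ (c *ᶠ y) * χ (c +ᶠ -ᶠ (c *ᶠ y))
          ≡⟨ cong₂ _*_ (χ-* c y) (trans (cong χ (trans (cong₂ _+ᶠ_ (sym (*-identityʳ c)) (-‿distribʳ-* c y)) (sym (distribˡ c 1# (-ᶠ y))))) (χ-* c _)) ⟩
        (χ c * χ y) * (χ c * χ (1# +ᶠ -ᶠ y))     ≡⟨ rearrange (χ c) (χ y) (χ (1# +ᶠ -ᶠ y)) ⟩
        (χ c * χ c) * (χ y * χ (1# +ᶠ -ᶠ y))     ≡⟨ cong (_* (χ y * χ (1# +ᶠ -ᶠ y))) (χ*χ≡1 c≢0) ⟩
        1ℤ * (χ y * χ (1# +ᶠ -ᶠ y))              ≡⟨ ℤ.*-identityˡ _ ⟩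
        χ y * χ (1# +ᶠ -ᶠ y)                     ∎

    ∑-jacobi : ∑ jacobi ≡ 0ℤ
    ∑-jacobi = begin
      ∑ (λ c → ∑ λ y → χ y * χ (c +ᶠ -ᶠ y))      ≡⟨ ∑-comm (λ c y → χ y * χ (c +ᶠ -ᶠ y)) ⟩
      ∑ (λ y → ∑ λ c → χ y * χ (c +ᶠ -ᶠ y))      ≡⟨ ∑-zero _ inner ⟩
      0ℤ                                         ∎
      where
      open ≡-Reasoning
      swapSign : ∀ c y → c +ᶠ -ᶠ y ≡ -ᶠ (y +ᶠ -ᶠ c)
      swapSign c y = sym (trans (sym (-‿+-comm y (-ᶠ c)))
        (trans (cong (-ᶠ y +ᶠ_) (-‿involutive c)) (+-comm (-ᶠ y) c)))
      inner : ∀ y → ∑ (λ c → χ y * χ (c +ᶠ -ᶠ y)) ≡ 0ℤ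
      inner y = begin
        ∑ (λ c → χ y * χ (c +ᶠ -ᶠ y))
          ≡⟨ ∑-cong (λ c → trans (cong (χ y *_) (trans (cong χ (swapSign c y)) (χ-neg (y +ᶠ -ᶠ c)))) (sym (ℤ.*-assoc (χ y) θ _))) ⟩
        ∑ (λ c → (χ y * θ) * χ (y +ᶠ -ᶠ c))      ≡⟨ ∑-scale (χ y * θ) (λ c → χ (y +ᶠ -ᶠ c)) ⟩
        (χ y * θ) * ∑ (λ c → χ (y +ᶠ -ᶠ c))      ≡⟨ cong ((χ y * θ) *_) (trans (∑-reflection y χ) ∑-χ) ⟩
        (χ y * θ) * 0ℤ                           ≡⟨ ℤ.*-zeroʳ (χ y * θ) ⟩
        0ℤ                                       ∎

    -- jacobi takes the same value at all c ≢ 0#, and ∑ jacobi ≡ (∑ χ)² ≡ 0.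
    jacobi-1 : jacobi 1# ≡ - θ
    jacobi-1 = ℤ.*-cancelˡ-≡ (+ q - 1ℤ) _ _ (begin
      (+ q - 1ℤ) * jacobi 1#
        ≡⟨ isolate ((+ q - 1ℤ) * jacobi 1#) (θ * (+ q - 1ℤ)) ⟩
      (θ * (+ q - 1ℤ) + (+ q - 1ℤ) * jacobi 1#) - θ * (+ q - 1ℤ)  ≡⟨ cong (_- θ * (+ q - 1ℤ)) total ⟨
      0ℤ - θ * (+ q - 1ℤ)                                   ≡⟨ collect θ (+ q - 1ℤ) ⟩
      (+ q - 1ℤ) * - θ                                      ∎)
      where
      open ≡-Reasoning
      isolate : ∀ u v → u ≡ (v + u) - v
      isolate = solve-∀
      collect : ∀ u v → 0ℤ - u * v ≡ v * - u
      collect = solve-∀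
      split : ∀ c → jacobi c ≡ δ c * jacobi 0# + jacobi 1# * w 1ℤ c
      split c with ≡0-cases c
      ... | inj₁ refl = sym (trans (cong₂ (λ u v → u * jacobi 0# + jacobi 1# * v) δ-0 (w₁-0 refl)) (evaluate (jacobi 0#) (jacobi 1#)))
        where
        evaluate : ∀ u v → 1ℤ * u + v * 0ℤ ≡ u
        evaluate = solve-∀
      ... | inj₂ c≢0 = trans (jacobi-scaling c≢0)
        (sym (trans (cong₂ (λ u v → u * jacobi 0# + jacobi 1# * v) (δ-≢0 c≢0) (w₁-≢0 c≢0)) (evaluate (jacobi 0#) (jacobi 1#))))
        where
        evaluate : ∀ u v → 0ℤ * u + v * 1ℤ ≡ v
        evaluate = solve-∀
      total : 0ℤ ≡ θ * (+ q - 1ℤ) + (+ q - 1ℤ) * jacobi 1#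
      total = begin
        0ℤ                                                          ≡⟨ ∑-jacobi ⟨
        ∑ jacobi                                                    ≡⟨ ∑-cong split ⟩
        ∑ (λ c → δ c * jacobi 0# + jacobi 1# * w 1ℤ c)
          ≡⟨ ∑-+ (λ c → δ c * jacobi 0#) (λ c → jacobi 1# * w 1ℤ c) ⟩
        ∑ (λ c → δ c * jacobi 0#) + ∑ (λ c → jacobi 1# * w 1ℤ c)
          ≡⟨ cong₂ _+_ (trans (∑-δ* λ _ → jacobi 0#) jacobi-0) (trans (∑-scale (jacobi 1#) (w 1ℤ)) (trans (cong (jacobi 1# *_) (∑-w 1ℤ)) (ℤ.*-comm (jacobi 1#) _))) ⟩
        θ * (+ q - 1ℤ) + (+ q - 1ℤ) * jacobi 1#                     ∎

    jacobi-≡ : ∀ c → jacobi c ≡ θ * (+ q * δ c - 1ℤ)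
    jacobi-≡ c with ≡0-cases c
    ... | inj₁ refl = trans jacobi-0 (cong (λ z → θ * (z - 1ℤ)) (sym (trans (cong (+ q *_) δ-0) (ℤ.*-identityʳ (+ q)))))
    ... | inj₂ c≢0  = trans (jacobi-scaling c≢0) (trans jacobi-1
      (sym (trans (cong (λ z → θ * (+ q * z - 1ℤ)) (δ-≢0 c≢0)) (evaluate θ (+ q)))))
      where
      evaluate : ∀ u v → u * (v * 0ℤ - 1ℤ) ≡ - u
      evaluate = solve-∀

∑ℤ-++ : ∀ xs ys → ∑ℤ (xs ++ ys) ≡ ∑ℤ xs + ∑ℤ ys
∑ℤ-++ []       ys = sym (ℤ.+-identityˡ _)
∑ℤ-++ (x ∷ xs) ys = trans (cong (_+_ x) (∑ℤ-++ xs ys)) (sym (ℤ.+-assoc x _ _))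

σ-∷ : ∀ r x xs → σ (suc r) (x ∷ xs) ≡ x * σ r xs + σ (suc r) xs
σ-∷ r x xs = begin
  ∑ℤ (map ∏ℤ (map (x ∷_) A ++ B))                ≡⟨ cong ∑ℤ (List.map-++ ∏ℤ (map (x ∷_) A) B) ⟩
  ∑ℤ (map ∏ℤ (map (x ∷_) A) ++ map ∏ℤ B)         ≡⟨ ∑ℤ-++ (map ∏ℤ (map (x ∷_) A)) (map ∏ℤ B) ⟩
  ∑ℤ (map ∏ℤ (map (x ∷_) A)) + σ (suc r) xs      ≡⟨ cong (_+ σ (suc r) xs) (factor A) ⟩
  x * σ r xs + σ (suc r) xs                      ∎
  where
  open ≡-Reasoning
  A = combinations r xs
  B = combinations (suc r) xs
  factor : ∀ A → ∑ℤ (map ∏ℤ (map (x ∷_) A)) ≡ x * ∑ℤ (map ∏ℤ A)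
  factor []      = sym (ℤ.*-zeroʳ x)
  factor (l ∷ A) = trans (cong (_+_ (x * ∏ℤ l)) (factor A)) (sym (ℤ.*-distribˡ-+ x (∏ℤ l) _))

σ-> : ∀ {r} xs → length xs < r → σ r xs ≡ 0ℤ
σ-> {suc r} []       _         = refl
σ-> {suc r} (x ∷ xs) (s≤s l<r) = trans (σ-∷ r x xs)
  (trans (cong₂ (λ u v → x * u + v) (σ-> xs l<r) (σ-> xs (ℕ.m<n⇒m<1+n l<r)))
         (trans (ℤ.+-identityʳ (x * 0ℤ)) (ℤ.*-zeroʳ x)))

σ-length : ∀ xs → σ (length xs) xs ≡ ∏ℤ xs
σ-length []       = refl
σ-length (x ∷ xs) = trans (σ-∷ (length xs) x xs)
  (trans (cong₂ (λ u v → x * u + v) (σ-length xs) (σ-> xs ℕ.≤-refl)) (ℤ.+-identityʳ _))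

∑₁-suc : ∀ J f → ∑₁ (suc J) f ≡ ∑₁ J f + f (suc J)
∑₁-suc J f = begin
  ∑ℤ (map (f ∘ suc) (upTo (suc J)))             ≡⟨ cong (∑ℤ ∘ map (f ∘ suc)) (List.applyUpTo-∷ʳ id J) ⟨
  ∑ℤ (map (f ∘ suc) (upTo J ++ [ J ]))          ≡⟨ cong ∑ℤ (List.map-++ (f ∘ suc) (upTo J) [ J ]) ⟩
  ∑ℤ (map (f ∘ suc) (upTo J) ++ [ f (suc J) ])  ≡⟨ ∑ℤ-++ (map (f ∘ suc) (upTo J)) [ f (suc J) ] ⟩
  ∑₁ J f + (f (suc J) + 0ℤ)                     ≡⟨ cong (_+_ (∑₁ J f)) (ℤ.+-identityʳ (f (suc J))) ⟩
  ∑₁ J f + f (suc J)                            ∎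
  where open ≡-Reasoning

σ-even σ-odd : ℤ → ℕ → List ℤ → ℤ
σ-even G zero    zs = 1ℤ
σ-even G (suc J) zs = σ-even G J zs + σ (2 ℕ.* suc J) zs * G ^ suc J
σ-odd  G zero    zs = σ 1 zs
σ-odd  G (suc J) zs = σ-odd G J zs + σ (suc (2 ℕ.* suc J)) zs * G ^ suc J

private
  2*suc : ∀ J → 2 ℕ.* suc J ≡ suc (suc (2 ℕ.* J))
  2*suc J = cong suc (ℕ.+-suc J (J ℕ.+ 0))

σ-even-∷ : ∀ G J x xs →
  σ-even G J (x ∷ xs) + x * G ^ suc J * σ (suc (2 ℕ.* J)) xs ≡ σ-even G J xs + x * G * σ-odd G J xs
σ-even-∷ G zero    x xs = cong (λ z → 1ℤ + x * z * σ 1 xs) (ℤ.*-identityʳ G)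
σ-even-∷ G (suc J) x xs = begin
  σ-even G J (x ∷ xs) + σ (2 ℕ.* suc J) (x ∷ xs) * G ^ suc J + x * (G * G ^ suc J) * τ
    ≡⟨ cong (λ s → σ-even G J (x ∷ xs) + s * G ^ suc J + x * (G * G ^ suc J) * τ) expandσ ⟩
  σ-even G J (x ∷ xs) + (x * σ (suc (2 ℕ.* J)) xs + σ (2 ℕ.* suc J) xs) * G ^ suc J + x * (G * G ^ suc J) * τ
    ≡⟨ regroup (σ-even G J (x ∷ xs)) x (σ (suc (2 ℕ.* J)) xs) (σ (2 ℕ.* suc J) xs) (G ^ suc J) G τ ⟩
  (σ-even G J (x ∷ xs) + x * G ^ suc J * σ (suc (2 ℕ.* J)) xs) + (σ (2 ℕ.* suc J) xs * G ^ suc J + x * G * (τ * G ^ suc J))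
    ≡⟨ cong (_+ (σ (2 ℕ.* suc J) xs * G ^ suc J + x * G * (τ * G ^ suc J))) (σ-even-∷ G J x xs) ⟩
  (σ-even G J xs + x * G * σ-odd G J xs) + (σ (2 ℕ.* suc J) xs * G ^ suc J + x * G * (τ * G ^ suc J))
    ≡⟨ collect (σ-even G J xs) (x * G) (σ-odd G J xs) (σ (2 ℕ.* suc J) xs * G ^ suc J) (τ * G ^ suc J) ⟩
  (σ-even G J xs + σ (2 ℕ.* suc J) xs * G ^ suc J) + x * G * (σ-odd G J xs + τ * G ^ suc J) ∎
  where
  open ≡-Reasoning
  τ = σ (suc (2 ℕ.* suc J)) xs
  expandσ : σ (2 ℕ.* suc J) (x ∷ xs) ≡ x * σ (suc (2 ℕ.* J)) xs + σ (2 ℕ.* suc J) xs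
  expandσ = subst (λ r → σ r (x ∷ xs) ≡ x * σ (suc (2 ℕ.* J)) xs + σ r xs) (sym (2*suc J)) (σ-∷ (suc (2 ℕ.* J)) x xs)
  regroup : ∀ e x s t g G τ → e + (x * s + t) * g + x * (G * g) * τ ≡ (e + x * g * s) + (t * g + x * G * (τ * g))
  regroup = solve-∀
  collect : ∀ e y o t u → (e + y * o) + (t + y * u) ≡ (e + t) + y * (o + u)
  collect = solve-∀

σ-odd-∷ : ∀ G J x xs → σ-odd G J (x ∷ xs) ≡ x * σ-even G J xs + σ-odd G J xs
σ-odd-∷ G zero    x xs = σ-∷ 0 x xs
σ-odd-∷ G (suc J) x xs = begin
  σ-odd G J (x ∷ xs) + σ (suc (2 ℕ.* suc J)) (x ∷ xs) * G ^ suc J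
    ≡⟨ cong₂ (λ o s → o + s * G ^ suc J) (σ-odd-∷ G J x xs) (σ-∷ (2 ℕ.* suc J) x xs) ⟩
  (x * σ-even G J xs + σ-odd G J xs) + (x * σ (2 ℕ.* suc J) xs + σ (suc (2 ℕ.* suc J)) xs) * G ^ suc J
    ≡⟨ regroup x (σ-even G J xs) (σ-odd G J xs) (σ (2 ℕ.* suc J) xs) (σ (suc (2 ℕ.* suc J)) xs) (G ^ suc J) ⟩
  x * (σ-even G J xs + σ (2 ℕ.* suc J) xs * G ^ suc J) + (σ-odd G J xs + σ (suc (2 ℕ.* suc J)) xs * G ^ suc J) ∎
  where
  open ≡-Reasoning
  regroup : ∀ x e o s t g → (x * e + o) + (x * s + t) * g ≡ x * (e + s * g) + (o + t * g)
  regroup = solve-∀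

σ-even-[] : ∀ G J → σ-even G J [] ≡ 1ℤ
σ-even-[] G zero    = refl
σ-even-[] G (suc J) = cong₂ (λ u v → u + v * G ^ suc J) (σ-even-[] G J) (σ-> {2 ℕ.* suc J} [] (s≤s z≤n))

σ-odd-[] : ∀ G J → σ-odd G J [] ≡ 0ℤ
σ-odd-[] G zero    = refl
σ-odd-[] G (suc J) = cong₂ (λ u v → u + v * G ^ suc J) (σ-odd-[] G J) (σ-> {suc (2 ℕ.* suc J)} [] (s≤s z≤n))

module Coefficients (G : ℤ) {ℓ} {A : Set ℓ} (χ : A → ℤ) where

  -- The first t variables, which occur linearly, have z = 0.
  signs : ∀ {n} → ℕ → (Fin n → A) → List ℤ
  signs {zero}  t       a = []
  signs {suc n} zero    a = χ (a zero) ∷ signs zero (a ∘ suc)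
  signs {suc n} (suc t) a = 0ℤ ∷ signs t (a ∘ suc)

  signs-0 : ∀ {n} (a : Fin n → A) → signs 0 a ≡ List.tabulate (χ ∘ a)
  signs-0 {zero}  a = refl
  signs-0 {suc n} a = cong (χ (a zero) ∷_) (signs-0 (a ∘ suc))

  αγ₁ : ∀ {n} t (a : Fin n → A) J → n ∸ t ≤ suc (2 ℕ.* J) → let zs = drop t (List.tabulate (χ ∘ a)) in
    α G 1ℤ (signs t a) ≡ -1ℤ ^ n * σ-even G J zs × γ G 1ℤ (signs t a) ≡ - (-1ℤ ^ n * σ-odd G J zs)
  αγ₁ {zero} t a J _ =
    trans (sym (ℤ.*-identityˡ 1ℤ)) (cong (1ℤ *_) (sym (trans (cong (σ-even G J) (drop-[] t)) (σ-even-[] G J)))) ,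
    cong (λ z → - (1ℤ * z)) (sym (trans (cong (σ-odd G J) (drop-[] t)) (σ-odd-[] G J)))
    where
    drop-[] : ∀ t → drop t List.[] ≡ List.[] {A = ℤ}
    drop-[] zero    = refl
    drop-[] (suc t) = refl
  αγ₁ {suc n} (suc t) a J n-t≤ with αγ₁ t (a ∘ suc) J n-t≤
  ... | α≡ , γ≡ = trans (cong₂ (λ u v → 0ℤ * G * u - 1ℤ * v) γ≡ α≡) (stepα G (-1ℤ ^ n) (σ-odd G J zs) (σ-even G J zs)) ,
                  trans (cong₂ (λ u v → 0ℤ * u - 1ℤ * v) α≡ γ≡) (stepγ (-1ℤ ^ n) (σ-even G J zs) (σ-odd G J zs))
    where
    zs = drop t (List.tabulate (χ ∘ a ∘ suc))
    stepα : ∀ G s o e → 0ℤ * G * - (s * o) - 1ℤ * (s * e) ≡ (-1ℤ * s) * e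
    stepα = solve-∀
    stepγ : ∀ s e o → 0ℤ * (s * e) - 1ℤ * - (s * o) ≡ - ((-1ℤ * s) * o)
    stepγ = solve-∀
  αγ₁ {suc n} zero a J (s≤s n≤2J) with αγ₁ zero (a ∘ suc) J (ℕ.m≤n⇒m≤1+n n≤2J)
  ... | α≡ , γ≡ =
    trans (cong₂ (λ u v → x * G * u - 1ℤ * v) γ≡ α≡)
      (trans (stepα x G (-1ℤ ^ n) (σ-odd G J zs) (σ-even G J zs)) (cong ((-1ℤ * -1ℤ ^ n) *_) (sym even))) ,
    trans (cong₂ (λ u v → x * u - 1ℤ * v) α≡ γ≡)
      (trans (stepγ x (-1ℤ ^ n) (σ-even G J zs) (σ-odd G J zs)) (cong (λ z → - ((-1ℤ * -1ℤ ^ n) * z)) (sym (σ-odd-∷ G J x zs))))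
    where
    x  = χ (a zero)
    zs = List.tabulate (χ ∘ a ∘ suc)
    even : σ-even G J (x ∷ zs) ≡ σ-even G J zs + x * G * σ-odd G J zs
    even = trans (sym (ℤ.+-identityʳ _)) (trans
      (cong (_+_ (σ-even G J (x ∷ zs))) (sym (trans
        (cong (x * G ^ suc J *_) (σ-> zs (s≤s (subst (_≤ 2 ℕ.* J) (sym (List.length-tabulate (χ ∘ a ∘ suc))) n≤2J))))
        (ℤ.*-zeroʳ (x * G ^ suc J)))))
      (σ-even-∷ G J x zs))
    stepα : ∀ x G s o e → x * G * - (s * o) - 1ℤ * (s * e) ≡ (-1ℤ * s) * (e + x * G * o)
    stepα = solve-∀
    stepγ : ∀ x s e o → x * (s * e) - 1ℤ * - (s * o) ≡ - ((-1ℤ * s) * (x * e + o))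
    stepγ = solve-∀

  α₀-linear : ∀ {n} t (a : Fin (suc n) → A) → α G 0ℤ (signs (suc t) a) ≡ 0ℤ
  α₀-linear t a = vanish G (γ G 0ℤ (signs t (a ∘ suc))) (α G 0ℤ (signs t (a ∘ suc)))
    where
    vanish : ∀ G g a → 0ℤ * G * g - 0ℤ * a ≡ 0ℤ
    vanish = solve-∀

  α₀-step : ∀ x y zs → α G 0ℤ (x ∷ y ∷ zs) ≡ x * y * G * α G 0ℤ zs
  α₀-step x y zs = step x y G (α G 0ℤ zs) (γ G 0ℤ zs)
    where
    step : ∀ x y G a g → x * G * (y * a - 0ℤ * g) - 0ℤ * (y * G * g - 0ℤ * a) ≡ x * y * G * a
    step = solve-∀

  α₀-even : ∀ h zs → length zs ≡ 2 ℕ.* h → α G 0ℤ zs ≡ ∏ℤ zs * G ^ h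
  α₀-even zero    []           _  = refl
  α₀-even (suc h) []           ()
  α₀-even zero    (x ∷ zs)     ()
  α₀-even (suc h) (x ∷ [])     eq = contradiction (trans eq (2*suc h)) λ ()
  α₀-even (suc h) (x ∷ y ∷ zs) eq = trans (α₀-step x y zs)
    (trans (cong (x * y * G *_) (α₀-even h zs (ℕ.suc-injective (ℕ.suc-injective (trans eq (2*suc h))))))
           (regroup x y G (∏ℤ zs) (G ^ h)))
    where
    regroup : ∀ x y G p g → x * y * G * (p * g) ≡ x * (y * p) * (G * g)
    regroup = solve-∀

  α₀-odd : ∀ h zs → length zs ≡ suc (2 ℕ.* h) → α G 0ℤ zs ≡ 0ℤ
  α₀-odd zero    (x ∷ [])     _  = trans (ℤ.+-identityʳ (x * G * 0ℤ)) (ℤ.*-zeroʳ (x * G))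
  α₀-odd (suc h) (x ∷ [])     eq = contradiction (trans eq (cong suc (2*suc h))) λ ()
  α₀-odd (suc h) (x ∷ y ∷ zs) eq = trans (α₀-step x y zs)
    (trans (cong (x * y * G *_) (α₀-odd h zs (ℕ.suc-injective (ℕ.suc-injective (trans eq (cong suc (2*suc h)))))))
           (ℤ.*-zeroʳ (x * y * G)))

degrees : ∀ {n} → ℕ → Fin n → ℕ
degrees zero    j       = 2
degrees (suc t) zero    = 1
degrees (suc t) (suc j) = degrees t j

module Distribution {q : ℕ} (𝔽 : FinField q) where
  open FinFieldProperties 𝔽
  open Points 𝔽
  open QuadraticCharacter 𝔽
  open Coefficients (θ * + q) χ

  distribution : ℤ → ∀ {n} → (Fin n → Fin q) → (Fin n → ℕ) → Fin q → ℤ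
  distribution ν a e c = ∑ⱽ λ x → ω ν x * ⟦ form a e x ≟ c ⟧

  distribution-suc : ∀ ν {n} (a : Fin (suc n) → Fin q) e c → distribution ν a e c ≡
    ∑ λ x → w ν x * distribution ν (a ∘ suc) (e ∘ suc) (c +ᶠ -ᶠ (a zero *ᶠ x ^ᶠ e zero))
  distribution-suc ν a e c = trans (∑ⱽ-∷ λ x → ω ν x * ⟦ form a e x ≟ c ⟧) (∑-cong λ x →
    trans (∑ⱽ-cong λ v → trans (ℤ.*-assoc (w ν x) (ω ν v) _)
                               (cong (λ z → w ν x * (ω ν v * z)) (moveTerm _ _)))
          (∑ⱽ-scale (w ν x) λ v → ω ν v * ⟦ form (a ∘ suc) (e ∘ suc) v ≟ c +ᶠ -ᶠ (a zero *ᶠ x ^ᶠ e zero) ⟧))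
    where
    moveTerm : ∀ u l → ⟦ u +ᶠ l ≟ c ⟧ ≡ ⟦ l ≟ c +ᶠ -ᶠ u ⟧
    moveTerm u l = ⟦⟧-cong (u +ᶠ l ≟ c) (l ≟ c +ᶠ -ᶠ u)
      (λ { refl → sym (trans (cong (_+ᶠ -ᶠ u) (+-comm u l)) (cancel l u)) })
      (λ { refl → trans (+-comm u _) (trans (+-assoc c (-ᶠ u) u) (trans (cong (c +ᶠ_) (-‿inverseˡ u)) (+-identityʳ c))) })
      where
      cancel : ∀ x y → x +ᶠ y +ᶠ -ᶠ y ≡ x
      cancel x y = trans (+-assoc x y (-ᶠ y)) (trans (cong (x +ᶠ_) (-‿inverseʳ y)) (+-identityʳ x))

  ∑-distribution : ∀ ν {n} (a : Fin n → Fin q) e → ∑ (distribution ν a e) ≡ (+ q - ν) ^ n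
  ∑-distribution ν {n} a e = begin
    ∑ (λ c → ∑ⱽ λ x → ω ν x * ⟦ form a e x ≟ c ⟧)    ≡⟨ ∑-∑ⱽ-comm (λ c x → ω ν x * ⟦ form a e x ≟ c ⟧) ⟩
    ∑ⱽ (λ x → ∑ λ c → ω ν x * ⟦ form a e x ≟ c ⟧)    ≡⟨ ∑ⱽ-cong total ⟩
    ∑ⱽ {n} (ω ν)                                     ≡⟨ ∑ⱽ-ω ν n ⟩
    (+ q - ν) ^ n                                    ∎
    where
    open ≡-Reasoning
    total : ∀ x → ∑ (λ c → ω ν x * ⟦ form a e x ≟ c ⟧) ≡ ω ν x
    total x = trans (∑-scale (ω ν x) λ c → ⟦ form a e x ≟ c ⟧)
      (trans (cong (ω ν x *_) (trans
        (∑-single (λ c → ⟦ form a e x ≟ c ⟧) (form a e x) λ c c≢ → ⟦⟧-no (form a e x ≟ c) (c≢ ∘ sym))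
        (⟦⟧-yes (form a e x ≟ form a e x) refl)))
        (ℤ.*-identityʳ (ω ν x)))

  ∑-affine : ∀ {u} → u ≢ 0# → ∀ c (f : Fin q → ℤ) → ∑ (λ y → f (c +ᶠ -ᶠ (u *ᶠ y))) ≡ ∑ f
  ∑-affine u≢0 c f = trans (∑-scaling u≢0 (λ y → f (c +ᶠ -ᶠ y))) (∑-reflection c f)

  origin : ∀ e → NonZero e → ∀ c u (f : Fin q → ℤ) → f (c +ᶠ -ᶠ (u *ᶠ 0# ^ᶠ e)) ≡ f c
  origin e e≢0 c u f = cong f (begin
    c +ᶠ -ᶠ (u *ᶠ 0# ^ᶠ e)   ≡⟨ cong (λ z → c +ᶠ -ᶠ (u *ᶠ z)) (0^n≡0 e {{e≢0}}) ⟩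
    c +ᶠ -ᶠ (u *ᶠ 0#)        ≡⟨ cong (c +ᶠ_) (-‿distribʳ-* u 0#) ⟩
    c +ᶠ u *ᶠ -ᶠ 0#          ≡⟨ cong (λ z → c +ᶠ u *ᶠ z) (trans (sym (+-identityˡ (-ᶠ 0#))) (-‿inverseʳ 0#)) ⟩
    c +ᶠ u *ᶠ 0#             ≡⟨ cong (c +ᶠ_) (zeroʳ u) ⟩
    c +ᶠ 0#                  ≡⟨ +-identityʳ c ⟩
    c                        ∎)
    where open ≡-Reasoning

  ∑-linear : ∀ ν {u} → u ≢ 0# → ∀ (f : Fin q → ℤ) c →
    ∑ (λ x → w ν x * f (c +ᶠ -ᶠ (u *ᶠ x ^ᶠ 1))) ≡ ∑ f - ν * f c
  ∑-linear ν {u} u≢0 f c = trans (∑-w* ν λ x → f (c +ᶠ -ᶠ (u *ᶠ x ^ᶠ 1))) (cong₂ (λ s t → s - ν * t)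
    (trans (∑-cong λ x → cong (λ z → f (c +ᶠ -ᶠ (u *ᶠ z))) (*-identityʳ x)) (∑-affine u≢0 c f))
    (origin 1 _ c u f))

  ∑-quadratic : 2 ∣ q ∸ 1 → ∀ ν {u} → u ≢ 0# → ∀ (f : Fin q → ℤ) c →
    ∑ (λ x → w ν x * f (c +ᶠ -ᶠ (u *ᶠ x ^ᶠ 2))) ≡
    ∑ f - ν * f c + χ u * ∑ (λ y → χ y * f (c +ᶠ -ᶠ y))
  ∑-quadratic odd ν {u} u≢0 f c = begin
    ∑ (λ x → w ν x * f (c +ᶠ -ᶠ (u *ᶠ x ^ᶠ 2)))     ≡⟨ ∑-w* ν (λ x → f (c +ᶠ -ᶠ (u *ᶠ x ^ᶠ 2))) ⟩
    ∑ (λ x → f (c +ᶠ -ᶠ (u *ᶠ x ^ᶠ 2))) - ν * f (c +ᶠ -ᶠ (u *ᶠ 0# ^ᶠ 2))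
      ≡⟨ cong₂ (λ s t → s - ν * t) (trans (∑-square odd λ y → f (c +ᶠ -ᶠ (u *ᶠ y))) (cong₂ _+_ (∑-affine u≢0 c f) twist)) (origin 2 _ c u f) ⟩
    ∑ f + χ u * K - ν * f c                         ≡⟨ regroup (∑ f) (χ u * K) (ν * f c) ⟩
    ∑ f - ν * f c + χ u * K                         ∎
    where
    open ≡-Reasoning
    K = ∑ (λ y → χ y * f (c +ᶠ -ᶠ y))
    regroup : ∀ s k t → s + k - t ≡ s - t + k
    regroup = solve-∀
    twist : ∑ (λ y → χ y * f (c +ᶠ -ᶠ (u *ᶠ y))) ≡ χ u * K
    twist = begin
      ∑ (λ y → χ y * f (c +ᶠ -ᶠ (u *ᶠ y)))                   ≡⟨ ∑-cong step ⟩
      ∑ (λ y → χ u * (χ (u *ᶠ y) * f (c +ᶠ -ᶠ (u *ᶠ y))))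
        ≡⟨ ∑-scaling u≢0 (λ y → χ u * (χ y * f (c +ᶠ -ᶠ y))) ⟩
      ∑ (λ y → χ u * (χ y * f (c +ᶠ -ᶠ y)))                  ≡⟨ ∑-scale (χ u) (λ y → χ y * f (c +ᶠ -ᶠ y)) ⟩
      χ u * K                                                ∎
      where
      step : ∀ y → χ y * f (c +ᶠ -ᶠ (u *ᶠ y)) ≡ χ u * (χ (u *ᶠ y) * f (c +ᶠ -ᶠ (u *ᶠ y)))
      step y = sym (begin
        χ u * (χ (u *ᶠ y) * F)      ≡⟨ cong (λ z → χ u * (z * F)) (χ-* odd u y) ⟩
        χ u * (χ u * χ y * F)       ≡⟨ reassoc (χ u) (χ y) F ⟩
        (χ u * χ u) * (χ y * F)     ≡⟨ cong (_* (χ y * F)) (χ*χ≡1 u≢0) ⟩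
        1ℤ * (χ y * F)              ≡⟨ ℤ.*-identityˡ _ ⟩
        χ y * F                     ∎)
        where
        F = f (c +ᶠ -ᶠ (u *ᶠ y))
        reassoc : ∀ a b c → a * (a * b * c) ≡ (a * a) * (b * c)
        reassoc = solve-∀

  -- The functions α δ + β + γ χ are closed under convolution: χ * χ is jacobi.
  χ-convolution : 2 ∣ q ∸ 1 → ∀ α β γ c →
    ∑ (λ y → χ y * (α * δ (c +ᶠ -ᶠ y) + β + γ * χ (c +ᶠ -ᶠ y))) ≡ α * χ c + γ * (θ * (+ q * δ c - 1ℤ))
  χ-convolution odd α β γ c = begin
    ∑ (λ y → χ y * (α * δ (c +ᶠ -ᶠ y) + β + γ * χ (c +ᶠ -ᶠ y)))
      ≡⟨ ∑-cong (λ y → expand (χ y) α (δ (c +ᶠ -ᶠ y)) β γ (χ (c +ᶠ -ᶠ y))) ⟩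
    ∑ (λ y → (α * (δ (c +ᶠ -ᶠ y) * χ y) + β * χ y) + γ * (χ y * χ (c +ᶠ -ᶠ y)))
      ≡⟨ ∑-+ (λ y → α * (δ (c +ᶠ -ᶠ y) * χ y) + β * χ y) (λ y → γ * (χ y * χ (c +ᶠ -ᶠ y))) ⟩
    ∑ (λ y → α * (δ (c +ᶠ -ᶠ y) * χ y) + β * χ y) + ∑ (λ y → γ * (χ y * χ (c +ᶠ -ᶠ y)))
      ≡⟨ cong₂ _+_ (trans (∑-+ (λ y → α * (δ (c +ᶠ -ᶠ y) * χ y)) (λ y → β * χ y))
           (cong₂ _+_ (trans (∑-scale α λ y → δ (c +ᶠ -ᶠ y) * χ y) (cong (α *_) diagonal))
                      (trans (∑-scale β χ) (trans (cong (β *_) (∑-χ odd)) (ℤ.*-zeroʳ β)))))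
         (trans (∑-scale γ λ y → χ y * χ (c +ᶠ -ᶠ y)) (cong (γ *_) (jacobi-≡ odd c))) ⟩
    α * χ c + 0ℤ + γ * (θ * (+ q * δ c - 1ℤ))
      ≡⟨ cong (_+ γ * (θ * (+ q * δ c - 1ℤ))) (ℤ.+-identityʳ (α * χ c)) ⟩
    α * χ c + γ * (θ * (+ q * δ c - 1ℤ)) ∎
    where
    open ≡-Reasoning
    expand : ∀ x a d b g z → x * (a * d + b + g * z) ≡ (a * (d * x) + b * x) + g * (x * z)
    expand = solve-∀
    diagonal : ∑ (λ y → δ (c +ᶠ -ᶠ y) * χ y) ≡ χ c
    diagonal = trans
      (∑-single (λ y → δ (c +ᶠ -ᶠ y) * χ y) c λ y y≢c →
        trans (cong (_* χ y) (δ-≢0 λ eq → y≢c (sym (x-y≡0 eq)))) (ℤ.*-zeroˡ (χ y)))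
      (trans (cong (_* χ c) (trans (cong δ (-‿inverseʳ c)) δ-0)) (ℤ.*-identityˡ (χ c)))

  distribution-≡ : ∀ ν {n} t (a : Fin n → Fin q) → (∀ j → a j ≢ 0#) → (t < n → 2 ∣ q ∸ 1) →
    let α′ = α (θ * + q) ν (signs t a) ; γ′ = γ (θ * + q) ν (signs t a) in
    ∃ λ β → α′ + + q * β ≡ (+ q - ν) ^ n ×
            (∀ c → distribution ν a (degrees t) c ≡ α′ * δ c + β + γ′ * χ c)
  distribution-≡ ν {zero} t a _ _ = 0ℤ , cong (_+_ 1ℤ) (ℤ.*-zeroʳ (+ q)) , λ c →
    trans (∑ⱽ-[] λ x → ω ν x * ⟦ form a (degrees t) x ≟ c ⟧)
      (trans (cong (1ℤ *_) (⟦⟧-cong (0# ≟ c) (c ≟ 0#) sym sym)) (pad (δ c) (χ c)))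
    where
    pad : ∀ d x → 1ℤ * d ≡ 1ℤ * d + 0ℤ + 0ℤ * x
    pad = solve-∀
  distribution-≡ ν {suc n} (suc t) a a≢0 odd
    with distribution-≡ ν t (a ∘ suc) (a≢0 ∘ suc) (odd ∘ s≤s)
  ... | β , mass , dist≡ = (+ q - ν) ^ n - ν * β , newMass , λ c → begin
      distribution ν a (degrees (suc t)) c
        ≡⟨ distribution-suc ν a (degrees (suc t)) c ⟩
      ∑ (λ x → w ν x * f (c +ᶠ -ᶠ (a zero *ᶠ x ^ᶠ 1)))                    ≡⟨ ∑-linear ν (a≢0 zero) f c ⟩
      ∑ f - ν * f c
        ≡⟨ cong₂ (λ s z → s - ν * z) (∑-distribution ν (a ∘ suc) (degrees t)) (dist≡ c) ⟩
      (+ q - ν) ^ n - ν * (α′ * δ c + β + γ′ * χ c)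
        ≡⟨ regroup (θ * + q) ν α′ β γ′ ((+ q - ν) ^ n) (δ c) (χ c) ⟩
      (0ℤ * (θ * + q) * γ′ - ν * α′) * δ c + ((+ q - ν) ^ n - ν * β) + (0ℤ * α′ - ν * γ′) * χ c ∎
    where
    open ≡-Reasoning
    f  = distribution ν (a ∘ suc) (degrees t)
    α′ = α (θ * + q) ν (signs t (a ∘ suc))
    γ′ = γ (θ * + q) ν (signs t (a ∘ suc))
    regroup : ∀ G ν a b g P d x →
      P - ν * (a * d + b + g * x) ≡ (0ℤ * G * g - ν * a) * d + (P - ν * b) + (0ℤ * a - ν * g) * x
    regroup = solve-∀
    newMass : 0ℤ * (θ * + q) * γ′ - ν * α′ + + q * ((+ q - ν) ^ n - ν * β) ≡ (+ q - ν) * (+ q - ν) ^ n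
    newMass = trans (split (θ * + q) γ′ ν α′ (+ q) ((+ q - ν) ^ n) β)
      (trans (cong (λ z → + q * (+ q - ν) ^ n - ν * z) mass) (factor (+ q) ν ((+ q - ν) ^ n)))
      where
      factor : ∀ q ν P → q * P - ν * P ≡ (q - ν) * P
      factor = solve-∀
      split : ∀ G g ν a q P b → 0ℤ * G * g - ν * a + q * (P - ν * b) ≡ q * P - ν * (a + q * b)
      split = solve-∀
  distribution-≡ ν {suc n} zero a a≢0 odd
    with distribution-≡ ν zero (a ∘ suc) (a≢0 ∘ suc) (λ _ → odd (s≤s z≤n))
  ... | β , mass , dist≡ = (+ q - ν) ^ n - ν * β - z * (θ * γ′) , newMass , λ c → begin
      distribution ν a (degrees zero) c
        ≡⟨ distribution-suc ν a (degrees zero) c ⟩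
      ∑ (λ x → w ν x * f (c +ᶠ -ᶠ (a zero *ᶠ x ^ᶠ 2)))
        ≡⟨ ∑-quadratic 2∣q∸1 ν (a≢0 zero) f c ⟩
      ∑ f - ν * f c + z * ∑ (λ y → χ y * f (c +ᶠ -ᶠ y))
        ≡⟨ cong₂ (λ s v → s + z * v)
             (cong₂ (λ s v → s - ν * v) (∑-distribution ν (a ∘ suc) (degrees zero)) (dist≡ c))
             (trans (∑-cong λ y → cong (χ y *_) (dist≡ (c +ᶠ -ᶠ y))) (χ-convolution 2∣q∸1 α′ β γ′ c)) ⟩
      (+ q - ν) ^ n - ν * (α′ * δ c + β + γ′ * χ c) + z * (α′ * χ c + γ′ * (θ * (+ q * δ c - 1ℤ)))
        ≡⟨ regroup ν α′ β γ′ ((+ q - ν) ^ n) (δ c) (χ c) z θ (+ q) ⟩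
      (z * (θ * + q) * γ′ - ν * α′) * δ c + ((+ q - ν) ^ n - ν * β - z * (θ * γ′)) + (z * α′ - ν * γ′) * χ c ∎
    where
    open ≡-Reasoning
    2∣q∸1 = odd (s≤s z≤n)
    z  = χ (a zero)
    f  = distribution ν (a ∘ suc) (degrees zero)
    α′ = α (θ * + q) ν (signs zero (a ∘ suc))
    γ′ = γ (θ * + q) ν (signs zero (a ∘ suc))
    regroup : ∀ ν a b g P d x z θ q →
      P - ν * (a * d + b + g * x) + z * (a * x + g * (θ * (q * d - 1ℤ))) ≡
      (z * (θ * q) * g - ν * a) * d + (P - ν * b - z * (θ * g)) + (z * a - ν * g) * x
    regroup = solve-∀
    newMass : z * (θ * + q) * γ′ - ν * α′ + + q * ((+ q - ν) ^ n - ν * β - z * (θ * γ′)) ≡ (+ q - ν) * (+ q - ν) ^ n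
    newMass = trans (split z θ γ′ ν α′ (+ q) ((+ q - ν) ^ n) β)
      (trans (cong (λ z → + q * (+ q - ν) ^ n - ν * z) mass) (factor (+ q) ν ((+ q - ν) ^ n)))
      where
      factor : ∀ q ν P → q * P - ν * P ≡ (q - ν) * P
      factor = solve-∀
      split : ∀ z θ g ν a q P b → z * (θ * q) * g - ν * a + q * (P - ν * b - z * (θ * g)) ≡ q * P - ν * (a + q * b)
      split = solve-∀

  q*zeros : ∀ ν {n} t (a : Fin n → Fin q) → (∀ j → a j ≢ 0#) → (t < n → 2 ∣ q ∸ 1) →
    + q * zeros ν a (degrees t) ≡ (+ q - ν) ^ n + (+ q - 1ℤ) * α (θ * + q) ν (signs t a)
  q*zeros ν {n} t a a≢0 odd with distribution-≡ ν t a a≢0 odd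
  ... | β , mass , dist≡ = begin
    + q * zeros ν a (degrees t)                         ≡⟨ cong (+ q *_) (dist≡ 0#) ⟩
    + q * (α′ * δ 0# + β + γ′ * χ 0#)
      ≡⟨ cong₂ (λ d x → + q * (α′ * d + β + γ′ * x)) δ-0 χ-0 ⟩
    + q * (α′ * 1ℤ + β + γ′ * 0ℤ)                       ≡⟨ regroup (+ q) α′ β γ′ ⟩
    (α′ + + q * β) + (+ q - 1ℤ) * α′                    ≡⟨ cong (_+ (+ q - 1ℤ) * α′) mass ⟩
    (+ q - ν) ^ n + (+ q - 1ℤ) * α′                     ∎
    where
    open ≡-Reasoning
    α′ = α (θ * + q) ν (signs t a)
    γ′ = γ (θ * + q) ν (signs t a)
    regroup : ∀ q a b g → q * (a * 1ℤ + b + g * 0ℤ) ≡ (a + q * b) + (q - 1ℤ) * a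
    regroup = solve-∀

toℚᵘ-/ : ∀ {n} {{_ : NonZero n}} i → toℚᵘ (i ℚ./ n) ℚᵘ.≃ i ℚᵘ./ n
toℚᵘ-/ {suc d} i = ℚ.toℚᵘ-fromℚᵘ (mkℚᵘ i d)

module _ (n : ℕ) {{_ : NonZero n}} where

  ι≡*/ : ∀ i → ι i ≡ (+ n * i) ℚ./ n
  ι≡*/ i = ℚ.toℚᵘ-injective (ℚᵘ.≃-trans (ℚ.toℚᵘ-fromℚᵘ (mkℚᵘ i 0))
    (ℚᵘ.≃-trans (cross n) (ℚᵘ.≃-sym (toℚᵘ-/ (+ n * i)))))
    where
    cross : ∀ n {{_ : NonZero n}} → mkℚᵘ i 0 ℚᵘ.≃ (+ n * i) ℚᵘ./ n
    cross (suc d) = *≡* (trans (ℤ.*-comm i (+ suc d)) (sym (ℤ.*-identityʳ (+ suc d * i))))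

  /-+ : ∀ i j → i ℚ./ n ℚ.+ j ℚ./ n ≡ (i + j) ℚ./ n
  /-+ i j = ℚ.toℚᵘ-injective (ℚᵘ.≃-trans (ℚ.toℚᵘ-homo-+ (i ℚ./ n) (j ℚ./ n))
    (ℚᵘ.≃-trans (ℚᵘ.+-cong (toℚᵘ-/ i) (toℚᵘ-/ j))
    (ℚᵘ.≃-trans (cross n) (ℚᵘ.≃-sym (toℚᵘ-/ (i + j))))))
    where
    cross : ∀ n {{_ : NonZero n}} → (i ℚᵘ./ n) ℚᵘ.+ (j ℚᵘ./ n) ℚᵘ.≃ (i + j) ℚᵘ./ n
    cross (suc d) = *≡* (trans (collect i j (+ suc d)) (cong ((i + j) *_) (sym (ℤ.pos-* (suc d) (suc d)))))
      where
      collect : ∀ i j n → (i * n + j * n) * n ≡ (i + j) * (n * n)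
      collect = solve-∀

  /-- : ∀ i j → i ℚ./ n ℚ.- j ℚ./ n ≡ (i - j) ℚ./ n
  /-- i j = trans (cong (i ℚ./ n ℚ.+_) negate) (/-+ i (- j))
    where
    cross : ∀ n {{_ : NonZero n}} → ℚᵘ.- (j ℚᵘ./ n) ℚᵘ.≃ (- j) ℚᵘ./ n
    cross (suc d) = ℚᵘ.≃-refl
    negate : ℚ.- (j ℚ./ n) ≡ (- j) ℚ./ n
    negate = ℚ.toℚᵘ-injective (ℚᵘ.≃-trans (ℚ.toℚᵘ-homo‿- (j ℚ./ n))
      (ℚᵘ.≃-trans (ℚᵘ.-‿cong (toℚᵘ-/ j)) (ℚᵘ.≃-trans (cross n) (ℚᵘ.≃-sym (toℚᵘ-/ (- j))))))

  ι-+ : ∀ N X Y → + n * N ≡ + n * X + Y → ι N ≡ ι X ℚ.+ Y ℚ./ n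
  ι-+ N X Y eq = trans (ι≡*/ N) (trans (cong (ℚ._/ n) eq)
    (sym (trans (cong (ℚ._+ Y ℚ./ n) (ι≡*/ X)) (/-+ (+ n * X) Y))))

  ι-+- : ∀ N X Y Z → + n * N ≡ + n * X + Y - + n * Z → ι N ≡ ι X ℚ.+ Y ℚ./ n ℚ.- ι Z
  ι-+- N X Y Z eq = trans (ι≡*/ N) (trans (cong (ℚ._/ n) eq)
    (sym (trans (cong₂ (λ x z → x ℚ.+ Y ℚ./ n ℚ.- z) (ι≡*/ X) (ι≡*/ Z))
      (trans (cong (ℚ._- (+ n * Z) ℚ./ n) (/-+ (+ n * X) Y)) (/-- (+ n * X + Y) (+ n * Z))))))

  ι-+-- : ∀ N X Y Z W → + n * N ≡ + n * X + Y - + n * Z - + n * W →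
    ι N ≡ ι X ℚ.+ Y ℚ./ n ℚ.- ι Z ℚ.- ι W
  ι-+-- N X Y Z W eq = trans (ι≡*/ N) (trans (cong (ℚ._/ n) eq)
    (sym (trans (cong₂ (λ x y → x ℚ.- y)
      (trans (cong₂ (λ x z → x ℚ.+ Y ℚ./ n ℚ.- z) (ι≡*/ X) (ι≡*/ Z))
        (trans (cong (ℚ._- (+ n * Z) ℚ./ n) (/-+ (+ n * X) Y)) (/-- (+ n * X + Y) (+ n * Z))))
      (ι≡*/ W)) (/-- (+ n * X + Y - + n * Z) (+ n * W)))))

^-distrib-*ℤ : ∀ x y n → (x * y) ^ n ≡ x ^ n * y ^ n
^-distrib-*ℤ x y zero    = refl
^-distrib-*ℤ x y (suc n) = trans (cong (x * y *_) (^-distrib-*ℤ x y n)) (rearrange x y (x ^ n) (y ^ n))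
  where
  rearrange : ∀ x y u v → x * y * (u * v) ≡ (x * u) * (y * v)
  rearrange = solve-∀

-1^2n≡1 : ∀ n → -1ℤ ^ (2 ℕ.* n) ≡ 1ℤ
-1^2n≡1 zero    = refl
-1^2n≡1 (suc n) = trans (cong (-1ℤ ^_) (cong suc (ℕ.+-suc n (n ℕ.+ 0))))
  (trans (sym (ℤ.*-assoc -1ℤ -1ℤ (-1ℤ ^ (2 ℕ.* n)))) (trans (ℤ.*-identityˡ _) (-1^2n≡1 n)))

coprime-2 : ∀ {n} → 2 ∤ n → Coprime n 2
coprime-2 2∤n {0} (_ , 0∣2)   = contradiction (0∣⇒≡0 0∣2) λ ()
coprime-2 2∤n {1} _           = refl
coprime-2 2∤n {2} (2∣n , _)   = contradiction 2∣n 2∤n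
coprime-2 2∤n {suc (suc (suc d))} (_ , d∣2) with ∣⇒≤ d∣2
... | s≤s (s≤s ())

n≤1+2[n/2] : ∀ n → n ≤ suc (2 ℕ.* (n / 2))
n≤1+2[n/2] n = subst (_≤ suc (2 ℕ.* (n / 2))) (sym (m≡m%n+[m/n]*n n 2))
  (ℕ.+-mono-≤ (ℕ.s≤s⁻¹ (m%n<n n 2)) (ℕ.≤-reflexive (ℕ.*-comm (n / 2) 2)))

2∤n⇒n≡1+2[n/2] : ∀ n → 2 ∤ n → n ≡ suc (2 ℕ.* (n / 2))
2∤n⇒n≡1+2[n/2] n 2∤n with n % 2 | m%n<n n 2 | m≡m%n+[m/n]*n n 2
... | 0           | _           | n≡ = contradiction (divides (n / 2) n≡) 2∤n
... | 1           | _           | n≡ = trans n≡ (cong suc (ℕ.*-comm (n / 2) 2))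
... | suc (suc r) | s≤s (s≤s ()) | _

even-half : ∀ {n} → 2 ≤ n → 2 ∣ n → n ≡ 2 ℕ.* suc ((n ∸ 2) / 2) × n / 2 ≡ suc ((n ∸ 2) / 2)
even-half ()  (divides zero refl)
even-half 2≤n (divides (suc c) refl) =
  trans (ℕ.*-comm (suc c) 2) (cong (λ h → 2 ℕ.* suc h) (sym (m*n/n≡m c 2))) ,
  trans (m*n/n≡m (suc c) 2) (cong suc (sym (m*n/n≡m c 2)))

degrees-< : ∀ {n} t (j : Fin n) → toℕ j < t → degrees t j ≡ 1
degrees-< (suc t) zero    _         = refl
degrees-< (suc t) (suc j) (s≤s j<t) = degrees-< t j j<t

degrees-≥ : ∀ {n} t (j : Fin n) → t ≤ toℕ j → degrees t j ≡ 2
degrees-≥ zero    j       _         = refl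
degrees-≥ (suc t) (suc j) (s≤s t≤j) = degrees-≥ t j t≤j

module Transport {c ℓ} (F : FiniteField c ℓ) where
  open FiniteField F
  private
    module R = CommutativeRing commutativeRing
    module enumeration = Inverse enumeration

  element-injective : ∀ {i j} → element i ≈ element j → i ≡ j
  element-injective {i} {j} eq =
    trans (sym (enumeration.strictlyInverseʳ i)) (trans (enumeration.from-cong eq) (enumeration.strictlyInverseʳ j))

  element-index : ∀ x → element (index x) ≈ x
  element-index = enumeration.strictlyInverseˡ

  rawRing : RawRing _ _
  rawRing = record
    { Carrier = Fin q
    ; _≈_     = _≡_
    ; _+_     = λ i j → index (element i +ᶠ element j)
    ; _*_     = λ i j → index (element i *ᶠ element j)
    ; -_      = λ i → index (-ᶠ element i)
    ; 0#      = index 0#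
    ; 1#      = index 1#
    }

  element-isRingMonomorphism : IsRingMonomorphism rawRing R.rawRing element
  element-isRingMonomorphism = record
    { isRingHomomorphism = record
      { isSemiringHomomorphism = record
        { isNearSemiringHomomorphism = record
          { +-isMonoidHomomorphism = record
            { isMagmaHomomorphism = record
              { isRelHomomorphism = record { cong = enumeration.to-cong }
              ; homo = λ i j → element-index _
              }
            ; ε-homo = element-index _
            }
          ; *-homo = λ i j → element-index _
          }
        ; 1#-homo = element-index _
        }
      ; -‿homo = λ i → element-index _
      }
    ; injective = element-injective
    }

  𝔽 : FinField q
  𝔽 = record
    { isCommutativeRing = RingMonomorphism.isCommutativeRing element-isRingMonomorphism R.isCommutativeRing
    ; 1≢0               = λ eq → 1≉0 (R.trans (R.sym (element-index 1#)) (R.trans (enumeration.to-cong eq) (element-index 0#)))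
    ; inverse           = λ i i≢0 →
        let y , xy≈1 = inverse (element i) λ eq → i≢0 (element-injective (R.trans eq (R.sym (element-index 0#))))
        in  index y , element-injective (R.trans (element-index _) (R.trans (R.*-congˡ (element-index y))
                        (R.trans xy≈1 (R.sym (element-index 1#)))))
    }

  open FinFieldProperties 𝔽 public
    using (_≟_; x^n≡0; 0^n≡0; ∏-≡0)
    renaming (_*ᶠ_ to _*′_; -ᶠ_ to -′_; 0# to 0′; 1# to 1′; _^ᶠ_ to _^′_; ∑ᶠ to ∑′; ∏ᶠ to ∏′)
  open Points 𝔽 public
  open Exponentiation 𝔽 public
  open QuadraticCharacter 𝔽 public
  open Coefficients (θ * + q) χ public
  open Distribution 𝔽 public

  element-^ : ∀ i e → element (i ^′ e) ≈ element i ^ᶠ e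
  element-^ i zero    = element-index 1#
  element-^ i (suc e) = R.trans (element-index _) (R.*-congˡ (element-^ i e))

  element-∑ : ∀ {n} (f : Fin n → Fin q) → element (∑′ f) ≈ ∑ᶠ (element ∘ f)
  element-∑ {zero}  f = element-index 0#
  element-∑ {suc n} f = R.trans (element-index _) (R.+-congˡ (element-∑ (f ∘ suc)))

  element-∏ : ∀ {n} (f : Fin n → Fin q) → element (∏′ f) ≈ ∏ᶠ (element ∘ f)
  element-∏ {zero}  f = element-index 1#
  element-∏ {suc n} f = R.trans (element-index _) (R.*-congˡ (element-∏ (f ∘ suc)))

  ∑-congᶠ : ∀ {n} {f g : Fin n → Carrier} → (∀ i → f i ≈ g i) → ∑ᶠ f ≈ ∑ᶠ g
  ∑-congᶠ = CommutativeMonoidSum.sum-cong-≋ R.+-commutativeMonoid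

  ∏-congᶠ : ∀ {n} {f g : Fin n → Carrier} → (∀ i → f i ≈ g i) → ∏ᶠ f ≈ ∏ᶠ g
  ∏-congᶠ = CommutativeMonoidSum.sum-cong-≋ R.*-commutativeMonoid

  ^-congᶠ : ∀ {x y} e → x ≈ y → x ^ᶠ e ≈ y ^ᶠ e
  ^-congᶠ zero    eq = R.refl
  ^-congᶠ (suc e) eq = R.*-cong eq (^-congᶠ e eq)

  index-≡ : ∀ {x i} → x ≈ element i → index x ≡ i
  index-≡ eq = element-injective (R.trans (element-index _) eq)

  index-^ : ∀ x e → index (x ^ᶠ e) ≡ index x ^′ e
  index-^ x e = index-≡ (R.sym (R.trans (element-^ (index x) e) (^-congᶠ e (element-index x))))

  index-∏ : ∀ {n} (f : Fin n → Carrier) → index (∏ᶠ f) ≡ ∏′ (index ∘ f)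
  index-∏ f = index-≡ (R.sym (R.trans (element-∏ (index ∘ f)) (∏-congᶠ λ j → element-index (f j))))

  index-* : ∀ x y → index (x *ᶠ y) ≡ index x *′ index y
  index-* x y = index-≡ (R.sym (R.trans (element-index _) (R.*-cong (element-index x) (element-index y))))

  index-neg1 : index (-ᶠ 1#) ≡ -′ 1′
  index-neg1 = index-≡ (R.sym (R.trans (element-index _) (R.-‿cong (element-index 1#))))

  index-≢0 : ∀ {x} → x ≉ 0# → index x ≢ 0′
  index-≢0 x≉0 eq = x≉0 (R.trans (R.sym (element-index _)) (R.trans (enumeration.to-cong eq) (element-index 0#)))

  η≡χ : ∀ x → η x ≡ χ (index x)
  η≡χ x = cong₂ (λ u v → if u then 0ℤ else if v then 1ℤ else -1ℤ)
    (does-⇔ (mk⇔ enumeration.from-cong λ eq → R.trans (R.sym (element-index x)) (R.trans (enumeration.to-cong eq) (element-index 0#)))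
            (x ≈? 0#) (index x ≟ 0′))
    (does-⇔ (mk⇔ (λ (i , ii≈x) → i , element-injective (R.trans (element-index _) (R.trans ii≈x (R.sym (element-index x)))))
                 (λ (i , ii≡x) → i , R.trans (R.sym (element-index _)) (R.trans (enumeration.to-cong ii≡x) (element-index x))))
            (FiniteField.square? F x) (QuadraticCharacter.square? 𝔽 (index x)))

  module _ {n} (a : Fin n → Carrier) (b : Carrier) (k : ℕ) (κ m : Fin n → ℕ) where

    a′ : Fin n → Fin q
    a′ = index ∘ a

    solution? : (x : Vec (Fin q) n) → Dec (form a′ m x ^′ k ≡ index b *′ ∏′ (λ j → lookup x j ^′ κ j))
    solution? x = form a′ m x ^′ k ≟ index b *′ ∏′ (λ j → lookup x j ^′ κ j)

    solutionCount≡∑ⱽ : + solutionCount a b k κ m ≡ ∑ⱽ λ x → ⟦ solution? x ⟧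
    solutionCount≡∑ⱽ = trans
      (length-filter-tabulate (λ i → lhs i ≈? rhs i) id)
      (trans (∑-cong λ i → ⟦⟧-cong (lhs i ≈? rhs i) (solution? (decode i))
          (λ eq → element-injective (R.trans (element-lhs i) (R.trans eq (R.sym (element-rhs i)))))
          (λ eq → R.trans (R.sym (element-lhs i)) (R.trans (enumeration.to-cong eq) (element-rhs i))))
        (sym (∑ⱽ≡∑ λ x → ⟦ solution? x ⟧)))
      where
      lhs rhs : Fin (q ℕ.^ n) → Carrier
      lhs i = (∑ᶠ λ j → a j *ᶠ (point i j ^ᶠ m j)) ^ᶠ k
      rhs i = b *ᶠ (∏ᶠ λ j → point i j ^ᶠ κ j)
      coordinate : ∀ i j e → element (lookup (decode i) j ^′ e) ≈ point {n} i j ^ᶠ e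
      coordinate i j e = R.trans (element-^ _ e)
        (^-congᶠ e (R.reflexive (cong element (Vec.lookup∘tabulate (finToFun {q} {n} i) j))))
      element-lhs : ∀ i → element (form a′ m (decode i) ^′ k) ≈ lhs i
      element-lhs i = R.trans (element-^ _ k) (^-congᶠ k (R.trans (element-∑ λ j → a′ j *′ lookup (decode i) j ^′ m j) (∑-congᶠ λ j →
        R.trans (element-index _) (R.*-cong (element-index (a j)) (coordinate i j (m j))))))
      element-rhs : ∀ i → element (index b *′ ∏′ (λ j → lookup (decode i) j ^′ κ j)) ≈ rhs i
      element-rhs i = R.trans (element-index _) (R.*-cong (element-index b)
        (R.trans (element-∏ λ j → lookup (decode i) j ^′ κ j) (∏-congᶠ λ j → coordinate i j (κ j))))

    -- A solution with a vanishing coordinate is a zero of the form.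
    solutionCount-split : NonZero k → (∀ j → NonZero (κ j)) → + solutionCount a b k κ m ≡
      ∑ⱽ (λ x → ω 1ℤ x * ⟦ solution? x ⟧) + (zeros 0ℤ a′ m - zeros 1ℤ a′ m)
    solutionCount-split k≢0 κ≢0 = trans solutionCount≡∑ⱽ (trans (∑ⱽ-cong split)
      (trans (∑ⱽ-+ (λ x → ω 1ℤ x * ⟦ solution? x ⟧) λ x → ω 0ℤ x * δ′ x + -1ℤ * (ω 1ℤ x * δ′ x))
        (cong (_+_ (∑ⱽ λ x → ω 1ℤ x * ⟦ solution? x ⟧)) (trans (∑ⱽ-+ (λ x → ω 0ℤ x * δ′ x) λ x → -1ℤ * (ω 1ℤ x * δ′ x))
          (cong (_+_ (zeros 0ℤ a′ m)) (trans (∑ⱽ-scale -1ℤ λ x → ω 1ℤ x * δ′ x) (ℤ.-1*i≡-i _)))))))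
      where
      δ′ : Vec (Fin q) n → ℤ
      δ′ x = ⟦ form a′ m x ≟ 0′ ⟧
      split : ∀ x → ⟦ solution? x ⟧ ≡ ω 1ℤ x * ⟦ solution? x ⟧ + (ω 0ℤ x * δ′ x + -1ℤ * (ω 1ℤ x * δ′ x))
      split x with ω₁-cases x
      ... | inj₁ (ω≡1 , _) = sym (trans
        (cong₂ (λ o z → o * ⟦ solution? x ⟧ + (z * δ′ x + -1ℤ * (o * δ′ x))) ω≡1 (ω₀≡1 x)) (evaluate ⟦ solution? x ⟧ (δ′ x)))
        where
        evaluate : ∀ s d → 1ℤ * s + (1ℤ * d + -1ℤ * (1ℤ * d)) ≡ s
        evaluate = solve-∀
      ... | inj₂ (ω≡0 , j , xj≡0) = sym (trans
        (cong₂ (λ o z → o * ⟦ solution? x ⟧ + (z * δ′ x + -1ℤ * (o * δ′ x))) ω≡0 (ω₀≡1 x))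
        (trans (evaluate ⟦ solution? x ⟧ (δ′ x)) (⟦⟧-cong (form a′ m x ≟ 0′) (solution? x)
          (λ S≡0 → trans (trans (cong (_^′ k) S≡0) (0^n≡0 k {{k≢0}})) (sym rhs≡0))
          (λ eq → x^n≡0 k (trans eq rhs≡0)))))
        where
        evaluate : ∀ s d → 0ℤ * s + (1ℤ * d + -1ℤ * (0ℤ * d)) ≡ d
        evaluate = solve-∀
        rhs≡0 : index b *′ ∏′ (λ j → lookup x j ^′ κ j) ≡ 0′
        rhs≡0 = trans (cong (index b *′_) (∏-≡0 (λ j → lookup x j ^′ κ j) j
          (trans (cong (_^′ κ j) xj≡0) (0^n≡0 (κ j) {{κ≢0 j}})))) (FinFieldProperties.zeroʳ 𝔽 (index b))

  module Count {n} (a : Fin n → Carrier) (b : Carrier) (a≉0 : ∀ j → a j ≉ 0#) (b≉0 : b ≉ 0#)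
           (k : ℕ) (κ m : Fin n → ℕ)
           (k≢0 : NonZero k) (κ≢0 : ∀ j → NonZero (κ j)) (m≢0 : ∀ j → NonZero (m j)) where
    open Exponents q k κ m k≢0 m≢0

    private
      N  = + solutionCount a b k κ m
      Q  = + q
      K₀ = + k₀

    module Reduced (t : ℕ) (odd-d : ∀ j → toℕ j < t → 2 ∤ d j) (even-d : ∀ j → t ≤ toℕ j → 2 ∣ d j)
             (coprime : ∀ i j → i ≢ j → Coprime (halved t i) (halved t j))
             (b-power : ∃ λ y → b ≈ y ^ᶠ k₀) (gcd≡1 : exponentGcd ≡ 1ℤ) where

      2∣q∸1 : t < n → 2 ∣ q ∸ 1
      2∣q∸1 t<n = ∣-trans (even-d j (ℕ.≤-reflexive (sym (Fin.toℕ-fromℕ< t<n)))) (gcd[m,n]∣n (m j) (q ∸ 1))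
        where j = fromℕ< t<n

      halved-< : ∀ j → toℕ j < t → halved t j ≡ d j
      halved-< j j<t = cong (if_then d j else (d j / 2)) (dec-true (toℕ j ℕ.<? t) j<t)

      halved-≥ : ∀ j → t ≤ toℕ j → halved t j ≡ d j / 2
      halved-≥ j t≤j = cong (if_then d j else (d j / 2)) (dec-false (toℕ j ℕ.<? t) (ℕ.≤⇒≯ t≤j))

      d≡degrees*halved : ∀ j → d j ≡ degrees t j ℕ.* halved t j
      d≡degrees*halved j with ℕ.<-≤-connex (toℕ j) t
      ... | inj₁ j<t = sym (trans (cong₂ ℕ._*_ (degrees-< t j j<t) (halved-< j j<t)) (ℕ.*-identityˡ (d j)))
      ... | inj₂ t≤j = sym (trans (cong₂ ℕ._*_ (degrees-≥ t j t≤j) (halved-≥ j t≤j))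
                                  (trans (ℕ.*-comm 2 (d j / 2)) (m/n*n≡m (even-d j t≤j))))

      degrees-cases : ∀ j → (degrees t j ≡ 1 × Coprime (halved t j) 2) ⊎ degrees t j ≡ 2
      degrees-cases j with ℕ.<-≤-connex (toℕ j) t
      ... | inj₁ j<t = inj₁ (degrees-< t j j<t ,
                             subst (λ h → Coprime h 2) (sym (halved-< j j<t)) (coprime-2 (odd-d j j<t)))
      ... | inj₂ t≤j = inj₂ (degrees-≥ t j t≤j)

      zeros-degrees : ∀ ν → zeros ν (index ∘ a) m ≡ zeros ν (index ∘ a) (degrees t)
      zeros-degrees ν = zeros-exponents ν (index ∘ a) m (degrees t) m≢0
        (λ j → ∣-trans (subst (degrees t j ∣_) (sym (d≡degrees*halved j)) (∣m⇒∣m*n (halved t j) ∣-refl))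
                       (gcd[m,n]∣m (m j) (q ∸ 1)))
        λ x x≢0 → let s , s≢0 , h = simultaneousPowers m (degrees t) (halved t) d≡degrees*halved degrees-cases coprime x x≢0
                  in  s , s≢0 , λ j → let isPower v v≢0 eq = h j in v , v≢0 , eq

      α₀ α₁ : ℤ
      α₀ = α (θ * Q) 0ℤ (signs t (index ∘ a))
      α₁ = α (θ * Q) 1ℤ (signs t (index ∘ a))

      Q*N : Q * N ≡ (K₀ - 1ℤ) * (Q - 1ℤ) ^ n - (K₀ + Q - 1ℤ) * α₁ + Q ^ n + (Q - 1ℤ) * α₀
      Q*N = ℤ.*-cancelˡ-≡ (Q - 1ℤ) _ _ (begin
        (Q - 1ℤ) * (Q * N)
          ≡⟨ cong (λ z → (Q - 1ℤ) * (Q * z)) (solutionCount-split a b k κ m k≢0 κ≢0) ⟩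
        (Q - 1ℤ) * (Q * (T + (z₀ - z₁)))
          ≡⟨ separate Q T z₀ z₁ ⟩
        Q * ((Q - 1ℤ) * T) + (Q - 1ℤ) * (Q * z₀ - Q * z₁)
          ≡⟨ cong (λ z → Q * z + (Q - 1ℤ) * (Q * z₀ - Q * z₁)) torus ⟩
        Q * (K₀ * ((Q - 1ℤ) ^ n - z₁)) + (Q - 1ℤ) * (Q * z₀ - Q * z₁)
          ≡⟨ gather Q K₀ ((Q - 1ℤ) ^ n) z₀ z₁ ⟩
        K₀ * (Q * (Q - 1ℤ) ^ n - Q * z₁) + (Q - 1ℤ) * (Q * z₀ - Q * z₁)
          ≡⟨ cong₂ (λ u v → K₀ * (Q * (Q - 1ℤ) ^ n - u) + (Q - 1ℤ) * (v - u)) Qz₁ Qz₀ ⟩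
        K₀ * (Q * (Q - 1ℤ) ^ n - ((Q - 1ℤ) ^ n + (Q - 1ℤ) * α₁)) +
          (Q - 1ℤ) * (Q ^ n + (Q - 1ℤ) * α₀ - ((Q - 1ℤ) ^ n + (Q - 1ℤ) * α₁))
          ≡⟨ collect Q K₀ ((Q - 1ℤ) ^ n) (Q ^ n) α₀ α₁ ⟩
        (Q - 1ℤ) * ((K₀ - 1ℤ) * (Q - 1ℤ) ^ n - (K₀ + Q - 1ℤ) * α₁ + Q ^ n + (Q - 1ℤ) * α₀) ∎)
        where
        open ≡-Reasoning
        open TorusSolutions 𝔽 k κ m k≢0 m≢0 using (torusSolutions; torusSolutions-≡)
        index-power : ∃ λ y → index b ≡ y ^′ k₀
        index-power = index (proj₁ b-power) , trans (enumeration.from-cong (proj₂ b-power)) (index-^ _ k₀)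
        T  = ∑ⱽ λ x → ω 1ℤ x * ⟦ solution? a b k κ m x ⟧
        z₀ = zeros 0ℤ (index ∘ a) m
        z₁ = zeros 1ℤ (index ∘ a) m
        torus : (Q - 1ℤ) * T ≡ K₀ * ((Q - 1ℤ) ^ n - z₁)
        torus = torusSolutions-≡ (index ∘ a) (index-≢0 b≉0) index-power gcd≡1
        Qz₁ : Q * z₁ ≡ (Q - 1ℤ) ^ n + (Q - 1ℤ) * α₁
        Qz₁ = trans (cong (Q *_) (zeros-degrees 1ℤ)) (q*zeros 1ℤ t (index ∘ a) (index-≢0 ∘ a≉0) 2∣q∸1)
        Qz₀ : Q * z₀ ≡ Q ^ n + (Q - 1ℤ) * α₀
        Qz₀ = trans (cong (Q *_) (zeros-degrees 0ℤ)) (trans (q*zeros 0ℤ t (index ∘ a) (index-≢0 ∘ a≉0) 2∣q∸1)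
          (cong (λ z → z ^ n + (Q - 1ℤ) * α₀) (ℤ.+-identityʳ Q)))
        separate : ∀ Q T u v → (Q - 1ℤ) * (Q * (T + (u - v))) ≡ Q * ((Q - 1ℤ) * T) + (Q - 1ℤ) * (Q * u - Q * v)
        separate = solve-∀
        gather : ∀ Q K P u v → Q * (K * (P - v)) + (Q - 1ℤ) * (Q * u - Q * v) ≡ K * (Q * P - Q * v) + (Q - 1ℤ) * (Q * u - Q * v)
        gather = solve-∀
        collect : ∀ Q K P R a b → K * (Q * P - (P + (Q - 1ℤ) * b)) + (Q - 1ℤ) * (R + (Q - 1ℤ) * a - (P + (Q - 1ℤ) * b)) ≡
                  (Q - 1ℤ) * ((K - 1ℤ) * P - (K + Q - 1ℤ) * b + R + (Q - 1ℤ) * a)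
        collect = solve-∀

      signs-η : ∀ {l} (f : Fin l → Carrier) → tabulate (χ ∘ index ∘ f) ≡ tabulate (λ i → η (f i))
      signs-η f = List.tabulate-cong λ i → sym (η≡χ (f i))

      module _ (odd-q : 2 ∣ q ∸ 1) where

        η-neg1^ : ∀ j → η ((-ᶠ 1#) ^ᶠ j) ≡ θ ^ j
        η-neg1^ j = trans (η≡χ _) (trans (cong χ (trans (index-^ (-ᶠ 1#) j) (cong (_^′ j) index-neg1)))
                                         (χ-^ odd-q (-′ 1′) j))

        η-discriminant : ∀ h → η (((-ᶠ 1#) ^ᶠ h) *ᶠ ∏ᶠ a) ≡ θ ^ h * ∏ℤ (tabulate λ i → η (a i))
        η-discriminant h = begin
          η (((-ᶠ 1#) ^ᶠ h) *ᶠ ∏ᶠ a)                               ≡⟨ trans (η≡χ _) (cong χ (index-* _ _)) ⟩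
          χ (index ((-ᶠ 1#) ^ᶠ h) *′ index (∏ᶠ a))                 ≡⟨ χ-* odd-q _ _ ⟩
          χ (index ((-ᶠ 1#) ^ᶠ h)) * χ (index (∏ᶠ a))
            ≡⟨ cong₂ _*_ (trans (sym (η≡χ _)) (η-neg1^ h)) (trans (cong χ (index-∏ a)) (χ-∏ (index ∘ a))) ⟩
          θ ^ h * ∏ℤ (tabulate (χ ∘ index ∘ a))                    ≡⟨ cong (λ l → θ ^ h * ∏ℤ l) (signs-η a) ⟩
          θ ^ h * ∏ℤ (tabulate λ i → η (a i))                      ∎
          where
          open ≡-Reasoning
          χ-∏ : ∀ {l} (f : Fin l → Fin q) → χ (∏′ f) ≡ ∏ℤ (tabulate (χ ∘ f))
          χ-∏ {zero}  f = χ-^ odd-q 1′ 0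
          χ-∏ {suc l} f = trans (χ-* odd-q (f zero) _) (cong (χ (f zero) *_) (χ-∏ (f ∘ suc)))

        σ-even≡ : ∀ J zs → σ-even (θ * Q) J zs ≡
          1ℤ + Q * ∑₁ J (λ j → η ((-ᶠ 1#) ^ᶠ j) * σ (2 ℕ.* j) zs * Q ^ (j ∸ 1))
        σ-even≡ zero    zs = cong (_+_ 1ℤ) (sym (ℤ.*-zeroʳ Q))
        σ-even≡ (suc J) zs = begin
          σ-even (θ * Q) J zs + τ * (θ * Q) ^ suc J
            ≡⟨ cong₂ (λ e p → e + τ * p) (σ-even≡ J zs) (^-distrib-*ℤ θ Q (suc J)) ⟩
          1ℤ + Q * ∑₁ J f + τ * (θ ^ suc J * Q ^ suc J)      ≡⟨ regroup Q (∑₁ J f) τ (θ ^ suc J) (Q ^ J) ⟩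
          1ℤ + Q * (∑₁ J f + θ ^ suc J * τ * Q ^ J)
            ≡⟨ cong (λ z → 1ℤ + Q * (∑₁ J f + z * τ * Q ^ J)) (η-neg1^ (suc J)) ⟨
          1ℤ + Q * (∑₁ J f + f (suc J))                      ≡⟨ cong (λ z → 1ℤ + Q * z) (∑₁-suc J f) ⟨
          1ℤ + Q * ∑₁ (suc J) f                              ∎
          where
          open ≡-Reasoning
          τ = σ (2 ℕ.* suc J) zs
          f = λ j → η ((-ᶠ 1#) ^ᶠ j) * σ (2 ℕ.* j) zs * Q ^ (j ∸ 1)
          regroup : ∀ Q S τ x y → 1ℤ + Q * S + τ * (x * (Q * y)) ≡ 1ℤ + Q * (S + x * τ * y)
          regroup = solve-∀

      α₁≡ : ∀ J → n ∸ t ≤ suc (2 ℕ.* J) → α₁ ≡ -1ℤ ^ n * σ-even (θ * Q) J (drop t (tabulate λ i → η (a i)))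
      α₁≡ J n-t≤ = trans (proj₁ (αγ₁ t (index ∘ a) J n-t≤))
        (cong (λ l → -1ℤ ^ n * σ-even (θ * Q) J (drop t l)) (signs-η a))

      module Formulas (2≤n : 2 ≤ n) where

        private
          s : ℤ
          s = -1ℤ ^ n

          ηs : List ℤ
          ηs = tabulate λ i → η (a i)

          length-ηs : length ηs ≡ n
          length-ηs = List.length-tabulate λ i → η (a i)

          n≢0 : n ≢ 0
          n≢0 = ℕ.m<n⇒n≢0 2≤n

          Q^n≡ : Q ^ n ≡ Q * Q ^ (n ∸ 1)
          Q^n≡ = cong (Q ^_) (sym (ℕ.m+[n∸m]≡n (ℕ.n≢0⇒n>0 n≢0)))

          α₀≡0 : ¬ (t ≡ 0 × 2 ∣ n) → α₀ ≡ 0ℤ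
          α₀≡0 = vanish t (index ∘ a) n≢0
            where
            vanish : ∀ t {n} (a : Fin n → Fin q) → n ≢ 0 → ¬ (t ≡ 0 × 2 ∣ n) → α (θ * Q) 0ℤ (signs t a) ≡ 0ℤ
            vanish t       {zero}  a n≢0 _ = contradiction refl n≢0
            vanish (suc t) {suc n} a _   _ = α₀-linear t a
            vanish zero    {suc n} a _   h = trans (cong (α (θ * Q) 0ℤ) (signs-0 a))
              (α₀-odd (suc n / 2) (tabulate (χ ∘ a))
                (trans (List.length-tabulate (χ ∘ a)) (2∤n⇒n≡1+2[n/2] (suc n) λ 2∣n → h (refl , 2∣n))))

        formula-allOdd : t ≡ n →
          ι N ≡ ι (Q ^ (n ∸ 1) - -1ℤ ^ n) ℚ.+ ((K₀ - 1ℤ) * ((Q - 1ℤ) ^ n - -1ℤ ^ n)) ℚ./ q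
        formula-allOdd t≡n = ι-+ q N (Q ^ (n ∸ 1) - s) ((K₀ - 1ℤ) * ((Q - 1ℤ) ^ n - s)) (begin
          Q * N
            ≡⟨ Q*N ⟩
          (K₀ - 1ℤ) * (Q - 1ℤ) ^ n - (K₀ + Q - 1ℤ) * α₁ + Q ^ n + (Q - 1ℤ) * α₀
            ≡⟨ cong₂ (λ u v → (K₀ - 1ℤ) * (Q - 1ℤ) ^ n - (K₀ + Q - 1ℤ) * u + Q ^ n + (Q - 1ℤ) * v)
                 (α₁≡ 0 (subst (λ t → n ∸ t ≤ 1) (sym t≡n) (subst (_≤ 1) (sym (ℕ.n∸n≡0 n)) z≤n)))
                 (α₀≡0 λ (t≡0 , _) → n≢0 (trans (sym t≡n) t≡0)) ⟩
          (K₀ - 1ℤ) * (Q - 1ℤ) ^ n - (K₀ + Q - 1ℤ) * (s * 1ℤ) + Q ^ n + (Q - 1ℤ) * 0ℤ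
            ≡⟨ cong (λ z → (K₀ - 1ℤ) * (Q - 1ℤ) ^ n - (K₀ + Q - 1ℤ) * (s * 1ℤ) + z + (Q - 1ℤ) * 0ℤ) Q^n≡ ⟩
          (K₀ - 1ℤ) * (Q - 1ℤ) ^ n - (K₀ + Q - 1ℤ) * (s * 1ℤ) + Q * Q ^ (n ∸ 1) + (Q - 1ℤ) * 0ℤ
            ≡⟨ collect K₀ ((Q - 1ℤ) ^ n) Q s (Q ^ (n ∸ 1)) ⟩
          Q * (Q ^ (n ∸ 1) - s) + (K₀ - 1ℤ) * ((Q - 1ℤ) ^ n - s) ∎)
          where
          open ≡-Reasoning
          collect : ∀ K X Q s R → (K - 1ℤ) * X - (K + Q - 1ℤ) * (s * 1ℤ) + Q * R + (Q - 1ℤ) * 0ℤ ≡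
                    Q * (R - s) + (K - 1ℤ) * (X - s)
          collect = solve-∀

        formula-mixed : t < n → ¬ (t ≡ 0 × 2 ∣ n) →
          ι N ≡
            ι (Q ^ (n ∸ 1) - -1ℤ ^ n)
            ℚ.+ ((K₀ - 1ℤ) * ((Q - 1ℤ) ^ n - -1ℤ ^ n)) ℚ./ q
            ℚ.- ι (-1ℤ ^ n * (K₀ + Q - 1ℤ) *
                   ∑₁ ((n ∸ t) / 2) λ j →
                     η ((-ᶠ 1#) ^ᶠ j) * σ (2 ℕ.* j) (drop t (tabulate λ i → η (a i))) * Q ^ (j ∸ 1))
        formula-mixed t<n ¬even = ι-+- q N (Q ^ (n ∸ 1) - s) ((K₀ - 1ℤ) * ((Q - 1ℤ) ^ n - s)) (s * (K₀ + Q - 1ℤ) * S) (begin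
          Q * N
            ≡⟨ Q*N ⟩
          (K₀ - 1ℤ) * (Q - 1ℤ) ^ n - (K₀ + Q - 1ℤ) * α₁ + Q ^ n + (Q - 1ℤ) * α₀
            ≡⟨ cong₂ (λ u v → (K₀ - 1ℤ) * (Q - 1ℤ) ^ n - (K₀ + Q - 1ℤ) * u + Q ^ n + (Q - 1ℤ) * v)
                 (trans (α₁≡ J (n≤1+2[n/2] (n ∸ t))) (cong (s *_) (σ-even≡ (2∣q∸1 t<n) J (drop t ηs)))) (α₀≡0 ¬even) ⟩
          (K₀ - 1ℤ) * (Q - 1ℤ) ^ n - (K₀ + Q - 1ℤ) * (s * (1ℤ + Q * S)) + Q ^ n + (Q - 1ℤ) * 0ℤ
            ≡⟨ cong (λ z → (K₀ - 1ℤ) * (Q - 1ℤ) ^ n - (K₀ + Q - 1ℤ) * (s * (1ℤ + Q * S)) + z + (Q - 1ℤ) * 0ℤ) Q^n≡ ⟩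
          (K₀ - 1ℤ) * (Q - 1ℤ) ^ n - (K₀ + Q - 1ℤ) * (s * (1ℤ + Q * S)) + Q * Q ^ (n ∸ 1) + (Q - 1ℤ) * 0ℤ
            ≡⟨ collect K₀ ((Q - 1ℤ) ^ n) Q s (Q ^ (n ∸ 1)) S ⟩
          Q * (Q ^ (n ∸ 1) - s) + (K₀ - 1ℤ) * ((Q - 1ℤ) ^ n - s) - Q * (s * (K₀ + Q - 1ℤ) * S) ∎)
          where
          open ≡-Reasoning
          J = (n ∸ t) / 2
          S = ∑₁ J λ j → η ((-ᶠ 1#) ^ᶠ j) * σ (2 ℕ.* j) (drop t ηs) * Q ^ (j ∸ 1)
          collect : ∀ K X Q s R S → (K - 1ℤ) * X - (K + Q - 1ℤ) * (s * (1ℤ + Q * S)) + Q * R + (Q - 1ℤ) * 0ℤ ≡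
                    Q * (R - s) + (K - 1ℤ) * (X - s) - Q * (s * (K + Q - 1ℤ) * S)
          collect = solve-∀

        formula-allEven : t ≡ 0 → 2 ∣ n →
          ι N ≡
            ι (Q ^ (n ∸ 1) - 1ℤ)
            ℚ.+ ((K₀ - 1ℤ) * ((Q - 1ℤ) ^ n - 1ℤ)) ℚ./ q
            ℚ.- ι (K₀ * η (((-ᶠ 1#) ^ᶠ (n / 2)) *ᶠ ∏ᶠ a) * Q ^ ((n ∸ 2) / 2))
            ℚ.- ι ((K₀ + Q - 1ℤ) *
                   ∑₁ ((n ∸ 2) / 2) λ j →
                     η ((-ᶠ 1#) ^ᶠ j) * σ (2 ℕ.* j) (tabulate λ i → η (a i)) * Q ^ (j ∸ 1))
        formula-allEven t≡0 2∣n = ι-+-- q N (Q ^ (n ∸ 1) - 1ℤ) ((K₀ - 1ℤ) * ((Q - 1ℤ) ^ n - 1ℤ))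
          (K₀ * D * Q ^ h) ((K₀ + Q - 1ℤ) * S) (begin
          Q * N
            ≡⟨ Q*N ⟩
          (K₀ - 1ℤ) * (Q - 1ℤ) ^ n - (K₀ + Q - 1ℤ) * α₁ + Q ^ n + (Q - 1ℤ) * α₀
            ≡⟨ cong₂ (λ u v → (K₀ - 1ℤ) * (Q - 1ℤ) ^ n - (K₀ + Q - 1ℤ) * u + Q ^ n + (Q - 1ℤ) * v) α₁≡′ α₀≡′ ⟩
          (K₀ - 1ℤ) * (Q - 1ℤ) ^ n - (K₀ + Q - 1ℤ) * (1ℤ + Q * S + D * (Q * Q ^ h)) + Q ^ n + (Q - 1ℤ) * (D * (Q * Q ^ h))
            ≡⟨ cong (λ z → (K₀ - 1ℤ) * (Q - 1ℤ) ^ n - (K₀ + Q - 1ℤ) * (1ℤ + Q * S + D * (Q * Q ^ h)) + z + (Q - 1ℤ) * (D * (Q * Q ^ h))) Q^n≡ ⟩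
          (K₀ - 1ℤ) * (Q - 1ℤ) ^ n - (K₀ + Q - 1ℤ) * (1ℤ + Q * S + D * (Q * Q ^ h)) + Q * Q ^ (n ∸ 1) + (Q - 1ℤ) * (D * (Q * Q ^ h))
            ≡⟨ collect K₀ ((Q - 1ℤ) ^ n) Q (Q ^ (n ∸ 1)) S D (Q ^ h) ⟩
          Q * (Q ^ (n ∸ 1) - 1ℤ) + (K₀ - 1ℤ) * ((Q - 1ℤ) ^ n - 1ℤ) - Q * (K₀ * D * Q ^ h) - Q * ((K₀ + Q - 1ℤ) * S) ∎)
          where
          open ≡-Reasoning
          h = (n ∸ 2) / 2
          D = η (((-ᶠ 1#) ^ᶠ (n / 2)) *ᶠ ∏ᶠ a)
          S = ∑₁ h λ j → η ((-ᶠ 1#) ^ᶠ j) * σ (2 ℕ.* j) ηs * Q ^ (j ∸ 1)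
          odd-q : 2 ∣ q ∸ 1
          odd-q = 2∣q∸1 (subst (_< n) (sym t≡0) (ℕ.n≢0⇒n>0 n≢0))
          n≡2[1+h] : n ≡ 2 ℕ.* suc h
          n≡2[1+h] = proj₁ (even-half 2≤n 2∣n)
          length≡ : length ηs ≡ 2 ℕ.* suc h
          length≡ = trans length-ηs n≡2[1+h]
          topTerm : ∏ℤ ηs * (θ * Q) ^ suc h ≡ D * (Q * Q ^ h)
          topTerm = begin
            ∏ℤ ηs * (θ * Q) ^ suc h             ≡⟨ cong (∏ℤ ηs *_) (^-distrib-*ℤ θ Q (suc h)) ⟩
            ∏ℤ ηs * (θ ^ suc h * Q ^ suc h)     ≡⟨ rearrange (∏ℤ ηs) (θ ^ suc h) (Q ^ suc h) ⟩
            θ ^ suc h * ∏ℤ ηs * Q ^ suc h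
              ≡⟨ cong (λ e → θ ^ e * ∏ℤ ηs * Q ^ suc h) (proj₂ (even-half 2≤n 2∣n)) ⟨
            θ ^ (n / 2) * ∏ℤ ηs * Q ^ suc h     ≡⟨ cong (_* Q ^ suc h) (η-discriminant odd-q (n / 2)) ⟨
            D * (Q * Q ^ h)                     ∎
            where
            rearrange : ∀ x y z → x * (y * z) ≡ y * x * z
            rearrange = solve-∀
          α₀≡′ : α₀ ≡ D * (Q * Q ^ h)
          α₀≡′ = begin
            α (θ * Q) 0ℤ (signs t (index ∘ a))    ≡⟨ cong (λ t → α (θ * Q) 0ℤ (signs t (index ∘ a))) t≡0 ⟩
            α (θ * Q) 0ℤ (signs 0 (index ∘ a))
              ≡⟨ cong (α (θ * Q) 0ℤ) (trans (signs-0 (index ∘ a)) (signs-η a)) ⟩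
            α (θ * Q) 0ℤ ηs                       ≡⟨ α₀-even (suc h) ηs length≡ ⟩
            ∏ℤ ηs * (θ * Q) ^ suc h               ≡⟨ topTerm ⟩
            D * (Q * Q ^ h)                       ∎
          α₁≡′ : α₁ ≡ 1ℤ + Q * S + D * (Q * Q ^ h)
          α₁≡′ = begin
            α₁
              ≡⟨ α₁≡ (suc h) (ℕ.≤-trans (ℕ.m∸n≤m n t) (ℕ.m≤n⇒m≤1+n (ℕ.≤-reflexive n≡2[1+h]))) ⟩
            s * σ-even (θ * Q) (suc h) (drop t ηs)
              ≡⟨ cong₂ (λ u t → u * σ-even (θ * Q) (suc h) (drop t ηs)) (trans (cong (-1ℤ ^_) n≡2[1+h]) (-1^2n≡1 (suc h))) t≡0 ⟩
            1ℤ * σ-even (θ * Q) (suc h) ηs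
              ≡⟨ ℤ.*-identityˡ _ ⟩
            σ-even (θ * Q) h ηs + σ (2 ℕ.* suc h) ηs * (θ * Q) ^ suc h
              ≡⟨ cong₂ (λ u v → u + v * (θ * Q) ^ suc h) (σ-even≡ odd-q h ηs) (trans (cong (λ r → σ r ηs) (sym length≡)) (σ-length ηs)) ⟩
            1ℤ + Q * S + ∏ℤ ηs * (θ * Q) ^ suc h
              ≡⟨ cong (_+_ (1ℤ + Q * S)) topTerm ⟩
            1ℤ + Q * S + D * (Q * Q ^ h) ∎
          collect : ∀ K X Q R S D P →
            (K - 1ℤ) * X - (K + Q - 1ℤ) * (1ℤ + Q * S + D * (Q * P)) + Q * R + (Q - 1ℤ) * (D * (Q * P)) ≡
            Q * (R - 1ℤ) + (K - 1ℤ) * (X - 1ℤ) - Q * (K * D * P) - Q * ((K + Q - 1ℤ) * S)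
          collect = solve-∀

theorem3 :
  ∀ {c ℓ} (F : FiniteField c ℓ) → let open FiniteField F in
  (n : ℕ) → 2 ≤ n →
  (a : Fin n → Carrier) (b : Carrier) → (∀ j → a j ≉ 0#) → b ≉ 0# →
  (k : ℕ) (κ m : Fin n → ℕ)
  (k≢0 : NonZero k) (κ≢0 : ∀ j → NonZero (κ j)) (m≢0 : ∀ j → NonZero (m j)) →
  let open Exponents q k κ m k≢0 m≢0
      N  = solutionCount a b k κ m
      Q  = + q
      K₀ = + k₀
  in
  (t : ℕ) → t ≤ n →
  (∀ j → toℕ j < t → 2 ∤ d j) →
  (∀ j → t ≤ toℕ j → 2 ∣ d j) →
  (∀ i j → i ≢ j → Coprime (halved t i) (halved t j)) →
  (∃ λ y → b ≈ y ^ᶠ k₀) →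
  exponentGcd ≡ 1ℤ →
  (t ≡ 0 → 2 ∣ n →
    ι (+ N) ≡
      ι (Q ^ (n ∸ 1) - 1ℤ)
      ℚ.+ ((K₀ - 1ℤ) * ((Q - 1ℤ) ^ n - 1ℤ)) ℚ./ q
      ℚ.- ι (K₀ * η (((-ᶠ 1#) ^ᶠ (n / 2)) *ᶠ ∏ᶠ a) * Q ^ ((n ∸ 2) / 2))
      ℚ.- ι ((K₀ + Q - 1ℤ) *
             ∑₁ ((n ∸ 2) / 2) λ j →
               η ((-ᶠ 1#) ^ᶠ j) * σ (2 ℕ.* j) (tabulate λ i → η (a i)) * Q ^ (j ∸ 1)))
  ×
  (t ≡ n →
    ι (+ N) ≡
      ι (Q ^ (n ∸ 1) - -1ℤ ^ n)
      ℚ.+ ((K₀ - 1ℤ) * ((Q - 1ℤ) ^ n - -1ℤ ^ n)) ℚ./ q)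
  ×
  (¬ (t ≡ 0 × 2 ∣ n) → t ≢ n →
    ι (+ N) ≡
      ι (Q ^ (n ∸ 1) - -1ℤ ^ n)
      ℚ.+ ((K₀ - 1ℤ) * ((Q - 1ℤ) ^ n - -1ℤ ^ n)) ℚ./ q
      ℚ.- ι (-1ℤ ^ n * (K₀ + Q - 1ℤ) *
             ∑₁ ((n ∸ t) / 2) λ j →
               η ((-ᶠ 1#) ^ᶠ j) * σ (2 ℕ.* j) (drop t (tabulate λ i → η (a i))) * Q ^ (j ∸ 1)))
theorem3 F n 2≤n a b a≉0 b≉0 k κ m k≢0 κ≢0 m≢0 t t≤n odd-d even-d coprime b-power gcd≡1 =
  formula-allEven ,
  formula-allOdd ,
  λ ¬allEven t≢n → formula-mixed (ℕ.≤∧≢⇒< t≤n t≢n) ¬allEven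
  where
  open Transport.Count.Reduced.Formulas F a b a≉0 b≉0 k κ m k≢0 κ≢0 m≢0
    t odd-d even-d coprime b-power gcd≡1 2≤n
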